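{- Fix a constant $\Delta>0$. For each $n$ let ${\bf d}=(d_1,\ldots,d_n)$ be a degree sequence with $1\le d_i\le \Delta$ for all $1\le i\le n$, and let ${\mathcal G}({\bf d})$ be the uniformly random simple graph on vertex set $[n]$ with degree sequence ${\bf d}$. Let $n_j=|\{i: d_i=j\}|$. \begin{enumerate} \item[(a)] If $n_1=o(n^{1/2})$ and $n_2=o(n)$, then asymptotically almost surely ${\mathcal G}({\bf d})$ is asymmetric. \item[(b)] If $n_1=\omega(n^{1/2})$, then asymptotically almost surely ${\mathcal G}({\bf d})$ is symmetric. \item[(c)] If there is a constant $c>0$ such that $n_1>cn^{1/2}$ or $n_2>cn$, then there is $\delta=\delta(c)>0$ such that for all sufficiently large $n$, ${\mathbb P}({\mathcal G}({\bf d})\text{ is symmetric})>\delta$. \end{enumerate}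
   Context: Degree sequences are assumed graphical with even sum. A graph is asymmetric if its automorphism group contains only the identity permutation, and symmetric otherwise. Asymptotics are as $n\to\infty$; "asymptotically almost surely" (a.a.s.) means with probability tending to $1$. $a_n=o(b_n)$ means $a_n/b_n\to 0$; $a_n=\omega(b_n)$ means $b_n=o(a_n)$ and $a_n>0$ for all large $n$. -}

module Defs where

open import Data.Nat using (ℕ; zero; suc; _+_; _*_; _≤_; _<_)
open import Data.Fin using (Fin; zero; suc)
open import Data.Fin.Permutation using (Permutation′; _⟨$⟩ʳ_)
open import Data.Vec using (Vec; []; _∷_; lookup)
open import Data.List using (List; []; _∷_; [_]; map; concatMap; length; filter; allFin)
open import Data.Nat.ListAction using (sum)
open import Data.Bool using (Bool; true; false; if_then_else_)
open import Data.Product using (Σ; ∃; _×_; _,_)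
open import Relation.Nullary using (¬_)
open import Relation.Binary.PropositionalEquality using (_≡_)
import Data.Nat as ℕ

-- A labelled simple graph on vertex set Fin n.  A graph on suc n vertices is
-- the adjacency vector of the new vertex 'zero' to the old vertices 'suc k',
-- together with a graph on the old vertices.  This is a bijective encoding of
-- all simple graphs on [n] (symmetric, irreflexive by construction).
Graph : ℕ → Set
Graph zero = Vec Bool 0
Graph (suc n) = Vec Bool n × Graph n

adj : ∀ {n} → Graph n → Fin n → Fin n → Bool
adj {suc n} (v , g) zero zero = false
adj {suc n} (v , g) zero (suc j) = lookup v j
adj {suc n} (v , g) (suc i) zero = lookup v i
adj {suc n} (v , g) (suc i) (suc j) = adj g i j

allVecs : (m : ℕ) → List (Vec Bool m)
allVecs zero = [ [] ]
allVecs (suc m) = concatMap (λ v → (true ∷ v) ∷ (false ∷ v) ∷ []) (allVecs m)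

allGraphs : (n : ℕ) → List (Graph n)
allGraphs zero = [ [] ]
allGraphs (suc n) = concatMap (λ v → map (λ g → (v , g)) (allGraphs n)) (allVecs n)

deg : ∀ {n} → Graph n → Fin n → ℕ
deg {n} g i = sum (map (λ j → if adj g i j then 1 else 0) (allFin n))

HasDegrees : ∀ {n} → (Fin n → ℕ) → Graph n → Set
HasDegrees ds g = ∀ i → deg g i ≡ ds i

Graphical : ∀ {n} → (Fin n → ℕ) → Set
Graphical {n} ds = Σ (Graph n) (HasDegrees ds)

IsAutomorphism : ∀ {n} → Graph n → Permutation′ n → Set
IsAutomorphism g σ = ∀ i j → adj g (σ ⟨$⟩ʳ i) (σ ⟨$⟩ʳ j) ≡ adj g i j

Asymmetric : ∀ {n} → Graph n → Set
Asymmetric {n} g = (σ : Permutation′ n) → IsAutomorphism g σ → ∀ i → σ ⟨$⟩ʳ i ≡ i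

Symmetric : ∀ {n} → Graph n → Set
Symmetric g = ¬ Asymmetric g

data CountIs {A : Set} (P : A → Set) : List A → ℕ → Set where
  nil : CountIs P [] 0
  yes : ∀ {x xs k} → P x → CountIs P xs k → CountIs P (x ∷ xs) (suc k)
  no  : ∀ {x xs k} → ¬ P x → CountIs P xs k → CountIs P (x ∷ xs) k

-- For the uniform random graph G(ds): P(G(ds) has property Q) = s / t.
ProbCounts : ∀ {n} → (Fin n → ℕ) → (Graph n → Set) → ℕ → ℕ → Set
ProbCounts {n} ds Q s t =
  CountIs (HasDegrees ds) (allGraphs n) t ×
  CountIs (λ g → HasDegrees ds g × Q g) (allGraphs n) s

DegSeqs : Set
DegSeqs = (n : ℕ) → Fin n → ℕ

Eventually : (ℕ → Set) → Set
Eventually P = ∃ λ N → ∀ n → N ≤ n → P n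

nj : ∀ {n} → (Fin n → ℕ) → ℕ → ℕ
nj {n} ds j = length (filter (λ i → ds i ℕ.≟ j) (allFin n))

-- a.a.s. Q: for every e, eventually P(Q) ≥ 1 - 1/(e+1), i.e. e·t ≤ (e+1)·s
AAS : DegSeqs → (∀ {n} → Graph n → Set) → Set
AAS d Q = ∀ (e : ℕ) → Eventually λ n →
  ∃ λ s → ∃ λ t → ProbCounts (d n) Q s t × e * t ≤ suc e * s

-- The main tool is double counting over switchings: replacing the edges xy, ab by xa, yb preserves degrees, and since
-- degrees are bounded it shows that, conditionally on other edges, a given edge is present with probability O(1/n).
--
-- Symmetric graphs are found by creating a pair of twins: if u and v are leaves, one switching creates the isolated
-- edge uv; if u and v have degree 2, two switchings create an ear, that is, a triangle uvz.  Comparing the numbers of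
-- switchings forwards and backwards bounds the graphs without such a structure.
--
-- For asymmetry, let S be the set of vertices moved by an automorphism.  Every vertex outside S has 0 or at least 2
-- neighbours in S, so the edges meeting S number at least half the degree sum of S plus the number of outside
-- neighbours.  For |S| at most a small fraction of n, a first moment bound over S and its outside neighbourhood shows
-- that this is unlikely.  For larger |S| the graph is determined by the automorphism and one edge from each orbit; such
-- data have about n^(M - c|S|) values, M being the number of edges, whereas switchings give at least
-- n^(M - εn) e^(-O(n)) graphs for every ε > 0.
module Submission where

open import Defs hiding (yes; no)
open import Data.Bool using (Bool; true; false; if_then_else_; T; not; _xor_)
import Data.Bool.Properties as Bool
open import Data.Bool.Properties using (T?)
open import Data.Empty using (⊥; ⊥-elim)
open import Data.Fin using (Fin; zero; suc; toℕ; fromℕ<; combine; remQuot; _≟_)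
open import Data.Fin.Permutation using (_⟨$⟩ʳ_; permutation; transpose; inverseˡ; inverseʳ)
open import Data.Fin.Properties using (any?; all?; toℕ-injective; toℕ<n; toℕ-fromℕ<; pigeonhole; remQuot-combine; combine-remQuot; combine-injective; combine-monoˡ-<)
import Data.List as List
open import Data.List using (List; []; _∷_; _++_; map; concatMap; length; filter; allFin; take)
open import Data.List.Membership.Propositional using (_∈_)
open import Data.List.Membership.Propositional.Properties using (∈-allFin)
import Data.List.Properties as List
import Data.List.Relation.Unary.All as All
open import Data.List.Relation.Unary.All using (All; []; _∷_)
import Data.List.Relation.Unary.All.Properties as All
open import Data.List.Relation.Unary.AllPairs using ([]; _∷_)
open import Data.List.Relation.Unary.Any using (here; there)
open import Data.List.Relation.Unary.Unique.Propositional using (Unique)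
import Data.List.Relation.Unary.Unique.Propositional.Properties as Unique
import Data.Nat as ℕ
open import Data.Nat using (ℕ; zero; suc; _+_; _*_; _∸_; _^_; _≤_; _<_; z≤n; s≤s; _≤?_; _<?_; _/_; _%_; NonZero; >-nonZero)
open import Data.Nat.DivMod using (m≡m%n+[m/n]*n; m%n<n; m/n*n≤m; m*n/n≡m; /-monoˡ-≤)
import Data.Nat.Induction as ℕInd
open import Data.Nat.ListAction using (sum)
open import Data.Nat.Properties hiding (_≟_; _≤?_; _<?_)
open import Data.Nat.Tactic.RingSolver using (solve-∀)
open import Data.Product using (Σ; ∃; ∃₂; _×_; _,_; proj₁; proj₂)
open import Data.Product.Properties using (≡-dec)
open import Data.Sum using (_⊎_; inj₁; inj₂; [_,_]′)
open import Data.Unit using (tt)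
import Data.Vec as Vec
open import Data.Vec using (Vec; []; _∷_; lookup)
import Data.Vec.Properties as Vec
open import Function using (_∘_; id)
open import Induction.WellFounded using (Acc; acc)
open import Relation.Binary.PropositionalEquality using (_≡_; _≢_; refl; sym; trans; cong; cong₂; subst; subst₂; module ≡-Reasoning)
open import Relation.Nullary using (¬_; Dec; yes; no; does; contradiction; ¬?; _×-dec_; _⊎-dec_; _→-dec_)
open import Relation.Nullary.Decidable using (map′)

-- Probabilities occur only as pairs of counts and exponential bounds as inequalities of powers;
-- denominators are cleared by a common power that is cancelled at the end. In the small range the
-- obstacle is that light vertices lie on few edges. With m = |S|, take a near sqrt(n/m), so that
-- each edge demanded at S costs about m/n = 1/a^2. An admissible S with degree sum D and outside
-- neighbourhood F then costs a^-(D + 2|F|). Summing over F is harmless, as n/a^2 is O(m); summing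
-- over S gives the product of the factors 1 + L/a^(d i), where L is the gain wanted per vertex of
-- S. This is e^O(m) if n1 L/a, n2 L/a^2 and n L/a^3 are at most m. At m = 1 the first two ask for
-- n1 small against sqrt n and n2 small against n; the third limits m to a small fraction of n. In
-- the large range the obstacle is an orbit of half-edges that is its own reverse: it uses up only
-- one half-edge at a root, so recording it as a pair would spoil the count. Such an edge is
-- determined by its first vertex, and a mark on that vertex is enough; all marks together cost 2^n.

private variable
  n : ℕ

-- Decidable propositions as numbers

𝕀 : Bool → ℕ
𝕀 b = if b then 1 else 0

-- Iverson bracket, taken of a decision.
⟦_⟧ : {P : Set} → Dec P → ℕ
⟦ p? ⟧ = 𝕀 (does p?)

⟦⟧-yes : {P : Set} → (p? : Dec P) → P → ⟦ p? ⟧ ≡ 1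
⟦⟧-yes (yes _) _ = refl
⟦⟧-yes (no ¬p) p = contradiction p ¬p

⟦⟧-≥1 : {P : Set} → (p? : Dec P) → P → 1 ≤ ⟦ p? ⟧
⟦⟧-≥1 (yes _) _ = ≤-refl
⟦⟧-≥1 (no ¬p) p = contradiction p ¬p

⟦⟧-no : {P : Set} → (p? : Dec P) → ¬ P → ⟦ p? ⟧ ≡ 0
⟦⟧-no (yes p) ¬p = contradiction p ¬p
⟦⟧-no (no _) _ = refl

⟦⟧≤1 : {P : Set} → (p? : Dec P) → ⟦ p? ⟧ ≤ 1
⟦⟧≤1 (yes _) = ≤-refl
⟦⟧≤1 (no _) = z≤n

⟦⟧≤ : {P : Set} → (p? : Dec P) {k : ℕ} → (P → 1 ≤ k) → ⟦ p? ⟧ ≤ k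
⟦⟧≤ (yes p) h = h p
⟦⟧≤ (no _) h = z≤n

⟦⟧*≤ : {P : Set} → (p? : Dec P) {a b : ℕ} → (P → a ≤ b) → ⟦ p? ⟧ * a ≤ b
⟦⟧*≤ (yes p) {a} h = ≤-trans (≤-reflexive (*-identityˡ a)) (h p)
⟦⟧*≤ (no _) h = z≤n

⟦⟧-pos : {P : Set} → (p? : Dec P) → ⟦ p? ⟧ ≢ 0 → P
⟦⟧-pos (yes p) _ = p
⟦⟧-pos (no _) h = contradiction refl h

⟦⟧-cong : {P Q : Set} → (p? : Dec P) (q? : Dec Q) → (P → Q) → (Q → P) → ⟦ p? ⟧ ≡ ⟦ q? ⟧
⟦⟧-cong (yes p) q? f g = sym (⟦⟧-yes q? (f p))
⟦⟧-cong (no ¬p) q? f g = sym (⟦⟧-no q? (¬p ∘ g))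

⟦⟧-mono : {P Q : Set} → (p? : Dec P) (q? : Dec Q) → (P → Q) → ⟦ p? ⟧ ≤ ⟦ q? ⟧
⟦⟧-mono p? q? f = ⟦⟧≤ p? (λ p → ⟦⟧-≥1 q? (f p))

⟦⟧-× : {P Q : Set} → (p? : Dec P) (q? : Dec Q) → ⟦ p? ×-dec q? ⟧ ≡ ⟦ p? ⟧ * ⟦ q? ⟧
⟦⟧-× (yes _) q? = sym (+-identityʳ _)
⟦⟧-× (no _) q? = refl

⟦⟧-¬ : {P : Set} → (p? : Dec P) → ⟦ p? ⟧ + ⟦ ¬? p? ⟧ ≡ 1
⟦⟧-¬ (yes _) = refl
⟦⟧-¬ (no _) = refl

≡0⇒≤ : ∀ {a b} → a ≡ 0 → a ≤ b
≡0⇒≤ refl = z≤n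

≢0⇒≥1 : ∀ {k} → k ≢ 0 → 1 ≤ k
≢0⇒≥1 {zero} h = contradiction refl h
≢0⇒≥1 {suc k} h = s≤s z≤n

*≢0ˡ : ∀ a {b} → a * b ≢ 0 → a ≢ 0
*≢0ˡ zero h _ = h refl

*≢0ʳ : ∀ a {b} → a * b ≢ 0 → b ≢ 0
*≢0ʳ a h refl = h (*-zeroʳ a)

-- Finite sums over lists

∑ : {A : Set} → List A → (A → ℕ) → ℕ
∑ xs f = sum (map f xs)

∑-cong : {A : Set} → (xs : List A) {f g : A → ℕ} → (∀ x → f x ≡ g x) → ∑ xs f ≡ ∑ xs g
∑-cong [] h = refl
∑-cong (x ∷ xs) h = cong₂ _+_ (h x) (∑-cong xs h)

∑-mono : {A : Set} → (xs : List A) {f g : A → ℕ} → (∀ x → f x ≤ g x) → ∑ xs f ≤ ∑ xs g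
∑-mono [] h = z≤n
∑-mono (x ∷ xs) h = +-mono-≤ (h x) (∑-mono xs h)

∑-zero : {A : Set} → (xs : List A) {f : A → ℕ} → (∀ x → f x ≡ 0) → ∑ xs f ≡ 0
∑-zero [] h = refl
∑-zero (x ∷ xs) h = cong₂ _+_ (h x) (∑-zero xs h)

∑-+ : {A : Set} → (xs : List A) (f g : A → ℕ) → ∑ xs (λ x → f x + g x) ≡ ∑ xs f + ∑ xs g
∑-+ [] f g = refl
∑-+ (x ∷ xs) f g = trans (cong (f x + g x +_) (∑-+ xs f g)) (lem (f x) (g x) (∑ xs f) (∑ xs g))
  where
  lem : ∀ a b c d → a + b + (c + d) ≡ a + c + (b + d)
  lem = solve-∀

∑-*ˡ : {A : Set} → (xs : List A) (c : ℕ) (f : A → ℕ) → ∑ xs (λ x → c * f x) ≡ c * ∑ xs f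
∑-*ˡ [] c f = sym (*-zeroʳ c)
∑-*ˡ (x ∷ xs) c f = trans (cong (c * f x +_) (∑-*ˡ xs c f)) (sym (*-distribˡ-+ c (f x) _))

∑-*ʳ : {A : Set} → (xs : List A) (c : ℕ) (f : A → ℕ) → ∑ xs (λ x → f x * c) ≡ ∑ xs f * c
∑-*ʳ xs c f = trans (∑-cong xs (λ x → *-comm (f x) c)) (trans (∑-*ˡ xs c f) (*-comm c _))

∑-swap : {A B : Set} → (xs : List A) (ys : List B) (f : A → B → ℕ) →
  ∑ xs (λ x → ∑ ys (f x)) ≡ ∑ ys (λ y → ∑ xs (λ x → f x y))
∑-swap [] ys f = sym (∑-zero ys (λ _ → refl))
∑-swap (x ∷ xs) ys f = trans (cong (∑ ys (f x) +_) (∑-swap xs ys f)) (sym (∑-+ ys (f x) _))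

∑-map : {A B : Set} → (g : A → B) (xs : List A) (f : B → ℕ) → ∑ (map g xs) f ≡ ∑ xs (f ∘ g)
∑-map g [] f = refl
∑-map g (x ∷ xs) f = cong (f (g x) +_) (∑-map g xs f)

∑-++ : {A : Set} → (xs ys : List A) (f : A → ℕ) → ∑ (xs ++ ys) f ≡ ∑ xs f + ∑ ys f
∑-++ [] ys f = refl
∑-++ (x ∷ xs) ys f = trans (cong (f x +_) (∑-++ xs ys f)) (sym (+-assoc (f x) _ _))

∑-concatMap : {A B : Set} → (g : A → List B) (xs : List A) (f : B → ℕ) →
  ∑ (concatMap g xs) f ≡ ∑ xs (λ x → ∑ (g x) f)
∑-concatMap g [] f = refl
∑-concatMap g (x ∷ xs) f = trans (∑-++ (g x) _ f) (cong (∑ (g x) f +_) (∑-concatMap g xs f))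

∑-nonzero : {A : Set} → (xs : List A) (f : A → ℕ) → ∑ xs f ≢ 0 → ∃ λ x → f x ≢ 0
∑-nonzero [] f h = contradiction refl h
∑-nonzero (x ∷ xs) f h with f x ℕ.≟ 0
... | no ¬z = x , ¬z
... | yes z = ∑-nonzero xs f (λ e → h (cong₂ _+_ z e))

-- If all terms vanish there is nothing to prove, so the bound may be derived from the data attached
-- to one nonzero term.
∑-bounded : {A : Set} → (xs : List A) (f : A → ℕ) (c : ℕ) → (∀ x → f x ≢ 0 → ∑ xs f ≤ c) → ∑ xs f ≤ c
∑-bounded xs f c h with ∑ xs f ℕ.≟ 0
... | yes z = ≡0⇒≤ z
... | no ¬z = let (x , fx) = ∑-nonzero xs f ¬z in h x fx

double-count : {A B : Set} → (xs : List A) (ys : List B) (r : A → B → ℕ) (p : A → ℕ) (q : B → ℕ) →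
  (∀ x → p x ≤ ∑ ys (r x)) → (∀ y → ∑ xs (λ x → r x y) ≤ q y) → ∑ xs p ≤ ∑ ys q
double-count xs ys r p q hp hq = begin
  ∑ xs p                            ≤⟨ ∑-mono xs hp ⟩
  ∑ xs (λ x → ∑ ys (r x))           ≡⟨ ∑-swap xs ys r ⟩
  ∑ ys (λ y → ∑ xs (λ x → r x y))   ≤⟨ ∑-mono ys hq ⟩
  ∑ ys q                            ∎
  where open ≤-Reasoning

-- Completeness and absence of repetitions are stated together as an equation between sums; `pick`
-- follows from it without any reasoning about list membership.
record Enumeration (A : Set) : Set where
  field
    elements : List A
    _≟ᴱ_ : (x y : A) → Dec (x ≡ y)
    once : ∀ a → ∑ elements (λ x → ⟦ a ≟ᴱ x ⟧) ≡ 1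

  pick : (a : A) (f : A → ℕ) → ∑ elements (λ x → ⟦ a ≟ᴱ x ⟧ * f x) ≡ f a
  pick a f = begin
    ∑ elements (λ x → ⟦ a ≟ᴱ x ⟧ * f x) ≡⟨ ∑-cong elements (λ x → lem x (a ≟ᴱ x)) ⟩
    ∑ elements (λ x → ⟦ a ≟ᴱ x ⟧ * f a) ≡⟨ ∑-*ʳ elements (f a) (λ x → ⟦ a ≟ᴱ x ⟧) ⟩
    ∑ elements (λ x → ⟦ a ≟ᴱ x ⟧) * f a ≡⟨ cong (_* f a) (once a) ⟩
    1 * f a                            ≡⟨ *-identityˡ (f a) ⟩
    f a                                ∎
    where
    open ≡-Reasoning
    lem : ∀ x (e : Dec (a ≡ x)) → ⟦ e ⟧ * f x ≡ ⟦ e ⟧ * f a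
    lem x (yes refl) = refl
    lem x (no _) = refl

  term≤∑ : (f : A → ℕ) (a : A) → f a ≤ ∑ elements f
  term≤∑ f a = subst (_≤ ∑ elements f) (pick a f)
    (∑-mono elements (λ x → ⟦⟧*≤ (a ≟ᴱ x) (λ _ → ≤-refl)))

  ∑-atMostOne : (f : A → ℕ) (c : ℕ) → (∀ x → f x ≤ c) →
    (∀ x y → f x ≢ 0 → f y ≢ 0 → x ≡ y) → ∑ elements f ≤ c
  ∑-atMostOne f c f≤c uniq = ∑-bounded elements f c λ a fa → begin
    ∑ elements f                          ≤⟨ ∑-mono elements (λ x → lem a fa x) ⟩
    ∑ elements (λ x → ⟦ a ≟ᴱ x ⟧ * f x)   ≡⟨ pick a f ⟩
    f a                                  ≤⟨ f≤c a ⟩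
    c                                    ∎
    where
    open ≤-Reasoning
    lem : ∀ a → f a ≢ 0 → ∀ x → f x ≤ ⟦ a ≟ᴱ x ⟧ * f x
    lem a fa x with f x ℕ.≟ 0
    ... | yes z = ≡0⇒≤ z
    ... | no ¬z = ≤-reflexive (sym (trans (cong (λ k → k * f x) (⟦⟧-yes (a ≟ᴱ x) (uniq a x fa ¬z))) (*-identityˡ _)))

open Enumeration public

-- The left inverse is required only where `p` is nonzero. This suits switchings, which can be
-- undone only if they were admissible: `p` encodes the admissibility.
∑-retract : {A B : Set} → (EA : Enumeration A) (EB : Enumeration B) (f : A → B) (g : B → A) (p : A → ℕ) (q : B → ℕ) →
  (∀ x → p x ≢ 0 → g (f x) ≡ x × p x ≤ q (f x)) → ∑ (elements EA) p ≤ ∑ (elements EB) q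
∑-retract EA EB f g p q h =
  double-count (elements EA) (elements EB) (λ x y → ⟦ _≟ᴱ_ EB (f x) y ⟧ * p x) p q
    (λ x → ≤-reflexive (sym (pick EB (f x) (λ _ → p x))))
    (λ y → ∑-atMostOne EA _ (q y) (bound y) (uniq y))
  where
  p≤q : ∀ x → Dec (p x ≡ 0) → p x ≤ q (f x)
  p≤q x (yes z) = ≡0⇒≤ z
  p≤q x (no ¬z) = proj₂ (h x ¬z)
  bound : ∀ y x → ⟦ _≟ᴱ_ EB (f x) y ⟧ * p x ≤ q y
  bound y x = ⟦⟧*≤ (_≟ᴱ_ EB (f x) y) λ where refl → p≤q x (p x ℕ.≟ 0)
  src : ∀ y x → ⟦ _≟ᴱ_ EB (f x) y ⟧ * p x ≢ 0 → x ≡ g y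
  src y x ne with _≟ᴱ_ EB (f x) y
  ... | yes refl = sym (proj₁ (h x (λ e → ne (trans (+-identityʳ _) e))))
  ... | no _ = contradiction refl ne
  uniq : ∀ y x x′ → ⟦ _≟ᴱ_ EB (f x) y ⟧ * p x ≢ 0 → ⟦ _≟ᴱ_ EB (f x′) y ⟧ * p x′ ≢ 0 → x ≡ x′
  uniq y x x′ a b = trans (src y x a) (sym (src y x′ b))

-- Variant for maps that are known to be injective but come without an inverse, such as codes that
-- are decoded only by comparing two of them.
∑-inject : {A B : Set} → (EA : Enumeration A) (EB : Enumeration B) (f : A → B) (p : A → ℕ) (q : B → ℕ) →
  (∀ x y → p x ≢ 0 → p y ≢ 0 → f x ≡ f y → x ≡ y) → (∀ x → p x ≤ q (f x)) →
  ∑ (elements EA) p ≤ ∑ (elements EB) q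
∑-inject EA EB f p q inj p≤q =
  double-count (elements EA) (elements EB) (λ x y → ⟦ _≟ᴱ_ EB (f x) y ⟧ * p x) p q
    (λ x → ≤-reflexive (sym (pick EB (f x) (λ _ → p x))))
    (λ y → ∑-atMostOne EA _ (q y) (λ x → ⟦⟧*≤ (_≟ᴱ_ EB (f x) y) λ where refl → p≤q x) (uniq y))
  where
  uniq : ∀ y x x′ → ⟦ _≟ᴱ_ EB (f x) y ⟧ * p x ≢ 0 → ⟦ _≟ᴱ_ EB (f x′) y ⟧ * p x′ ≢ 0 → x ≡ x′
  uniq y x x′ a b = inj x x′ (*≢0ʳ ⟦ _≟ᴱ_ EB (f x) y ⟧ a) (*≢0ʳ ⟦ _≟ᴱ_ EB (f x′) y ⟧ b)
    (trans (⟦⟧-pos (_≟ᴱ_ EB (f x) y) (*≢0ˡ _ a)) (sym (⟦⟧-pos (_≟ᴱ_ EB (f x′) y) (*≢0ˡ _ b))))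

∑F : (Fin n → ℕ) → ℕ
∑F {n} = ∑ (allFin n)

∑F-suc : (f : Fin (suc n) → ℕ) → ∑F f ≡ f zero + ∑F (f ∘ suc)
∑F-suc {n} f = cong (λ l → f zero + sum l) (trans (List.map-tabulate suc f) (sym (List.map-tabulate id (f ∘ suc))))

∑F-const : ∀ c → ∑F {n} (λ _ → c) ≡ n * c
∑F-const {zero} c = refl
∑F-const {suc n} c = trans (∑F-suc {n} (λ _ → c)) (cong (c +_) (∑F-const {n} c))

finE : ∀ n → Enumeration (Fin n)
finE n = record { elements = allFin n ; _≟ᴱ_ = _≟_ ; once = one }
  where
  one : ∀ {n} (a : Fin n) → ∑F (λ x → ⟦ a ≟ x ⟧) ≡ 1
  one {suc n} zero = trans (∑F-suc {n} (λ x → ⟦ zero ≟ x ⟧)) (cong suc (∑-zero (allFin n) (λ _ → refl)))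
  one {suc n} (suc a) = trans (∑F-suc {n} (λ x → ⟦ suc a ≟ x ⟧)) (one a)

vecE : ∀ n → Enumeration (Vec Bool n)
vecE n = record { elements = allVecs n ; _≟ᴱ_ = Vec.≡-dec Bool._≟_ ; once = one }
  where
  _≟v_ : ∀ {n} (u v : Vec Bool n) → Dec (u ≡ v)
  _≟v_ = Vec.≡-dec Bool._≟_
  one : ∀ {n} (a : Vec Bool n) → ∑ (allVecs n) (λ x → ⟦ a ≟v x ⟧) ≡ 1
  one [] = refl
  one {suc n} (b ∷ a) = trans (∑-concatMap _ (allVecs n) _) (trans (∑-cong (allVecs n) (step b)) (one a))
    where
    step : ∀ b v → ⟦ (b ∷ a) ≟v (true ∷ v) ⟧ + (⟦ (b ∷ a) ≟v (false ∷ v) ⟧ + 0) ≡ ⟦ a ≟v v ⟧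
    step true v = +-identityʳ _
    step false v = +-identityʳ _

graphE : ∀ n → Enumeration (Graph n)
graphE n = record { elements = allGraphs n ; _≟ᴱ_ = _≟g_ ; once = one }
  where
  _≟g_ : ∀ {n} (g h : Graph n) → Dec (g ≡ h)
  _≟g_ {zero} [] [] = yes refl
  _≟g_ {suc n} = ≡-dec (_≟ᴱ_ (vecE n)) _≟g_
  one : ∀ {n} (a : Graph n) → ∑ (allGraphs n) (λ x → ⟦ a ≟g x ⟧) ≡ 1
  one {zero} [] = refl
  one {suc n} (v , g) = trans (∑-concatMap _ (allVecs n) _) (trans (∑-cong (allVecs n) step) (once (vecE n) v))
    where
    step : ∀ w → ∑ (map (λ h → (w , h)) (allGraphs n)) (λ x → ⟦ (v , g) ≟g x ⟧) ≡ ⟦ _≟ᴱ_ (vecE n) v w ⟧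
    step w = trans (∑-map _ (allGraphs n) _) (trans (∑-cong (allGraphs n) (λ h → lem (_≟ᴱ_ (vecE n) v w) h))
      (trans (∑-*ˡ (allGraphs n) ⟦ _≟ᴱ_ (vecE n) v w ⟧ (λ h → ⟦ g ≟g h ⟧)) (trans (cong (⟦ _≟ᴱ_ (vecE n) v w ⟧ *_) (one g)) (*-identityʳ _))))
      where
      lem : (e : Dec (v ≡ w)) → ∀ h → ⟦ (v , g) ≟g (w , h) ⟧ ≡ ⟦ e ⟧ * ⟦ g ≟g h ⟧
      lem e h with g ≟g h
      lem (yes refl) h | yes refl = ⟦⟧-yes ((v , g) ≟g (v , g)) refl
      lem (yes refl) h | no ne = ⟦⟧-no ((v , g) ≟g (v , h)) λ where refl → ne refl
      lem (no ne) h | _ = ⟦⟧-no ((v , g) ≟g (w , h)) λ where refl → ne refl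

T⇒≡ : ∀ {b} → T b → b ≡ true
T⇒≡ {true} _ = refl

≡⇒T : ∀ {b} → b ≡ true → T b
≡⇒T refl = tt

𝕀-T : ∀ {b} → T b → 1 ≤ 𝕀 b
𝕀-T {true} _ = ≤-refl

¬T⇒≡ : ∀ {b} → ¬ T b → b ≡ false
¬T⇒≡ {true} h = contradiction tt h
¬T⇒≡ {false} _ = refl

T-ext : ∀ {b c} → (T b → T c) → (T c → T b) → b ≡ c
T-ext {true} {true} f g = refl
T-ext {false} {false} f g = refl
T-ext {true} {false} f g = ⊥-elim (f tt)
T-ext {false} {true} f g = ⊥-elim (g tt)

-- Switchings

Adj : Graph n → Fin n → Fin n → Set
Adj G i j = T (adj G i j)

adj? : (G : Graph n) (i j : Fin n) → Dec (Adj G i j)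
adj? G i j = T? (adj G i j)

adj-sym : (G : Graph n) (i j : Fin n) → adj G i j ≡ adj G j i
adj-sym {suc n} (v , G) zero zero = refl
adj-sym {suc n} (v , G) zero (suc j) = refl
adj-sym {suc n} (v , G) (suc i) zero = refl
adj-sym {suc n} (v , G) (suc i) (suc j) = adj-sym G i j

adj-irrefl : (G : Graph n) (i : Fin n) → adj G i i ≡ false
adj-irrefl {suc n} (v , G) zero = refl
adj-irrefl {suc n} (v , G) (suc i) = adj-irrefl G i

Adj-sym : (G : Graph n) {i j : Fin n} → Adj G i j → Adj G j i
Adj-sym G {i} {j} = subst T (adj-sym G i j)

Adj⇒≢ : (G : Graph n) {i j : Fin n} → Adj G i j → i ≢ j
Adj⇒≢ G {i} a refl = subst T (adj-irrefl G i) a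

graph-ext : (G H : Graph n) → (∀ i j → adj G i j ≡ adj H i j) → G ≡ H
graph-ext {zero} [] [] h = refl
graph-ext {suc n} (v , G) (w , H) h = cong₂ _,_ (vec-ext v w (λ i → h zero (suc i))) (graph-ext G H (λ i j → h (suc i) (suc j)))
  where
  vec-ext : ∀ {m} (v w : Vec Bool m) → (∀ i → lookup v i ≡ lookup w i) → v ≡ w
  vec-ext [] [] h = refl
  vec-ext (x ∷ v) (y ∷ w) h = cong₂ _∷_ (h zero) (vec-ext v w (h ∘ suc))

fromAdj : (Fin n → Fin n → Bool) → Graph n
fromAdj {zero} f = []
fromAdj {suc n} f = Vec.tabulate (λ j → f zero (suc j)) , fromAdj (λ i j → f (suc i) (suc j))

adj-fromAdj : (f : Fin n → Fin n → Bool) → (∀ i j → f i j ≡ f j i) → (∀ i → f i i ≡ false) →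
  ∀ i j → adj (fromAdj f) i j ≡ f i j
adj-fromAdj {suc n} f s r zero zero = sym (r zero)
adj-fromAdj {suc n} f s r zero (suc j) = Vec.lookup∘tabulate _ j
adj-fromAdj {suc n} f s r (suc i) zero = trans (Vec.lookup∘tabulate _ i) (s zero (suc i))
adj-fromAdj {suc n} f s r (suc i) (suc j) = adj-fromAdj _ (λ i j → s (suc i) (suc j)) (λ i → r (suc i)) i j

SamePair : (p q i j : Fin n) → Set
SamePair p q i j = (p ≡ i × q ≡ j) ⊎ (p ≡ j × q ≡ i)

samePair? : (p q i j : Fin n) → Dec (SamePair p q i j)
samePair? p q i j = (p ≟ i ×-dec q ≟ j) ⊎-dec (p ≟ j ×-dec q ≟ i)

does-≡ : {P Q : Set} (p? : Dec P) (q? : Dec Q) → (P → Q) → (Q → P) → does p? ≡ does q?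
does-≡ (yes p) (yes q) f g = refl
does-≡ (yes p) (no ¬q) f g = contradiction (f p) ¬q
does-≡ (no ¬p) (yes q) f g = contradiction (g q) ¬p
does-≡ (no ¬p) (no ¬q) f g = refl

does-yes : {P : Set} (p? : Dec P) → P → does p? ≡ true
does-yes (yes _) _ = refl
does-yes (no ¬p) p = contradiction p ¬p

does-no : {P : Set} (p? : Dec P) → ¬ P → does p? ≡ false
does-no (yes p) ¬p = contradiction p ¬p
does-no (no _) _ = refl

xor-false : ∀ b → b xor false ≡ b
xor-false true = refl
xor-false false = refl

xor-cancel : ∀ b c → (b xor c) xor c ≡ b
xor-cancel true true = refl
xor-cancel true false = refl
xor-cancel false true = refl
xor-cancel false false = refl

toggle : (p q : Fin n) → Graph n → Graph n
toggle p q G = fromAdj (λ i j → adj G i j xor does (samePair? p q i j))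

module _ {p q : Fin n} (p≢q : p ≢ q) (G : Graph n) where

  adj-toggle : ∀ i j → adj (toggle p q G) i j ≡ adj G i j xor does (samePair? p q i j)
  adj-toggle = adj-fromAdj _
    (λ i j → cong₂ _xor_ (adj-sym G i j) (does-≡ (samePair? p q i j) (samePair? p q j i) swp swp))
    (λ i → cong₂ _xor_ (adj-irrefl G i) (does-no (samePair? p q i i) λ where
      (inj₁ (refl , refl)) → p≢q refl
      (inj₂ (refl , refl)) → p≢q refl))
    where
    swp : ∀ {i j} → SamePair p q i j → SamePair p q j i
    swp (inj₁ x) = inj₂ x
    swp (inj₂ x) = inj₁ x

  adj-toggle-same : ∀ i j → SamePair p q i j → adj (toggle p q G) i j ≡ not (adj G i j)
  adj-toggle-same i j s = trans (adj-toggle i j) (trans (cong (adj G i j xor_) (does-yes (samePair? p q i j) s)) (xor-true _))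
    where
    xor-true : ∀ b → b xor true ≡ not b
    xor-true true = refl
    xor-true false = refl

  adj-toggle-other : ∀ i j → ¬ SamePair p q i j → adj (toggle p q G) i j ≡ adj G i j
  adj-toggle-other i j s = trans (adj-toggle i j) (trans (cong (adj G i j xor_) (does-no (samePair? p q i j) s)) (xor-false _))

  deg-toggle-add : adj G p q ≡ false → ∀ i → deg (toggle p q G) i ≡ deg G i + (⟦ p ≟ i ⟧ + ⟦ q ≟ i ⟧)
  deg-toggle-add pq i = begin
    ∑F (λ j → 𝕀 (adj (toggle p q G) i j))
      ≡⟨ ∑-cong (allFin n) point ⟩
    ∑F (λ j → 𝕀 (adj G i j) + (⟦ q ≟ j ⟧ * ⟦ p ≟ i ⟧ + ⟦ p ≟ j ⟧ * ⟦ q ≟ i ⟧))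
      ≡⟨ ∑-+ (allFin n) _ _ ⟩
    deg G i + ∑F (λ j → ⟦ q ≟ j ⟧ * ⟦ p ≟ i ⟧ + ⟦ p ≟ j ⟧ * ⟦ q ≟ i ⟧)
      ≡⟨ cong (deg G i +_) (∑-+ (allFin n) _ _) ⟩
    deg G i + (∑F (λ j → ⟦ q ≟ j ⟧ * ⟦ p ≟ i ⟧) + ∑F (λ j → ⟦ p ≟ j ⟧ * ⟦ q ≟ i ⟧))
      ≡⟨ cong (deg G i +_) (cong₂ _+_ (pick (finE n) q (λ _ → ⟦ p ≟ i ⟧)) (pick (finE n) p (λ _ → ⟦ q ≟ i ⟧))) ⟩
    deg G i + (⟦ p ≟ i ⟧ + ⟦ q ≟ i ⟧) ∎
    where
    open ≡-Reasoning
    split : ∀ j → (p ≡ i → q ≡ j → adj G i j ≡ false) → (p ≡ j → q ≡ i → adj G i j ≡ false) →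
      𝕀 (adj G i j xor does (samePair? p q i j)) ≡ 𝕀 (adj G i j) + (⟦ q ≟ j ⟧ * ⟦ p ≟ i ⟧ + ⟦ p ≟ j ⟧ * ⟦ q ≟ i ⟧)
    split j h k with p ≟ i | q ≟ j | p ≟ j | q ≟ i
    ... | yes refl | yes refl | yes refl | _ = contradiction refl p≢q
    ... | yes refl | yes refl | no _ | _ rewrite h refl refl = refl
    ... | yes refl | no _ | yes refl | yes refl = contradiction refl p≢q
    ... | yes refl | no _ | yes refl | no _ = trans (cong 𝕀 (xor-false _)) (sym (+-identityʳ _))
    ... | yes refl | no _ | no _ | _ = trans (cong 𝕀 (xor-false _)) (sym (+-identityʳ _))
    ... | no _ | yes refl | yes refl | _ = contradiction refl p≢q
    ... | no _ | no _ | yes refl | yes refl rewrite k refl refl = refl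
    ... | no _ | yes refl | no _ | _ = trans (cong 𝕀 (xor-false _)) (sym (+-identityʳ _))
    ... | no _ | no _ | no _ | _ = trans (cong 𝕀 (xor-false _)) (sym (+-identityʳ _))
    ... | no _ | no _ | yes refl | no _ = trans (cong 𝕀 (xor-false _)) (sym (+-identityʳ _))
    point : ∀ j → 𝕀 (adj (toggle p q G) i j) ≡ 𝕀 (adj G i j) + (⟦ q ≟ j ⟧ * ⟦ p ≟ i ⟧ + ⟦ p ≟ j ⟧ * ⟦ q ≟ i ⟧)
    point j = trans (cong 𝕀 (adj-toggle i j)) (split j (λ where refl refl → pq) (λ where refl refl → trans (adj-sym G q p) pq))

toggle-involutive : {p q : Fin n} → p ≢ q → (G : Graph n) → toggle p q (toggle p q G) ≡ G
toggle-involutive {p = p} {q} p≢q G = graph-ext _ G λ i j →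
  trans (adj-toggle p≢q (toggle p q G) i j)
    (trans (cong (_xor does (samePair? p q i j)) (adj-toggle p≢q G i j)) (xor-cancel (adj G i j) _))

deg-toggle-remove : {p q : Fin n} → p ≢ q → (G : Graph n) → adj G p q ≡ true →
  ∀ i → deg (toggle p q G) i + (⟦ p ≟ i ⟧ + ⟦ q ≟ i ⟧) ≡ deg G i
deg-toggle-remove {p = p} {q} p≢q G pq i = sym (begin
  deg G i                                   ≡⟨ cong (λ H → deg H i) (sym (toggle-involutive p≢q G)) ⟩
  deg (toggle p q (toggle p q G)) i         ≡⟨ deg-toggle-add p≢q (toggle p q G) (trans (adj-toggle-same p≢q G p q (inj₁ (refl , refl))) (cong not pq)) i ⟩
  deg (toggle p q G) i + (⟦ p ≟ i ⟧ + ⟦ q ≟ i ⟧) ∎)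
  where open ≡-Reasoning

-- As a composite of involutions it is undone by the same toggles in reverse order, and degrees can
-- be tracked one toggle at a time.
switch : (x y a b : Fin n) → Graph n → Graph n
switch x y a b G = toggle x a (toggle y b (toggle x y (toggle a b G)))

unswitch : (x y a b : Fin n) → Graph n → Graph n
unswitch x y a b G = toggle a b (toggle x y (toggle y b (toggle x a G)))

-- The other two inequalities follow: if `x` were `b`, or `y` were `a`, then the edge `ab`, or `xy`,
-- would be the excluded edge `xa`.
record Switchable (G : Graph n) (x y a b : Fin n) : Set where
  constructor switchable
  field
    xy : Adj G x y
    ab : Adj G a b
    ¬xa : ¬ Adj G x a
    ¬yb : ¬ Adj G y b
    x≢a : x ≢ a
    y≢b : y ≢ b

switchable? : (G : Graph n) (x y a b : Fin n) → Dec (Switchable G x y a b)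
switchable? G x y a b = map′
  (λ (p , q , r , s , t , u) → switchable p q r s t u)
  (λ (switchable p q r s t u) → p , q , r , s , t , u)
  (adj? G x y ×-dec adj? G a b ×-dec ¬? (adj? G x a) ×-dec ¬? (adj? G y b) ×-dec ¬? (x ≟ a) ×-dec ¬? (y ≟ b))

module _ {G : Graph n} {x y a b : Fin n} (sw : Switchable G x y a b) where
  open Switchable sw

  private
    x≢y : x ≢ y
    x≢y = Adj⇒≢ G xy
    a≢b : a ≢ b
    a≢b = Adj⇒≢ G ab
    x≢b : x ≢ b
    x≢b refl = ¬xa (Adj-sym G ab)
    y≢a : y ≢ a
    y≢a refl = ¬xa xy
    G₁ G₂ G₃ : Graph n
    G₁ = toggle a b G
    G₂ = toggle x y G₁
    G₃ = toggle y b G₂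
    xy∦ab : ¬ SamePair a b x y
    xy∦ab (inj₁ (p , _)) = x≢a (sym p)
    xy∦ab (inj₂ (p , _)) = y≢a (sym p)
    yb∦ab : ¬ SamePair a b y b
    yb∦ab (inj₁ (p , _)) = y≢a (sym p)
    yb∦ab (inj₂ (p , _)) = a≢b p
    yb∦xy : ¬ SamePair x y y b
    yb∦xy (inj₁ (p , _)) = x≢y p
    yb∦xy (inj₂ (p , _)) = x≢b p
    xa∦ab : ¬ SamePair a b x a
    xa∦ab (inj₁ (p , _)) = x≢a (sym p)
    xa∦ab (inj₂ (_ , p)) = x≢b (sym p)
    xa∦xy : ¬ SamePair x y x a
    xa∦xy (inj₁ (_ , p)) = y≢a p
    xa∦xy (inj₂ (p , _)) = x≢a p
    xa∦yb : ¬ SamePair y b x a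
    xa∦yb (inj₁ (p , _)) = x≢y (sym p)
    xa∦yb (inj₂ (p , _)) = y≢a p
    xy₁ : adj G₁ x y ≡ true
    xy₁ = trans (adj-toggle-other a≢b G x y xy∦ab) (T⇒≡ xy)
    yb₂ : adj G₂ y b ≡ false
    yb₂ = trans (adj-toggle-other x≢y G₁ y b yb∦xy) (trans (adj-toggle-other a≢b G y b yb∦ab) (¬T⇒≡ ¬yb))
    xa₃ : adj G₃ x a ≡ false
    xa₃ = trans (adj-toggle-other y≢b G₂ x a xa∦yb) (trans (adj-toggle-other x≢y G₁ x a xa∦xy)
      (trans (adj-toggle-other a≢b G x a xa∦ab) (¬T⇒≡ ¬xa)))

  unswitch-switch : unswitch x y a b (switch x y a b G) ≡ G
  unswitch-switch = begin
    unswitch x y a b (switch x y a b G)    ≡⟨ cong (λ H → toggle a b (toggle x y (toggle y b H))) (toggle-involutive x≢a G₃) ⟩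
    toggle a b (toggle x y (toggle y b G₃)) ≡⟨ cong (λ H → toggle a b (toggle x y H)) (toggle-involutive y≢b G₂) ⟩
    toggle a b (toggle x y G₂)             ≡⟨ cong (toggle a b) (toggle-involutive x≢y G₁) ⟩
    toggle a b G₁                          ≡⟨ toggle-involutive a≢b G ⟩
    G                                      ∎
    where open ≡-Reasoning

  deg-switch : ∀ i → deg (switch x y a b G) i ≡ deg G i
  deg-switch i = arith {d₂ = deg G₂ i} (⟦ a ≟ i ⟧) (⟦ b ≟ i ⟧) (⟦ x ≟ i ⟧) (⟦ y ≟ i ⟧)
    (deg-toggle-remove a≢b G (T⇒≡ ab) i) (deg-toggle-remove x≢y G₁ xy₁ i)
    (deg-toggle-add y≢b G₂ yb₂ i) (deg-toggle-add x≢a G₃ xa₃ i)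
    where
    arith : ∀ {d₀ d₁ d₂ d₃ d₄} A B X Y → d₁ + (A + B) ≡ d₀ → d₂ + (X + Y) ≡ d₁ →
      d₃ ≡ d₂ + (Y + B) → d₄ ≡ d₃ + (X + A) → d₄ ≡ d₀
    arith {d₂ = d} A B X Y refl refl refl refl = lem d A B X Y
      where
      lem : ∀ d A B X Y → d + (Y + B) + (X + A) ≡ d + (X + Y) + (A + B)
      lem = solve-∀

  switch-keeps : ∀ i j → Adj G i j → ¬ SamePair x y i j → ¬ SamePair a b i j → Adj (switch x y a b G) i j
  switch-keeps i j ij ¬1 ¬2 = subst T (sym (trans (adj-toggle-other x≢a G₃ i j ¬4)
    (trans (adj-toggle-other y≢b G₂ i j ¬3) (trans (adj-toggle-other x≢y G₁ i j ¬1) (adj-toggle-other a≢b G i j ¬2))))) ij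
    where
    ¬3 : ¬ SamePair y b i j
    ¬3 (inj₁ (refl , refl)) = ¬yb ij
    ¬3 (inj₂ (refl , refl)) = ¬yb (Adj-sym G ij)
    ¬4 : ¬ SamePair x a i j
    ¬4 (inj₁ (refl , refl)) = ¬xa ij
    ¬4 (inj₂ (refl , refl)) = ¬xa (Adj-sym G ij)

  -- Edges of the new graph that were switched away do not occur, but this weaker form is all that
  -- is needed to trace a newly created structure back to `xa` or `yb`.
  switch-origin : ∀ i j → Adj (switch x y a b G) i j → Adj G i j ⊎ SamePair x a i j ⊎ SamePair y b i j
  switch-origin i j ij with samePair? x a i j | samePair? y b i j | samePair? x y i j | samePair? a b i j
  ... | yes p | _ | _ | _ = inj₂ (inj₁ p)
  ... | no _ | yes p | _ | _ = inj₂ (inj₂ p)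
  ... | no _ | no _ | yes (inj₁ (refl , refl)) | _ = inj₁ xy
  ... | no _ | no _ | yes (inj₂ (refl , refl)) | _ = inj₁ (Adj-sym G xy)
  ... | no _ | no _ | no _ | yes (inj₁ (refl , refl)) = inj₁ ab
  ... | no _ | no _ | no _ | yes (inj₂ (refl , refl)) = inj₁ (Adj-sym G ab)
  ... | no ¬4 | no ¬3 | no ¬1 | no ¬2 = inj₁ (subst T (trans (adj-toggle-other x≢a G₃ i j ¬4)
    (trans (adj-toggle-other y≢b G₂ i j ¬3) (trans (adj-toggle-other x≢y G₁ i j ¬1) (adj-toggle-other a≢b G i j ¬2)))) ij)

  switch-xa : Adj (switch x y a b G) x a
  switch-xa = ≡⇒T (trans (adj-toggle-same x≢a G₃ x a (inj₁ (refl , refl))) (cong not xa₃))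

  switch-yb : Adj (switch x y a b G) y b
  switch-yb = ≡⇒T (trans (adj-toggle-other x≢a G₃ y b yb∦xa) (trans (adj-toggle-same y≢b G₂ y b (inj₁ (refl , refl))) (cong not yb₂)))
    where
    yb∦xa : ¬ SamePair x a y b
    yb∦xa (inj₁ (p , _)) = x≢y p
    yb∦xa (inj₂ (p , _)) = x≢b p

∑∑-+ : ∀ {n} (f g : Fin n → Fin n → ℕ) → ∑F (λ a → ∑F (λ b → f a b + g a b)) ≡ ∑F (λ a → ∑F (f a)) + ∑F (λ a → ∑F (g a))
∑∑-+ {n} f g = trans (∑-cong (allFin n) (λ a → ∑-+ (allFin n) (f a) (g a))) (∑-+ (allFin n) (∑F ∘ f) (∑F ∘ g))

double-∑F-mono : ∀ {n} {f g : Fin n → Fin n → ℕ} → (∀ a b → f a b ≤ g a b) → ∑F (λ a → ∑F (f a)) ≤ ∑F (λ a → ∑F (g a))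
double-∑F-mono {n} h = ∑-mono (allFin n) λ a → ∑-mono (allFin n) (h a)

hasDegrees? : ∀ {n} (d : Fin n → ℕ) (G : Graph n) → Dec (HasDegrees d G)
hasDegrees? d G = all? (λ i → deg G i ℕ.≟ d i)

-- The expectation of `w` over the random graph, multiplied by the number of graphs with these
-- degrees.
∑𝒢 : ∀ {n} → (Fin n → ℕ) → (Graph n → ℕ) → ℕ
∑𝒢 {n} d w = ∑ (allGraphs n) (λ G → ⟦ hasDegrees? d G ⟧ * w G)

module _ {n : ℕ} (d : Fin n → ℕ) where

  ∑𝒢-mono : {v w : Graph n → ℕ} → (∀ G → HasDegrees d G → v G ≤ w G) → ∑𝒢 d v ≤ ∑𝒢 d w
  ∑𝒢-mono {v} {w} h = ∑-mono (allGraphs n) λ G → lem G (hasDegrees? d G)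
    where
    lem : ∀ G (e : Dec (HasDegrees d G)) → ⟦ e ⟧ * v G ≤ ⟦ e ⟧ * w G
    lem G (yes p) = +-monoˡ-≤ 0 (h G p)
    lem G (no _) = z≤n

  ∑𝒢-cong : {v w : Graph n → ℕ} → (∀ G → HasDegrees d G → v G ≡ w G) → ∑𝒢 d v ≡ ∑𝒢 d w
  ∑𝒢-cong h = ≤-antisym (∑𝒢-mono (λ G p → ≤-reflexive (h G p))) (∑𝒢-mono (λ G p → ≤-reflexive (sym (h G p))))

  ∑𝒢-* : ∀ c (w : Graph n → ℕ) → ∑𝒢 d (λ G → c * w G) ≡ c * ∑𝒢 d w
  ∑𝒢-* c w = trans (∑-cong (allGraphs n) (λ G → lem ⟦ hasDegrees? d G ⟧ c (w G))) (∑-*ˡ (allGraphs n) c _)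
    where
    lem : ∀ a b c → a * (b * c) ≡ b * (a * c)
    lem = solve-∀

  ∑𝒢-+ : ∀ (v w : Graph n → ℕ) → ∑𝒢 d (λ G → v G + w G) ≡ ∑𝒢 d v + ∑𝒢 d w
  ∑𝒢-+ v w = trans (∑-cong (allGraphs n) (λ G → *-distribˡ-+ ⟦ hasDegrees? d G ⟧ (v G) (w G))) (∑-+ (allGraphs n) _ _)

  ∑𝒢-swap : {A : Set} (ys : List A) (f : Graph n → A → ℕ) →
    ∑𝒢 d (λ G → ∑ ys (f G)) ≡ ∑ ys (λ y → ∑𝒢 d (λ G → f G y))
  ∑𝒢-swap ys f = trans (∑-cong (allGraphs n) (λ G → sym (∑-*ˡ ys ⟦ hasDegrees? d G ⟧ (f G)))) (∑-swap (allGraphs n) ys _)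

  ∑𝒢-swap² : (f : Graph n → Fin n → Fin n → ℕ) →
    ∑𝒢 d (λ G → ∑F (λ a → ∑F (f G a))) ≡ ∑F (λ a → ∑F (λ b → ∑𝒢 d (λ G → f G a b)))
  ∑𝒢-swap² f = trans (∑𝒢-swap (allFin n) _) (∑-cong (allFin n) (λ a → ∑𝒢-swap (allFin n) _))

  ∑𝒢-retract : (f g : Graph n → Graph n) (p q : Graph n → ℕ) →
    (∀ G → HasDegrees d G → p G ≢ 0 → g (f G) ≡ G × (∀ i → deg (f G) i ≡ deg G i) × p G ≤ q (f G)) →
    ∑𝒢 d p ≤ ∑𝒢 d q
  ∑𝒢-retract f g p q h = ∑-retract (graphE n) (graphE n) f g _ _ λ G ne → step G (hasDegrees? d G) ne
    where
    step : ∀ G (e : Dec (HasDegrees d G)) → ⟦ e ⟧ * p G ≢ 0 → g (f G) ≡ G × ⟦ e ⟧ * p G ≤ ⟦ hasDegrees? d (f G) ⟧ * q (f G)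
    step G (no _) ne = contradiction refl ne
    step G (yes D) ne = let (gf , dg , le) = h G D (λ z → ne (trans (+-identityʳ _) z)) in
      gf , *-mono-≤ {1} (⟦⟧-≥1 (hasDegrees? d (f G)) (λ i → trans (dg i) (D i))) le

  ∑𝒢-switch : (x y a b : Fin n) (p q : Graph n → ℕ) →
    (∀ G → HasDegrees d G → p G ≢ 0 → Switchable G x y a b × p G ≤ q (switch x y a b G)) → ∑𝒢 d p ≤ ∑𝒢 d q
  ∑𝒢-switch x y a b p q h = ∑𝒢-retract (switch x y a b) (unswitch x y a b) p q λ G D ne →
    let (s , le) = h G D ne in unswitch-switch s , deg-switch s , le

module BoundedDegree {n : ℕ} (d : Fin n → ℕ) (Δ : ℕ) (d≤Δ : ∀ i → d i ≤ Δ) where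

  deg≤Δ : ∀ {G} → HasDegrees d G → ∀ i → deg G i ≤ Δ
  deg≤Δ D i = ≤-trans (≤-reflexive (D i)) (d≤Δ i)

  -- Bounds the oriented edges that start at `x` or at a neighbour of `x`, plus those that end at
  -- `y` or at a neighbour of `y`.
  slack : ℕ
  slack = (1 + Δ) * Δ + (1 + Δ) * Δ

  near-count : ∀ {G} → HasDegrees d G → ∀ x → ∑F (λ a → ⟦ x ≟ a ⟧ + 𝕀 (adj G x a)) ≤ 1 + Δ
  near-count {G} D x = ≤-trans (≤-reflexive (∑-+ (allFin n) (λ a → ⟦ x ≟ a ⟧) (λ a → 𝕀 (adj G x a))))
    (+-mono-≤ (≤-reflexive (once (finE n) x)) (deg≤Δ D x))

  near-edges : ∀ {G} → HasDegrees d G → ∀ x →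
    ∑F (λ a → ∑F (λ b → (⟦ x ≟ a ⟧ + 𝕀 (adj G x a)) * 𝕀 (adj G a b))) ≤ (1 + Δ) * Δ
  near-edges {G} D x = begin
    ∑F (λ a → ∑F (λ b → (⟦ x ≟ a ⟧ + 𝕀 (adj G x a)) * 𝕀 (adj G a b)))
      ≡⟨ ∑-cong (allFin n) (λ a → ∑-*ˡ (allFin n) (⟦ x ≟ a ⟧ + 𝕀 (adj G x a)) _) ⟩
    ∑F (λ a → (⟦ x ≟ a ⟧ + 𝕀 (adj G x a)) * deg G a)
      ≤⟨ ∑-mono (allFin n) (λ a → *-monoʳ-≤ (⟦ x ≟ a ⟧ + 𝕀 (adj G x a)) (deg≤Δ D a)) ⟩
    ∑F (λ a → (⟦ x ≟ a ⟧ + 𝕀 (adj G x a)) * Δ)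
      ≡⟨ ∑-*ʳ (allFin n) Δ (λ a → ⟦ x ≟ a ⟧ + 𝕀 (adj G x a)) ⟩
    ∑F (λ a → ⟦ x ≟ a ⟧ + 𝕀 (adj G x a)) * Δ
      ≤⟨ *-monoˡ-≤ Δ (near-count D x) ⟩
    (1 + Δ) * Δ ∎
    where open ≤-Reasoning

  -- `φ` selects the oriented edges `ab` that may be used. One that cannot be switched with `xy` is
  -- near `x` at its start or near `y` at its end, so at most `slack` of them are lost.
  switchable-count : ∀ {G} → HasDegrees d G → ∀ {x y} → Adj G x y → (φ : Fin n → Fin n → ℕ) → (∀ a b → φ a b ≤ 1) →
    ∑F (λ a → ∑F (λ b → φ a b * 𝕀 (adj G a b))) ≤ ∑F (λ a → ∑F (λ b → φ a b * ⟦ switchable? G x y a b ⟧)) + slack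
  switchable-count {G} D {x} {y} xy φ φ≤1 = begin
    ∑F (λ a → ∑F (λ b → φ a b * 𝕀 (adj G a b)))
      ≤⟨ double-∑F-mono point ⟩
    ∑F (λ a → ∑F (λ b → good a b + (near x a b + near y b a)))
      ≡⟨ ∑∑-+ good (λ a b → near x a b + near y b a) ⟩
    ∑F (λ a → ∑F (good a)) + ∑F (λ a → ∑F (λ b → near x a b + near y b a))
      ≡⟨ cong (∑F (λ a → ∑F (good a)) +_) (∑∑-+ (near x) (λ a b → near y b a)) ⟩
    ∑F (λ a → ∑F (good a)) + (∑F (λ a → ∑F (near x a)) + ∑F (λ a → ∑F (λ b → near y b a)))
      ≤⟨ +-monoʳ-≤ (∑F (λ a → ∑F (good a))) (+-mono-≤ (near-edges D x)
           (≤-trans (≤-reflexive (∑-swap (allFin n) (allFin n) (λ a b → near y b a))) (near-edges D y))) ⟩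
    ∑F (λ a → ∑F (good a)) + slack ∎
    where
    open ≤-Reasoning
    good : Fin n → Fin n → ℕ
    good a b = φ a b * ⟦ switchable? G x y a b ⟧
    near : Fin n → Fin n → Fin n → ℕ
    near x a b = (⟦ x ≟ a ⟧ + 𝕀 (adj G x a)) * 𝕀 (adj G a b)
    near-pos : ∀ x a b → Adj G a b → x ≡ a ⊎ Adj G x a → 1 ≤ near x a b
    near-pos x a b ab h = *-mono-≤ {1} (pos h) (𝕀-T ab)
      where
      pos : x ≡ a ⊎ Adj G x a → 1 ≤ ⟦ x ≟ a ⟧ + 𝕀 (adj G x a)
      pos (inj₁ p) = ≤-trans (⟦⟧-≥1 (x ≟ a) p) (m≤m+n ⟦ x ≟ a ⟧ _)
      pos (inj₂ p) = ≤-trans (𝕀-T p) (m≤n+m (𝕀 (adj G x a)) ⟦ x ≟ a ⟧)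
    cases : ∀ a b → Adj G a b → Dec (x ≡ a) → Dec (Adj G x a) → Dec (y ≡ b) → Dec (Adj G y b) →
      Switchable G x y a b ⊎ 1 ≤ near x a b ⊎ 1 ≤ near y b a
    cases a b ab (yes p) _ _ _ = inj₂ (inj₁ (near-pos x a b ab (inj₁ p)))
    cases a b ab (no _) (yes p) _ _ = inj₂ (inj₁ (near-pos x a b ab (inj₂ p)))
    cases a b ab (no _) (no _) (yes p) _ = inj₂ (inj₂ (near-pos y b a (Adj-sym G ab) (inj₁ p)))
    cases a b ab (no _) (no _) (no _) (yes p) = inj₂ (inj₂ (near-pos y b a (Adj-sym G ab) (inj₂ p)))
    cases a b ab (no x≢a) (no ¬xa) (no y≢b) (no ¬yb) = inj₁ (switchable xy ab ¬xa ¬yb x≢a y≢b)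
    small : ∀ a b → φ a b * 𝕀 (adj G a b) ≤ 1
    small a b = *-mono-≤ (φ≤1 a b) (⟦⟧≤1 (adj? G a b))
    point : ∀ a b → φ a b * 𝕀 (adj G a b) ≤ good a b + (near x a b + near y b a)
    point a b = by (adj? G a b)
      where
      by : Dec (Adj G a b) → φ a b * 𝕀 (adj G a b) ≤ good a b + (near x a b + near y b a)
      by (no ¬ab) = ≡0⇒≤ (trans (cong (φ a b *_) (cong 𝕀 (¬T⇒≡ ¬ab))) (*-zeroʳ (φ a b)))
      by (yes ab) with cases a b ab (x ≟ a) (adj? G x a) (y ≟ b) (adj? G y b)
      ... | inj₁ s = ≤-trans (*-monoʳ-≤ (φ a b) (≤-reflexive (trans (cong 𝕀 (T⇒≡ ab)) (sym (⟦⟧-yes (switchable? G x y a b) s))))) (m≤m+n (good a b) _)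
      ... | inj₂ (inj₁ k) = ≤-trans (small a b) (≤-trans k (≤-trans (m≤m+n (near x a b) (near y b a)) (m≤n+m _ (good a b))))
      ... | inj₂ (inj₂ k) = ≤-trans (small a b) (≤-trans k (≤-trans (m≤n+m (near y b a) (near x a b)) (m≤n+m _ (good a b))))

  -- Reads: under the law weighted by `w`, the edge `xy` is present with probability at most Δ²/β.
  -- There are at least β admissible switchings out of a graph containing `xy`. The weight plays the
  -- part of conditioning; all that is asked of it is that admissible switchings do not decrease it.
  switching-bound : (x y : Fin n) (φ : Fin n → Fin n → ℕ) (w : Graph n → ℕ) (β : ℕ) →
    (∀ a b → φ a b ≤ 1) →
    (∀ G a b → φ a b ≢ 0 → Switchable G x y a b → w G ≤ w (switch x y a b G)) →
    (∀ G → HasDegrees d G → β + slack ≤ ∑F (λ a → ∑F (λ b → φ a b * 𝕀 (adj G a b)))) →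
    β * ∑𝒢 d (λ G → 𝕀 (adj G x y) * w G) ≤ Δ * Δ * ∑𝒢 d w
  switching-bound x y φ w β φ≤1 mono many = begin
    β * ∑𝒢 d (λ G → 𝕀 (adj G x y) * w G)
      ≡⟨ ∑𝒢-* d β _ ⟨
    ∑𝒢 d (λ G → β * (𝕀 (adj G x y) * w G))
      ≤⟨ ∑𝒢-mono d enough ⟩
    ∑𝒢 d (λ G → ∑F (λ a → ∑F (λ b → φ a b * ⟦ switchable? G x y a b ⟧ * w G)))
      ≡⟨ ∑𝒢-swap² d (λ G a b → φ a b * ⟦ switchable? G x y a b ⟧ * w G) ⟩
    ∑F (λ a → ∑F (λ b → ∑𝒢 d (λ G → φ a b * ⟦ switchable? G x y a b ⟧ * w G)))
      ≤⟨ double-∑F-mono (λ a b → ∑𝒢-switch d x y a b _ (λ G → 𝕀 (adj G x a) * (𝕀 (adj G y b) * w G)) (perform a b)) ⟩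
    ∑F (λ a → ∑F (λ b → ∑𝒢 d (λ G → 𝕀 (adj G x a) * (𝕀 (adj G y b) * w G))))
      ≡⟨ ∑𝒢-swap² d (λ G a b → 𝕀 (adj G x a) * (𝕀 (adj G y b) * w G)) ⟨
    ∑𝒢 d (λ G → ∑F (λ a → ∑F (λ b → 𝕀 (adj G x a) * (𝕀 (adj G y b) * w G))))
      ≤⟨ ∑𝒢-mono d few ⟩
    ∑𝒢 d (λ G → Δ * Δ * w G)
      ≡⟨ ∑𝒢-* d (Δ * Δ) w ⟩
    Δ * Δ * ∑𝒢 d w ∎
    where
    open ≤-Reasoning
    enough : ∀ G → HasDegrees d G → β * (𝕀 (adj G x y) * w G) ≤ ∑F (λ a → ∑F (λ b → φ a b * ⟦ switchable? G x y a b ⟧ * w G))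
    enough G D = ≤-trans (≤-reflexive (lem β (𝕀 (adj G x y)) (w G))) (⟦⟧*≤ (adj? G x y) λ xy → begin
      β * w G
        ≤⟨ *-monoˡ-≤ (w G) (+-cancelʳ-≤ slack β (∑F (λ a → ∑F (λ b → φ a b * ⟦ switchable? G x y a b ⟧))) (≤-trans (many G D) (switchable-count D xy φ φ≤1))) ⟩
      ∑F (λ a → ∑F (λ b → φ a b * ⟦ switchable? G x y a b ⟧)) * w G
        ≡⟨ trans (∑-cong (allFin n) (λ a → ∑-*ʳ (allFin n) (w G) _)) (∑-*ʳ (allFin n) (w G) _) ⟨
      ∑F (λ a → ∑F (λ b → φ a b * ⟦ switchable? G x y a b ⟧ * w G)) ∎)
      where
      lem : ∀ a b c → a * (b * c) ≡ b * (a * c)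
      lem = solve-∀
    perform : ∀ a b G → HasDegrees d G → φ a b * ⟦ switchable? G x y a b ⟧ * w G ≢ 0 →
      Switchable G x y a b × φ a b * ⟦ switchable? G x y a b ⟧ * w G ≤
        𝕀 (adj (switch x y a b G) x a) * (𝕀 (adj (switch x y a b G) y b) * w (switch x y a b G))
    perform a b G D ne = s , (begin
      φ a b * ⟦ switchable? G x y a b ⟧ * w G
        ≤⟨ *-monoˡ-≤ (w G) (*-mono-≤ (φ≤1 a b) (⟦⟧≤1 (switchable? G x y a b))) ⟩
      1 * w G
        ≡⟨ *-identityˡ (w G) ⟩
      w G
        ≤⟨ mono G a b φ≢0 s ⟩
      w (switch x y a b G)
        ≡⟨ trans (cong₂ (λ u v → 𝕀 u * (𝕀 v * w (switch x y a b G))) (T⇒≡ (switch-xa s)) (T⇒≡ (switch-yb s))) (trans (+-identityʳ _) (+-identityʳ _)) ⟨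
      𝕀 (adj (switch x y a b G) x a) * (𝕀 (adj (switch x y a b G) y b) * w (switch x y a b G)) ∎)
      where
      φs : φ a b * ⟦ switchable? G x y a b ⟧ ≢ 0
      φs = *≢0ˡ _ ne
      φ≢0 : φ a b ≢ 0
      φ≢0 = *≢0ˡ _ φs
      s : Switchable G x y a b
      s = ⟦⟧-pos (switchable? G x y a b) (*≢0ʳ (φ a b) φs)
    -- The switched graph together with `a` and `b` determines the original one, and there `a` and
    -- `b` are neighbours of `x` and `y`.
    few : ∀ G → HasDegrees d G → ∑F (λ a → ∑F (λ b → 𝕀 (adj G x a) * (𝕀 (adj G y b) * w G))) ≤ Δ * Δ * w G
    few G D = begin
      ∑F (λ a → ∑F (λ b → 𝕀 (adj G x a) * (𝕀 (adj G y b) * w G)))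
        ≡⟨ ∑-cong (allFin n) (λ a → trans (∑-*ˡ (allFin n) (𝕀 (adj G x a)) _) (cong (𝕀 (adj G x a) *_) (∑-*ʳ (allFin n) (w G) _))) ⟩
      ∑F (λ a → 𝕀 (adj G x a) * (deg G y * w G))
        ≡⟨ ∑-*ʳ (allFin n) (deg G y * w G) _ ⟩
      deg G x * (deg G y * w G)
        ≡⟨ *-assoc (deg G x) (deg G y) (w G) ⟨
      deg G x * deg G y * w G
        ≤⟨ *-monoˡ-≤ (w G) (*-mono-≤ (deg≤Δ D x) (deg≤Δ D y)) ⟩
      Δ * Δ * w G ∎

-- Counting graphs and deciding symmetry

count : {A : Set} {P : A → Set} (P? : ∀ x → Dec (P x)) (xs : List A) → CountIs P xs (∑ xs (λ x → ⟦ P? x ⟧))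
count P? [] = CountIs.nil
count P? (x ∷ xs) = step (P? x) (count P? xs)
  where
  step : ∀ {k} (e : Dec _) → CountIs _ xs k → CountIs _ (x ∷ xs) (⟦ e ⟧ + k)
  step (yes p) c = CountIs.yes p c
  step (no ¬p) c = CountIs.no ¬p c

length-filter≡∑ : {A : Set} {P : A → Set} (P? : ∀ x → Dec (P x)) (xs : List A) → length (filter P? xs) ≡ ∑ xs (λ x → ⟦ P? x ⟧)
length-filter≡∑ P? [] = refl
length-filter≡∑ P? (x ∷ xs) with P? x
... | yes _ = cong suc (length-filter≡∑ P? xs)
... | no _ = length-filter≡∑ P? xs

probCounts : (d : Fin n → ℕ) {Q : Graph n → Set} (Q? : ∀ G → Dec (Q G)) →
  ProbCounts d Q (∑𝒢 d (λ G → ⟦ Q? G ⟧)) (∑𝒢 d (λ _ → 1))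
proj₁ (probCounts {n} d Q?) = subst (CountIs _ (allGraphs n)) (∑-cong (allGraphs n) (λ G → sym (*-identityʳ _))) (count (hasDegrees? d) (allGraphs n))
proj₂ (probCounts {n} d Q?) = subst (CountIs _ (allGraphs n)) (∑-cong (allGraphs n) (λ G → ⟦⟧-× (hasDegrees? d G) (Q? G)))
  (count (λ G → hasDegrees? d G ×-dec Q? G) (allGraphs n))

anyVec? : ∀ {m} {P : Vec (Fin n) m → Set} → (∀ v → Dec (P v)) → Dec (∃ P)
anyVec? {m = zero} P? = map′ (λ p → [] , p) (λ where ([] , p) → p) (P? [])
anyVec? {m = suc m} P? = map′ (λ (x , v , p) → x ∷ v , p) (λ where (x ∷ v , p) → x , v , p) (any? (λ x → anyVec? (λ v → P? (x ∷ v))))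

-- The inverse is carried along, so that the whole condition is a finite conjunction of equations
-- and hence decidable.
record IsAut (G : Graph n) (f g : Fin n → Fin n) : Set where
  constructor isAut
  field
    fg : ∀ i → f (g i) ≡ i
    gf : ∀ i → g (f i) ≡ i
    preserves : ∀ i j → adj G (f i) (f j) ≡ adj G i j

moved : (Fin n → Fin n) → Vec Bool n
moved f = Vec.tabulate (λ i → does (¬? (f i ≟ i)))

-- Automorphisms are searched for among tables, as Fin n → Fin n is not enumerable without extensionality.
HasAut : (Vec Bool n → Set) → Graph n → Set
HasAut {n} P G = Σ (Vec (Fin n) n) λ v → Σ (Vec (Fin n) n) λ w → IsAut G (lookup v) (lookup w) × P (moved (lookup v))

isAut? : (G : Graph n) (f g : Fin n → Fin n) → Dec (IsAut G f g)
isAut? G f g = map′ (λ (p , q , r) → isAut p q r) (λ (isAut p q r) → p , q , r)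
  (all? (λ i → f (g i) ≟ i) ×-dec all? (λ i → g (f i) ≟ i) ×-dec all? (λ i → all? (λ j → adj G (f i) (f j) Bool.≟ adj G i j)))

hasAut? : {P : Vec Bool n → Set} → (∀ v → Dec (P v)) → ∀ G → Dec (HasAut P G)
hasAut? P? G = anyVec? λ v → anyVec? λ w → isAut? G (lookup v) (lookup w) ×-dec P? (moved (lookup v))

hasAut-intro : {P : Vec Bool n → Set} {G : Graph n} {f g : Fin n → Fin n} → IsAut G f g → P (moved f) → HasAut P G
hasAut-intro {n} {P} {G} {f} {g} (isAut fg gf pres) p = Vec.tabulate f , Vec.tabulate g ,
  isAut (λ i → trans (f≗ _) (trans (cong f (g≗ i)) (fg i)))
        (λ i → trans (g≗ _) (trans (cong g (f≗ i)) (gf i)))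
        (λ i j → trans (cong₂ (adj G) (f≗ i) (f≗ j)) (pres i j)) ,
  subst P (Vec.tabulate-cong (λ i → cong (λ k → does (¬? (k ≟ i))) (sym (f≗ i)))) p
  where
  f≗ : ∀ i → lookup (Vec.tabulate f) i ≡ f i
  f≗ = Vec.lookup∘tabulate f
  g≗ : ∀ i → lookup (Vec.tabulate g) i ≡ g i
  g≗ = Vec.lookup∘tabulate g

moved-⁺ : (f : Fin n → Fin n) {i : Fin n} → f i ≢ i → T (lookup (moved f) i)
moved-⁺ f {i} ne = ≡⇒T (trans (Vec.lookup∘tabulate _ i) (does-yes (¬? (f i ≟ i)) ne))

moved-⁻ : (f : Fin n → Fin n) {i : Fin n} → T (lookup (moved f) i) → f i ≢ i
moved-⁻ f {i} t with f i ≟ i | Vec.lookup∘tabulate (λ i → does (¬? (f i ≟ i))) i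
... | no ne | _ = ne
... | yes _ | e = ⊥-elim (subst T e t)

Nonempty : Vec Bool n → Set
Nonempty S = ∃ λ i → T (lookup S i)

nonempty? : (S : Vec Bool n) → Dec (Nonempty S)
nonempty? S = any? (λ i → T? (lookup S i))

-- `Symmetric` is only a negation. The exhaustive search over tables turns it into an actual
-- automorphism that moves a vertex.
symmetric⇒hasAut : (G : Graph n) → Symmetric G → HasAut Nonempty G
symmetric⇒hasAut G ¬asym with hasAut? nonempty? G
... | yes p = p
... | no ¬p = contradiction asym ¬asym
  where
  asym : Asymmetric G
  asym σ aut i with σ ⟨$⟩ʳ i ≟ i
  ... | yes e = e
  ... | no ne = contradiction (hasAut-intro {P = Nonempty} (isAut (λ _ → inverseʳ σ) (λ _ → inverseˡ σ) aut) (i , moved-⁺ (σ ⟨$⟩ʳ_) ne)) ¬p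

hasAut⇒symmetric : (G : Graph n) → HasAut Nonempty G → Symmetric G
hasAut⇒symmetric G (v , w , isAut fg gf pres , i , m) asym =
  moved-⁻ (lookup v) m (asym (permutation (lookup v) (lookup w) fg gf) pres i)

symmetric? : (G : Graph n) → Dec (Symmetric G)
symmetric? G = map′ (hasAut⇒symmetric G) (symmetric⇒hasAut G) (hasAut? nonempty? G)

asymmetric? : (G : Graph n) → Dec (Asymmetric G)
asymmetric? G with hasAut? nonempty? G
... | yes p = no (hasAut⇒symmetric G p)
... | no ¬p = yes λ σ aut i → [ id , (λ ne → contradiction (symmetric⇒hasAut G (λ asym → ne (asym σ aut i))) ¬p) ]′ (dec⊎ (σ ⟨$⟩ʳ i ≟ i))
  where
  dec⊎ : {P : Set} → Dec P → P ⊎ ¬ P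
  dec⊎ (yes p) = inj₁ p
  dec⊎ (no ¬p) = inj₂ ¬p

-- Twins, and vertices of degree one and two

swap : (u v : Fin n) → Fin n → Fin n
swap u v = transpose u v ⟨$⟩ʳ_

swap-cases : (u v k : Fin n) → (k ≡ u × swap u v k ≡ v) ⊎ (k ≡ v × swap u v k ≡ u) ⊎ (k ≢ u × k ≢ v × swap u v k ≡ k)
swap-cases u v k with k ≟ u
... | yes p = inj₁ (p , refl)
... | no ¬p with k ≟ v
...   | yes q = inj₂ (inj₁ (q , refl))
...   | no ¬q = inj₂ (inj₂ (¬p , ¬q , refl))

-- The transposition of `u` and `v` is an automorphism whether or not they are adjacent.
twins⇒symmetric : (G : Graph n) {u v : Fin n} → u ≢ v → (∀ z → z ≢ u → z ≢ v → adj G u z ≡ adj G v z) → Symmetric G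
twins⇒symmetric G {u} {v} u≢v twin asym = moves (swap-cases u v u)
  where
  loop : ∀ i j → adj G i i ≡ adj G j j
  loop i j = trans (adj-irrefl G i) (sym (adj-irrefl G j))
  twinʳ : ∀ z → z ≢ u → z ≢ v → adj G z u ≡ adj G z v
  twinʳ z p q = trans (adj-sym G z u) (trans (twin z p q) (adj-sym G v z))
  aut : IsAutomorphism G (transpose u v)
  aut i j with swap u v i | swap-cases u v i | swap u v j | swap-cases u v j
  ... | _ | inj₁ (refl , refl) | _ | inj₁ (refl , refl) = loop v u
  ... | _ | inj₁ (refl , refl) | _ | inj₂ (inj₁ (refl , refl)) = adj-sym G v u
  ... | _ | inj₁ (refl , refl) | _ | inj₂ (inj₂ (p , q , refl)) = sym (twin j p q)
  ... | _ | inj₂ (inj₁ (refl , refl)) | _ | inj₁ (refl , refl) = adj-sym G u v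
  ... | _ | inj₂ (inj₁ (refl , refl)) | _ | inj₂ (inj₁ (refl , refl)) = loop u v
  ... | _ | inj₂ (inj₁ (refl , refl)) | _ | inj₂ (inj₂ (p , q , refl)) = twin j p q
  ... | _ | inj₂ (inj₂ (p , q , refl)) | _ | inj₁ (refl , refl) = sym (twinʳ i p q)
  ... | _ | inj₂ (inj₂ (p , q , refl)) | _ | inj₂ (inj₁ (refl , refl)) = twinʳ i p q
  ... | _ | inj₂ (inj₂ (p , q , refl)) | _ | inj₂ (inj₂ (p′ , q′ , refl)) = refl
  moves : _ → ⊥
  moves (inj₁ (_ , e)) = u≢v (trans (sym (asym (transpose u v) aut u)) e)
  moves (inj₂ (inj₁ (e , _))) = u≢v e
  moves (inj₂ (inj₂ (ne , _))) = ne refl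

two-terms : ∀ {n} (f : Fin n → ℕ) u v → u ≢ v → 1 ≤ f u → 1 ≤ f v → 2 ≤ ∑F f
two-terms {n} f u v u≢v fu fv = subst (_≤ ∑F f)
  (trans (∑-+ (allFin n) (λ j → ⟦ u ≟ j ⟧) (λ j → ⟦ v ≟ j ⟧)) (cong₂ _+_ (once (finE n) u) (once (finE n) v)))
  (∑-mono (allFin n) point)
  where
  point : ∀ j → ⟦ u ≟ j ⟧ + ⟦ v ≟ j ⟧ ≤ f j
  point j with u ≟ j | v ≟ j
  ... | yes refl | yes refl = contradiction refl u≢v
  ... | yes refl | no _ = fu
  ... | no _ | yes refl = fv
  ... | no _ | no _ = z≤n

deg≥2 : (G : Graph n) {u v w : Fin n} → Adj G u v → Adj G u w → v ≢ w → 2 ≤ deg G u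
deg≥2 G {u} {v} {w} uv uw v≢w = two-terms (λ j → 𝕀 (adj G u j)) v w v≢w (𝕀-T uv) (𝕀-T uw)

deg≥3 : (G : Graph n) {u v w z : Fin n} → Adj G u v → Adj G u w → Adj G u z → v ≢ w → v ≢ z → w ≢ z → 3 ≤ deg G u
deg≥3 {n} G {u} {v} {w} {z} uv uw uz v≢w v≢z w≢z = subst (_≤ deg G u)
  (trans (∑-+ (allFin n) (λ j → ⟦ v ≟ j ⟧) (λ j → ⟦ w ≟ j ⟧ + ⟦ z ≟ j ⟧))
    (cong₂ _+_ (once (finE n) v) (trans (∑-+ (allFin n) (λ j → ⟦ w ≟ j ⟧) (λ j → ⟦ z ≟ j ⟧)) (cong₂ _+_ (once (finE n) w) (once (finE n) z)))))
  (∑-mono (allFin n) point)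
  where
  point : ∀ j → ⟦ v ≟ j ⟧ + (⟦ w ≟ j ⟧ + ⟦ z ≟ j ⟧) ≤ 𝕀 (adj G u j)
  point j with v ≟ j | w ≟ j | z ≟ j
  ... | yes refl | yes refl | _ = contradiction refl v≢w
  ... | yes refl | no _ | yes refl = contradiction refl v≢z
  ... | yes refl | no _ | no _ = 𝕀-T uv
  ... | no _ | yes refl | yes refl = contradiction refl w≢z
  ... | no _ | yes refl | no _ = 𝕀-T uw
  ... | no _ | no _ | yes refl = 𝕀-T uz
  ... | no _ | no _ | no _ = z≤n

deg1-unique : (G : Graph n) {u v w : Fin n} → deg G u ≡ 1 → Adj G u v → Adj G u w → v ≡ w
deg1-unique G {u} {v} {w} d₁ uv uw with v ≟ w
... | yes e = e
... | no ne = contradiction (subst (2 ≤_) d₁ (deg≥2 G uv uw ne)) λ where (s≤s ())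

deg2-unique : (G : Graph n) {u v w z : Fin n} → deg G u ≡ 2 → Adj G u v → Adj G u w → v ≢ w → Adj G u z → z ≡ v ⊎ z ≡ w
deg2-unique G {u} {v} {w} {z} d₂ uv uw v≢w uz with z ≟ v | z ≟ w
... | yes p | _ = inj₁ p
... | no _ | yes p = inj₂ p
... | no p | no q = contradiction (subst (3 ≤_) d₂ (deg≥3 G uv uw uz v≢w (p ∘ sym) (q ∘ sym))) λ where (s≤s (s≤s ()))

pair-sum : ∀ {n} (u a : Fin n) → ∑F (λ i → ∑F (λ j → ⟦ u ≟ i ⟧ * ⟦ a ≟ j ⟧)) ≡ 1
pair-sum {n} u a = trans (∑-cong (allFin n) (λ i → trans (∑-*ˡ (allFin n) ⟦ u ≟ i ⟧ (λ j → ⟦ a ≟ j ⟧)) (trans (cong (⟦ u ≟ i ⟧ *_) (once (finE n) a)) (*-identityʳ _)))) (once (finE n) u)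

∑²-bounded : ∀ {n} (f : Fin n → Fin n → ℕ) (c : ℕ) → (∀ u v → f u v ≢ 0 → ∑F (λ a → ∑F (f a)) ≤ c) → ∑F (λ a → ∑F (f a)) ≤ c
∑²-bounded {n} f c h = ∑-bounded (allFin n) (λ a → ∑F (f a)) c λ u ne → let (v , fuv) = ∑-nonzero (allFin n) (f u) ne in h u v fuv

-- Isolated edges and ears

module LightVertices {n : ℕ} (d : Fin n → ℕ) (Δ : ℕ) (d≤Δ : ∀ i → d i ≤ Δ) where
  open BoundedDegree d Δ d≤Δ

  n₁ n₂ : ℕ
  n₁ = ∑F (λ i → ⟦ d i ℕ.≟ 1 ⟧)
  n₂ = ∑F (λ i → ⟦ d i ℕ.≟ 2 ⟧)

  total-degree≤ : ∀ {G} → HasDegrees d G → ∑F (deg G) ≤ n * Δ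
  total-degree≤ D = ≤-trans (∑-mono (allFin n) (deg≤Δ D)) (≤-reflexive (∑F-const {n} Δ))

  leaf-edges : ∀ {G} → HasDegrees d G → ∑F (λ a → ∑F (λ b → ⟦ d a ℕ.≟ 1 ⟧ * 𝕀 (adj G a b))) ≡ n₁
  leaf-edges {G} D = ∑-cong (allFin n) λ a → trans (∑-*ˡ (allFin n) ⟦ d a ℕ.≟ 1 ⟧ (λ b → 𝕀 (adj G a b))) (lem a (d a ℕ.≟ 1))
    where
    lem : ∀ a (e : Dec (d a ≡ 1)) → ⟦ e ⟧ * deg G a ≡ ⟦ e ⟧
    lem a (yes p) = trans (*-identityˡ _) (trans (D a) p)
    lem a (no _) = refl

  record IsolatedEdge (G : Graph n) (u v : Fin n) : Set where
    constructor isolatedEdge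
    field
      leafˡ : d u ≡ 1
      leafʳ : d v ≡ 1
      edge : Adj G u v

  isolatedEdge? : ∀ G u v → Dec (IsolatedEdge G u v)
  isolatedEdge? G u v = map′ (λ (p , q , r) → isolatedEdge p q r) (λ (isolatedEdge p q r) → p , q , r)
    (d u ℕ.≟ 1 ×-dec d v ℕ.≟ 1 ×-dec adj? G u v)

  HasIsolatedEdge : Graph n → Set
  HasIsolatedEdge G = ∃₂ λ u v → IsolatedEdge G u v

  hasIsolatedEdge? : ∀ G → Dec (HasIsolatedEdge G)
  hasIsolatedEdge? G = any? λ u → any? λ v → isolatedEdge? G u v

  isolatedEdge⇒symmetric : ∀ {G} → HasDegrees d G → HasIsolatedEdge G → Symmetric G
  isolatedEdge⇒symmetric {G} D (u , v , isolatedEdge p q uv) = twins⇒symmetric G (Adj⇒≢ G uv) λ z z≢u z≢v →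
    T-ext (λ uz → contradiction (deg1-unique G (trans (D u) p) uz uv) z≢v)
          (λ vz → contradiction (deg1-unique G (trans (D v) q) vz (Adj-sym G uv)) z≢u)

  -- In a graph obtained from one without isolated edges, the created edge is the only one. Undoing
  -- the switching therefore leaves just the two orders of `u` and `v` to choose from.
  OnlyIsolatedEdge : Graph n → Fin n → Fin n → Set
  OnlyIsolatedEdge G u v = IsolatedEdge G u v × (∀ i j → IsolatedEdge G i j → SamePair u v i j)

  onlyIsolatedEdge? : ∀ G u v → Dec (OnlyIsolatedEdge G u v)
  onlyIsolatedEdge? G u v = isolatedEdge? G u v ×-dec all? λ i → all? λ j → isolatedEdge? G i j →-dec samePair? u v i j

  onlyIsolatedEdge-count : ∀ G → ∑F (λ u → ∑F (λ v → ⟦ onlyIsolatedEdge? G u v ⟧)) ≤ 2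
  onlyIsolatedEdge-count G = ∑²-bounded (λ u v → ⟦ onlyIsolatedEdge? G u v ⟧) 2 λ u v ne →
    let (iso , only) = ⟦⟧-pos (onlyIsolatedEdge? G u v) ne in begin
    ∑F (λ i → ∑F (λ j → ⟦ onlyIsolatedEdge? G i j ⟧))
      ≤⟨ double-∑F-mono (λ i j → ⟦⟧≤ (onlyIsolatedEdge? G i j) (λ (iso′ , _) → hit u v i j (only i j iso′))) ⟩
    ∑F (λ i → ∑F (λ j → ⟦ u ≟ i ⟧ * ⟦ v ≟ j ⟧ + ⟦ v ≟ i ⟧ * ⟦ u ≟ j ⟧))
      ≡⟨ trans (∑-cong (allFin n) (λ i → ∑-+ (allFin n) (λ j → ⟦ u ≟ i ⟧ * ⟦ v ≟ j ⟧) (λ j → ⟦ v ≟ i ⟧ * ⟦ u ≟ j ⟧)))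
           (∑-+ (allFin n) (λ i → ∑F (λ j → ⟦ u ≟ i ⟧ * ⟦ v ≟ j ⟧)) (λ i → ∑F (λ j → ⟦ v ≟ i ⟧ * ⟦ u ≟ j ⟧))) ⟩
    ∑F (λ i → ∑F (λ j → ⟦ u ≟ i ⟧ * ⟦ v ≟ j ⟧)) + ∑F (λ i → ∑F (λ j → ⟦ v ≟ i ⟧ * ⟦ u ≟ j ⟧))
      ≡⟨ cong₂ _+_ (pair-sum u v) (pair-sum v u) ⟩
    2 ∎
    where
    open ≤-Reasoning
    hit : ∀ u v i j → SamePair u v i j → 1 ≤ ⟦ u ≟ i ⟧ * ⟦ v ≟ j ⟧ + ⟦ v ≟ i ⟧ * ⟦ u ≟ j ⟧
    hit u v i j (inj₁ (p , q)) = ≤-trans (≤-reflexive (sym (cong₂ _*_ (⟦⟧-yes (u ≟ i) p) (⟦⟧-yes (v ≟ j) q)))) (m≤m+n (⟦ u ≟ i ⟧ * ⟦ v ≟ j ⟧) _)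
    hit u v i j (inj₂ (p , q)) = ≤-trans (≤-reflexive (sym (cong₂ _*_ (⟦⟧-yes (v ≟ i) q) (⟦⟧-yes (u ≟ j) p)))) (m≤n+m (⟦ v ≟ i ⟧ * ⟦ u ≟ j ⟧) _)

  -- The second new edge `xy` is not isolated: otherwise `x` would be a leaf, and `ux` would have
  -- been an isolated edge before.
  switch-creates-isolatedEdge : ∀ {G u x v y} → ¬ HasIsolatedEdge G → d u ≡ 1 → d v ≡ 1 → Switchable G u x v y →
    OnlyIsolatedEdge (switch u x v y G) u v
  switch-creates-isolatedEdge {G} {u} {x} {v} {y} none du dv s = isolatedEdge du dv (switch-xa s) , only
    where
    open Switchable s
    only : ∀ i j → IsolatedEdge (switch u x v y G) i j → SamePair u v i j
    only i j (isolatedEdge di dj ij) with switch-origin s i j ij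
    ... | inj₁ e = contradiction (i , j , isolatedEdge di dj e) none
    ... | inj₂ (inj₁ p) = p
    ... | inj₂ (inj₂ (inj₁ (refl , refl))) = contradiction (u , x , isolatedEdge du di xy) none
    ... | inj₂ (inj₂ (inj₂ (refl , refl))) = contradiction (u , x , isolatedEdge du dj xy) none

  -- Forwards there are `n₁` leaf edges `ux`, and for each at least `k` leaf edges `vy` to switch
  -- with. Backwards there are two choices of `(u , v)` and at most `n * Δ` oriented edges `xy`.
  few-without-isolatedEdge : ∀ k → k + slack ≤ n₁ →
    n₁ * k * ∑𝒢 d (λ G → ⟦ ¬? (hasIsolatedEdge? G) ⟧) ≤ 2 * (n * Δ) * ∑𝒢 d (λ G → ⟦ hasIsolatedEdge? G ⟧)
  few-without-isolatedEdge k k≤ = begin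
    n₁ * k * ∑𝒢 d none
      ≡⟨ ∑𝒢-* d (n₁ * k) none ⟨
    ∑𝒢 d (λ G → n₁ * k * none G)
      ≤⟨ ∑𝒢-mono d (λ G D → many G D (¬? (hasIsolatedEdge? G))) ⟩
    ∑𝒢 d (λ G → ∑F λ u → ∑F λ v → ∑F λ x → ∑F λ y → p u v x y G)
      ≡⟨ trans (∑𝒢-swap² d _) (∑-cong (allFin n) (λ u → ∑-cong (allFin n) (λ v → ∑𝒢-swap² d (λ G → λ x y → p u v x y G)))) ⟩
    (∑F λ u → ∑F λ v → ∑F λ x → ∑F λ y → ∑𝒢 d (p u v x y))
      ≤⟨ double-∑F-mono (λ u v → double-∑F-mono (λ x y → ∑𝒢-switch d u x v y (p u v x y) (q u v x y) (perform u v x y))) ⟩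
    (∑F λ u → ∑F λ v → ∑F λ x → ∑F λ y → ∑𝒢 d (q u v x y))
      ≡⟨ trans (∑𝒢-swap² d _) (∑-cong (allFin n) (λ u → ∑-cong (allFin n) (λ v → ∑𝒢-swap² d (λ G → λ x y → q u v x y G)))) ⟨
    ∑𝒢 d (λ G → ∑F λ u → ∑F λ v → ∑F λ x → ∑F λ y → q u v x y G)
      ≤⟨ ∑𝒢-mono d (λ G D → few G D) ⟩
    ∑𝒢 d (λ G → 2 * (n * Δ) * ⟦ hasIsolatedEdge? G ⟧)
      ≡⟨ ∑𝒢-* d (2 * (n * Δ)) (λ G → ⟦ hasIsolatedEdge? G ⟧) ⟩
    2 * (n * Δ) * ∑𝒢 d (λ G → ⟦ hasIsolatedEdge? G ⟧) ∎
    where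
    open ≤-Reasoning
    none : Graph n → ℕ
    none G = ⟦ ¬? (hasIsolatedEdge? G) ⟧
    leaf : Fin n → ℕ
    leaf u = ⟦ d u ℕ.≟ 1 ⟧
    p q : Fin n → Fin n → Fin n → Fin n → Graph n → ℕ
    p u v x y G = none G * (leaf u * (leaf v * ⟦ switchable? G u x v y ⟧))
    q u v x y G = ⟦ onlyIsolatedEdge? G u v ⟧ * 𝕀 (adj G x y)
    many : ∀ G → HasDegrees d G → (e : Dec (¬ HasIsolatedEdge G)) →
      n₁ * k * ⟦ e ⟧ ≤ ∑F λ u → ∑F λ v → ∑F λ x → ∑F λ y → ⟦ e ⟧ * (leaf u * (leaf v * ⟦ switchable? G u x v y ⟧))
    many G D (no _) = ≡0⇒≤ (*-zeroʳ (n₁ * k))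
    many G D (yes _) = begin
      n₁ * k * 1
        ≡⟨ trans (*-identityʳ (n₁ * k)) (cong (_* k) (sym (leaf-edges D))) ⟩
      ∑F (λ u → ∑F (λ x → leaf u * 𝕀 (adj G u x))) * k
        ≡⟨ trans (∑-cong (allFin n) (λ u → ∑-*ʳ (allFin n) k (λ x → leaf u * 𝕀 (adj G u x)))) (∑-*ʳ (allFin n) k (λ u → ∑F (λ x → leaf u * 𝕀 (adj G u x)))) ⟨
      ∑F (λ u → ∑F (λ x → leaf u * 𝕀 (adj G u x) * k))
        ≤⟨ double-∑F-mono (λ u x → ≤-trans (≤-reflexive (*-assoc (leaf u) (𝕀 (adj G u x)) k)) (*-monoʳ-≤ (leaf u) (⟦⟧*≤ (adj? G u x) λ ux →
             +-cancelʳ-≤ slack k (∑F (λ v → ∑F (λ y → leaf v * ⟦ switchable? G u x v y ⟧)))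
               (≤-trans k≤ (≤-trans (≤-reflexive (sym (leaf-edges D))) (switchable-count D ux (λ a _ → leaf a) (λ a _ → ⟦⟧≤1 (d a ℕ.≟ 1)))))))) ⟩
      ∑F (λ u → ∑F (λ x → leaf u * ∑F (λ v → ∑F (λ y → leaf v * ⟦ switchable? G u x v y ⟧))))
        ≡⟨ ∑-cong (allFin n) (λ u → ∑-cong (allFin n) (λ x → trans (sym (∑-*ˡ (allFin n) (leaf u) (λ v → ∑F (λ y → leaf v * ⟦ switchable? G u x v y ⟧))))
             (∑-cong (allFin n) (λ v → sym (∑-*ˡ (allFin n) (leaf u) (λ y → leaf v * ⟦ switchable? G u x v y ⟧)))))) ⟩
      ∑F (λ u → ∑F (λ x → ∑F (λ v → ∑F (λ y → leaf u * (leaf v * ⟦ switchable? G u x v y ⟧)))))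
        ≡⟨ ∑-cong (allFin n) (λ u → ∑-swap (allFin n) (allFin n) (λ x v → ∑F (λ y → leaf u * (leaf v * ⟦ switchable? G u x v y ⟧)))) ⟩
      ∑F (λ u → ∑F (λ v → ∑F (λ x → ∑F (λ y → leaf u * (leaf v * ⟦ switchable? G u x v y ⟧)))))
        ≡⟨ ∑-cong (allFin n) (λ u → ∑-cong (allFin n) (λ v → ∑-cong (allFin n) (λ x → ∑-cong (allFin n) (λ y → *-identityˡ (leaf u * (leaf v * ⟦ switchable? G u x v y ⟧)))))) ⟨
      (∑F λ u → ∑F λ v → ∑F λ x → ∑F λ y → 1 * (leaf u * (leaf v * ⟦ switchable? G u x v y ⟧))) ∎
    perform : ∀ u v x y G → HasDegrees d G → p u v x y G ≢ 0 → Switchable G u x v y × p u v x y G ≤ q u v x y (switch u x v y G)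
    perform u v x y G D ne = s , (begin
      p u v x y G
        ≤⟨ *-mono-≤ (⟦⟧≤1 (¬? (hasIsolatedEdge? G))) (*-mono-≤ (⟦⟧≤1 (d u ℕ.≟ 1)) (*-mono-≤ (⟦⟧≤1 (d v ℕ.≟ 1)) (⟦⟧≤1 (switchable? G u x v y)))) ⟩
      1
        ≡⟨ cong₂ _*_ (⟦⟧-yes (onlyIsolatedEdge? G′ u v) (switch-creates-isolatedEdge free du dv s)) (cong 𝕀 (T⇒≡ (switch-yb s))) ⟨
      q u v x y G′ ∎)
      where
      G′ : Graph n
      G′ = switch u x v y G
      ne₁ : leaf u * (leaf v * ⟦ switchable? G u x v y ⟧) ≢ 0
      ne₁ = *≢0ʳ (none G) ne
      ne₂ : leaf v * ⟦ switchable? G u x v y ⟧ ≢ 0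
      ne₂ = *≢0ʳ (leaf u) ne₁
      free : ¬ HasIsolatedEdge G
      free = ⟦⟧-pos (¬? (hasIsolatedEdge? G)) (*≢0ˡ (none G) ne)
      du : d u ≡ 1
      du = ⟦⟧-pos (d u ℕ.≟ 1) (*≢0ˡ (leaf u) ne₁)
      dv : d v ≡ 1
      dv = ⟦⟧-pos (d v ℕ.≟ 1) (*≢0ˡ (leaf v) ne₂)
      s : Switchable G u x v y
      s = ⟦⟧-pos (switchable? G u x v y) (*≢0ʳ (leaf v) ne₂)
    few : ∀ G → HasDegrees d G → (∑F λ u → ∑F λ v → ∑F λ x → ∑F λ y → q u v x y G) ≤ 2 * (n * Δ) * ⟦ hasIsolatedEdge? G ⟧
    few G D = begin
      (∑F λ u → ∑F λ v → ∑F λ x → ∑F λ y → q u v x y G)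
        ≡⟨ ∑-cong (allFin n) (λ u → ∑-cong (allFin n) (λ v → trans (∑-cong (allFin n) (λ x → ∑-*ˡ (allFin n) (only u v) (λ y → 𝕀 (adj G x y)))) (∑-*ˡ (allFin n) (only u v) (deg G)))) ⟩
      ∑F (λ u → ∑F (λ v → only u v * ∑F (deg G)))
        ≡⟨ trans (∑-cong (allFin n) (λ u → ∑-*ʳ (allFin n) (∑F (deg G)) (only u))) (∑-*ʳ (allFin n) (∑F (deg G)) (λ u → ∑F (only u))) ⟩
      ∑F (λ u → ∑F (only u)) * ∑F (deg G)
        ≤⟨ *-mono-≤ bound (total-degree≤ D) ⟩
      2 * ⟦ hasIsolatedEdge? G ⟧ * (n * Δ)
        ≡⟨ lem ⟦ hasIsolatedEdge? G ⟧ (n * Δ) ⟩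
      2 * (n * Δ) * ⟦ hasIsolatedEdge? G ⟧ ∎
      where
      lem : ∀ a b → 2 * a * b ≡ 2 * b * a
      lem = solve-∀
      only : Fin n → Fin n → ℕ
      only u v = ⟦ onlyIsolatedEdge? G u v ⟧
      bound : ∑F (λ u → ∑F (only u)) ≤ 2 * ⟦ hasIsolatedEdge? G ⟧
      bound = ∑²-bounded only (2 * ⟦ hasIsolatedEdge? G ⟧) λ u v ne →
        ≤-trans (onlyIsolatedEdge-count G) (≤-reflexive (cong (2 *_) (sym (⟦⟧-yes (hasIsolatedEdge? G) (u , v , proj₁ (⟦⟧-pos (onlyIsolatedEdge? G u v) ne))))))

∑⃗ : ∀ {n} k → (Vec (Fin n) k → ℕ) → ℕ
∑⃗ zero f = f []
∑⃗ (suc k) f = ∑F (λ i → ∑⃗ k (λ v → f (i ∷ v)))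

module _ {n : ℕ} where

  ∑⃗-mono : ∀ k {f g : Vec (Fin n) k → ℕ} → (∀ v → f v ≤ g v) → ∑⃗ k f ≤ ∑⃗ k g
  ∑⃗-mono zero h = h []
  ∑⃗-mono (suc k) h = ∑-mono (allFin n) (λ i → ∑⃗-mono k (λ v → h (i ∷ v)))

  ∑⃗-*ˡ : ∀ k c (f : Vec (Fin n) k → ℕ) → ∑⃗ k (λ v → c * f v) ≡ c * ∑⃗ k f
  ∑⃗-*ˡ zero c f = refl
  ∑⃗-*ˡ (suc k) c f = trans (∑-cong (allFin n) (λ i → ∑⃗-*ˡ k c (λ v → f (i ∷ v)))) (∑-*ˡ (allFin n) c (λ i → ∑⃗ k (λ v → f (i ∷ v))))

  ∑⃗-*ʳ : ∀ k c (f : Vec (Fin n) k → ℕ) → ∑⃗ k (λ v → f v * c) ≡ ∑⃗ k f * c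
  ∑⃗-*ʳ zero c f = refl
  ∑⃗-*ʳ (suc k) c f = trans (∑-cong (allFin n) (λ i → ∑⃗-*ʳ k c (λ v → f (i ∷ v)))) (∑-*ʳ (allFin n) c (λ i → ∑⃗ k (λ v → f (i ∷ v))))

  term≤∑⃗ : ∀ k (f : Vec (Fin n) k → ℕ) v → f v ≤ ∑⃗ k f
  term≤∑⃗ zero f [] = ≤-refl
  term≤∑⃗ (suc k) f (i ∷ v) = ≤-trans (term≤∑⃗ k (λ v → f (i ∷ v)) v) (term≤∑ (finE n) (λ i → ∑⃗ k (λ v → f (i ∷ v))) i)

  ∑⃗-bounded : ∀ k (f : Vec (Fin n) k → ℕ) c → (∀ v → f v ≢ 0 → ∑⃗ k f ≤ c) → ∑⃗ k f ≤ c
  ∑⃗-bounded k f c h with ∑⃗ k f ℕ.≟ 0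
  ... | yes z = ≡0⇒≤ z
  ... | no ¬z = let (v , fv) = nonzero k f ¬z in h v fv
    where
    nonzero : ∀ k (f : Vec (Fin n) k → ℕ) → ∑⃗ k f ≢ 0 → ∃ λ v → f v ≢ 0
    nonzero zero f h = [] , h
    nonzero (suc k) f h = let (i , hi) = ∑-nonzero (allFin n) (λ i → ∑⃗ k (λ v → f (i ∷ v))) h
                              (v , hv) = nonzero k (λ v → f (i ∷ v)) hi in i ∷ v , hv

  -- Splits off the first coordinate of a tuple sum. Iterated, it bounds the number of tuples by the
  -- number of choices for each coordinate given the earlier ones.
  ∑⃗-factor : ∀ k {A c} (a : Fin n → ℕ) (f : Vec (Fin n) (suc k) → ℕ) (g : Fin n → Vec (Fin n) k → ℕ) →
    (∀ i v → f (i ∷ v) ≤ a i * g i v) → ∑F a ≤ A → (∀ i → ∑⃗ k (g i) ≤ c) → ∑⃗ (suc k) f ≤ A * c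
  ∑⃗-factor k {A} {c} a f g h a≤ g≤ = begin
    ∑F (λ i → ∑⃗ k (λ v → f (i ∷ v)))   ≤⟨ ∑-mono (allFin n) (λ i → ≤-trans (∑⃗-mono k (h i)) (≤-reflexive (∑⃗-*ˡ k (a i) (g i)))) ⟩
    ∑F (λ i → a i * ∑⃗ k (g i))         ≤⟨ ∑-mono (allFin n) (λ i → *-monoʳ-≤ (a i) (g≤ i)) ⟩
    ∑F (λ i → a i * c)                 ≡⟨ ∑-*ʳ (allFin n) c a ⟩
    ∑F a * c                           ≤⟨ *-monoˡ-≤ c a≤ ⟩
    A * c                              ∎
    where open ≤-Reasoning

  ∑𝒢-swap⃗ : ∀ (d : Fin n → ℕ) k (f : Graph n → Vec (Fin n) k → ℕ) → ∑𝒢 d (λ G → ∑⃗ k (f G)) ≡ ∑⃗ k (λ v → ∑𝒢 d (λ G → f G v))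
  ∑𝒢-swap⃗ d zero f = refl
  ∑𝒢-swap⃗ d (suc k) f = trans (∑𝒢-swap d (allFin n) (λ G i → ∑⃗ k (λ v → f G (i ∷ v)))) (∑-cong (allFin n) (λ i → ∑𝒢-swap⃗ d k (λ G v → f G (i ∷ v))))

  -- The number of walks of length `k` after adding a loop at every vertex, so it is positive
  -- exactly when the distance is at most `k`.
  reach : Graph n → ℕ → Fin n → Fin n → ℕ
  reach G zero u v = ⟦ u ≟ v ⟧
  reach G (suc k) u v = ∑F (λ s → reach G k u s * (⟦ s ≟ v ⟧ + 𝕀 (adj G s v)))

  record Within (G : Graph n) (k : ℕ) (u v : Fin n) : Set where
    constructor within
    field reached : 1 ≤ reach G k u v
  open Within public

  within-refl : ∀ {G u} → Within G 0 u u
  within-refl {u = u} = within (⟦⟧-≥1 (u ≟ u) refl)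

  within-step : ∀ {G k u s v} → Within G k u s → Adj G s v → Within G (suc k) u v
  within-step {G} {k} {u} {s} {v} w sv = within (≤-trans
    (*-mono-≤ {1} (reached w) (≤-trans (𝕀-T sv) (m≤n+m (𝕀 (adj G s v)) ⟦ s ≟ v ⟧)))
    (term≤∑ (finE n) (λ s → reach G k u s * (⟦ s ≟ v ⟧ + 𝕀 (adj G s v))) s))

  within-stay : ∀ {G k u v} → Within G k u v → Within G (suc k) u v
  within-stay {G} {k} {u} {v} w = within (≤-trans
    (*-mono-≤ {1} (reached w) (≤-trans (⟦⟧-≥1 (v ≟ v) refl) (m≤m+n ⟦ v ≟ v ⟧ _)))
    (term≤∑ (finE n) (λ s → reach G k u s * (⟦ s ≟ v ⟧ + 𝕀 (adj G s v))) v))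

  within? : ∀ G k u v → Dec (Within G k u v)
  within? G k u v = map′ within reached (1 ≤? reach G k u v)

another-neighbour : ∀ {n} (G : Graph n) u y → 2 ≤ deg G u → ∃ λ w → Adj G u w × w ≢ y
another-neighbour {n} G u y 2≤ with any? (λ w → adj? G u w ×-dec ¬? (w ≟ y))
... | yes p = p
... | no none = contradiction (≤-trans 2≤ deg≤1) λ where (s≤s ())
  where
  deg≤1 : deg G u ≤ 1
  deg≤1 = ≤-trans (∑-mono (allFin n) (λ j → ⟦⟧≤ (adj? G u j) (λ uj → ⟦⟧-≥1 (y ≟ j) (eq j uj (j ≟ y)))))
    (≤-reflexive (once (finE n) y))
    where
    eq : ∀ j → Adj G u j → Dec (j ≡ y) → y ≡ j
    eq j uj (yes p) = sym p
    eq j uj (no p) = contradiction (j , uj , p) none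

some-neighbour : ∀ {n} (G : Graph n) u → 1 ≤ deg G u → ∃ λ w → Adj G u w
some-neighbour {n} G u 1≤ = let (w , h) = ∑-nonzero (allFin n) (λ j → 𝕀 (adj G u j)) (λ z → contradiction (subst (1 ≤_) z 1≤) λ ()) in w , ⟦⟧-pos (adj? G u w) h

∈⇒≤∑ : {A : Set} {xs : List A} {x : A} (f : A → ℕ) → x ∈ xs → f x ≤ ∑ xs f
∈⇒≤∑ f (here refl) = m≤m+n (f _) _
∈⇒≤∑ {xs = y ∷ xs} f (there p) = ≤-trans (∈⇒≤∑ f p) (m≤n+m _ (f y))

module Ears {n : ℕ} (d : Fin n → ℕ) (Δ : ℕ) (d≥1 : ∀ i → 1 ≤ d i) (d≤Δ : ∀ i → d i ≤ Δ) where
  open BoundedDegree d Δ d≤Δ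
  open LightVertices d Δ d≤Δ

  reach-total : ∀ {G} → HasDegrees d G → ∀ k u → ∑F (reach G k u) ≤ (1 + Δ) ^ k
  reach-total {G} D zero u = ≤-reflexive (once (finE n) u)
  reach-total {G} D (suc k) u = begin
    ∑F (λ v → ∑F (λ s → reach G k u s * (⟦ s ≟ v ⟧ + 𝕀 (adj G s v))))
      ≡⟨ ∑-swap (allFin n) (allFin n) (λ v s → reach G k u s * (⟦ s ≟ v ⟧ + 𝕀 (adj G s v))) ⟩
    ∑F (λ s → ∑F (λ v → reach G k u s * (⟦ s ≟ v ⟧ + 𝕀 (adj G s v))))
      ≡⟨ ∑-cong (allFin n) (λ s → ∑-*ˡ (allFin n) (reach G k u s) (λ v → ⟦ s ≟ v ⟧ + 𝕀 (adj G s v))) ⟩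
    ∑F (λ s → reach G k u s * ∑F (λ v → ⟦ s ≟ v ⟧ + 𝕀 (adj G s v)))
      ≤⟨ ∑-mono (allFin n) (λ s → *-monoʳ-≤ (reach G k u s) (near-count D s)) ⟩
    ∑F (λ s → reach G k u s * (1 + Δ))
      ≡⟨ ∑-*ʳ (allFin n) (1 + Δ) (reach G k u) ⟩
    ∑F (reach G k u) * (1 + Δ)
      ≤⟨ *-monoˡ-≤ (1 + Δ) (reach-total D k u) ⟩
    (1 + Δ) ^ k * (1 + Δ)
      ≡⟨ *-comm ((1 + Δ) ^ k) (1 + Δ) ⟩
    (1 + Δ) ^ suc k ∎
    where open ≤-Reasoning

  record Ear (G : Graph n) (u v z : Fin n) : Set where
    constructor ear
    field
      du : d u ≡ 2
      dv : d v ≡ 2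
      uv : Adj G u v
      uz : Adj G u z
      vz : Adj G v z

  ear? : ∀ G u v z → Dec (Ear G u v z)
  ear? G u v z = map′ (λ (p , q , r , s , t) → ear p q r s t) (λ (ear p q r s t) → p , q , r , s , t)
    (d u ℕ.≟ 2 ×-dec d v ℕ.≟ 2 ×-dec adj? G u v ×-dec adj? G u z ×-dec adj? G v z)

  HasEar : Graph n → Set
  HasEar G = ∃ λ u → ∃ λ v → ∃ λ z → Ear G u v z

  hasEar? : ∀ G → Dec (HasEar G)
  hasEar? G = any? λ u → any? λ v → any? λ z → ear? G u v z

  ear⇒symmetric : ∀ {G} → HasDegrees d G → HasEar G → Symmetric G
  ear⇒symmetric {G} D (u , v , z , ear du dv uv uz vz) = twins⇒symmetric G (Adj⇒≢ G uv) λ s s≢u s≢v →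
    T-ext (λ us → [ (λ p → contradiction p s≢v) , (λ where refl → vz) ]′ (deg2-unique G (trans (D u) du) uv uz (Adj⇒≢ G vz) us))
          (λ vs → [ (λ p → contradiction p s≢u) , (λ where refl → uz) ]′ (deg2-unique G (trans (D v) dv) (Adj-sym G uv) vz (Adj⇒≢ G uz) vs))

  -- Half of the data for making an ear. The first switching turns `ux`, `vy` into `uv`, `xy`; the
  -- second turns `vw`, `zt` into `vz`, `wt`. Since `uz` survives, `u`, `v`, `z` form a triangle.
  record Anchor (G : Graph n) (u x z t : Fin n) : Set where
    constructor anchor
    field
      du : d u ≡ 2
      ux : Adj G u x
      uz : Adj G u z
      x≢z : x ≢ z
      zt : Adj G z t
      t≢u : t ≢ u

  anchor? : ∀ G u x z t → Dec (Anchor G u x z t)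
  anchor? G u x z t = map′ (λ (p , q , r , s , t , u) → anchor p q r s t u) (λ (anchor p q r s t u) → p , q , r , s , t , u)
    (d u ℕ.≟ 2 ×-dec adj? G u x ×-dec adj? G u z ×-dec ¬? (x ≟ z) ×-dec adj? G z t ×-dec ¬? (t ≟ u))

  -- Distance more than 4 from `u` gives all the distinctness and non-adjacency that both switchings
  -- need. The longest path to be excluded is u, z, t, w, v, which would arise if `wt` were already
  -- an edge.
  record Remote (G : Graph n) (u v y w : Fin n) : Set where
    constructor remote
    field
      dv : d v ≡ 2
      vy : Adj G v y
      vw : Adj G v w
      y≢w : y ≢ w
      far : ¬ Within G 4 u v

  remote? : ∀ G u v y w → Dec (Remote G u v y w)
  remote? G u v y w = map′ (λ (p , q , r , s , t) → remote p q r s t) (λ (remote p q r s t) → p , q , r , s , t)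
    (d v ℕ.≟ 2 ×-dec adj? G v y ×-dec adj? G v w ×-dec ¬? (y ≟ w) ×-dec ¬? (within? G 4 u v))

  -- A vertex `u` of degree 2 yields an anchor unless the neighbour taken as `z` is a leaf, and each
  -- leaf is charged by only one such vertex.
  many-anchors : ∀ {G} → HasDegrees d G → n₂ ≤ ∑⃗ 4 (λ where (u ∷ x ∷ z ∷ t ∷ []) → ⟦ anchor? G u x z t ⟧) + n₁
  many-anchors {G} D = begin
    ∑F (λ u → ⟦ d u ℕ.≟ 2 ⟧)
      ≤⟨ ∑-mono (allFin n) (λ u → ⟦⟧≤ (d u ℕ.≟ 2) (point u)) ⟩
    ∑F (λ u → anchors u + leaves u)
      ≡⟨ ∑-+ (allFin n) anchors leaves ⟩
    ∑F anchors + ∑F leaves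
      ≡⟨ cong (∑F anchors +_) (trans (∑-swap (allFin n) (allFin n) (λ u z → ⟦ d z ℕ.≟ 1 ⟧ * 𝕀 (adj G z u))) (leaf-edges D)) ⟩
    ∑F anchors + n₁ ∎
    where
    open ≤-Reasoning
    anchors leaves : Fin n → ℕ
    anchors u = ∑⃗ 3 (λ where (x ∷ z ∷ t ∷ []) → ⟦ anchor? G u x z t ⟧)
    leaves u = ∑F (λ z → ⟦ d z ℕ.≟ 1 ⟧ * 𝕀 (adj G z u))
    point : ∀ u → d u ≡ 2 → 1 ≤ anchors u + leaves u
    point u du = let (x , ux) = some-neighbour G u (subst (1 ≤_) (sym (trans (D u) du)) (s≤s z≤n))
                     (z , uz , z≢x) = another-neighbour G u x (subst (2 ≤_) (sym (trans (D u) du)) ≤-refl)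
                 in by x z ux uz (z≢x ∘ sym) (d z ℕ.≟ 1)
      where
      by : ∀ x z → Adj G u x → Adj G u z → x ≢ z → Dec (d z ≡ 1) → 1 ≤ anchors u + leaves u
      by x z ux uz x≢z (yes dz) = ≤-trans
        (≤-trans (≤-reflexive (sym (cong₂ _*_ (⟦⟧-yes (d z ℕ.≟ 1) dz) (cong 𝕀 (T⇒≡ (Adj-sym G uz))))))
          (term≤∑ (finE n) (λ z → ⟦ d z ℕ.≟ 1 ⟧ * 𝕀 (adj G z u)) z))
        (m≤n+m (leaves u) (anchors u))
      by x z ux uz x≢z (no dz) =
        let (t , zt , t≢u) = another-neighbour G z u (subst (2 ≤_) (sym (D z)) (≤∧≢⇒< (d≥1 z) (dz ∘ sym))) in ≤-trans
        (≤-trans (⟦⟧-≥1 (anchor? G u x z t) (anchor du ux uz x≢z zt t≢u))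
          (term≤∑⃗ 3 (λ where (x ∷ z ∷ t ∷ []) → ⟦ anchor? G u x z t ⟧) (x ∷ z ∷ t ∷ [])))
        (m≤m+n (anchors u) (leaves u))

  many-remotes : ∀ {G} → HasDegrees d G → ∀ u → n₂ ≤ ∑⃗ 3 (λ where (v ∷ y ∷ w ∷ []) → ⟦ remote? G u v y w ⟧) + (1 + Δ) ^ 4
  many-remotes {G} D u = begin
    ∑F (λ v → ⟦ d v ℕ.≟ 2 ⟧)
      ≤⟨ ∑-mono (allFin n) (λ v → ⟦⟧≤ (d v ℕ.≟ 2) (λ dv → point v dv (within? G 4 u v))) ⟩
    ∑F (λ v → remotes v + reach G 4 u v)
      ≡⟨ ∑-+ (allFin n) remotes (reach G 4 u) ⟩
    ∑F remotes + ∑F (reach G 4 u)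
      ≤⟨ +-monoʳ-≤ (∑F remotes) (reach-total D 4 u) ⟩
    ∑F remotes + (1 + Δ) ^ 4 ∎
    where
    open ≤-Reasoning
    remotes : Fin n → ℕ
    remotes v = ∑⃗ 2 (λ where (y ∷ w ∷ []) → ⟦ remote? G u v y w ⟧)
    point : ∀ v → d v ≡ 2 → Dec (Within G 4 u v) → 1 ≤ remotes v + reach G 4 u v
    point v dv (yes p) = ≤-trans (reached p) (m≤n+m (reach G 4 u v) (remotes v))
    point v dv (no far) =
      let (y , vy) = some-neighbour G v (subst (1 ≤_) (sym (trans (D v) dv)) (s≤s z≤n))
          (w , vw , w≢y) = another-neighbour G v y (subst (2 ≤_) (sym (trans (D v) dv)) ≤-refl)
      in ≤-trans (≤-trans (⟦⟧-≥1 (remote? G u v y w) (remote dv vy vw (w≢y ∘ sym) far))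
           (term≤∑⃗ 2 (λ where (y ∷ w ∷ []) → ⟦ remote? G u v y w ⟧) (y ∷ w ∷ [])))
         (m≤m+n (remotes v) (reach G 4 u v))

  -- When there was no ear before, every new ear contains an edge among the seven vertices, so its
  -- first vertex is one of them or adjacent to one. The sum over all `i` is at most 7(1 + Δ).
  touching : Graph n → List (Fin n) → Fin n → ℕ
  touching G vs i = ∑ vs (λ p → ⟦ p ≟ i ⟧ + 𝕀 (adj G p i))

  -- The second conjunct bounds the number of ears created by the two switchings.
  EarMade : Graph n → Vec (Fin n) 7 → Set
  EarMade G (u ∷ x ∷ z ∷ t ∷ v ∷ y ∷ w ∷ []) = (Ear G u v z × Adj G x y × Adj G t w) ×
    (∀ i j k → Ear G i j k → 1 ≤ touching G (u ∷ x ∷ z ∷ t ∷ v ∷ y ∷ w ∷ []) i)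

  earMade? : ∀ G vs → Dec (EarMade G vs)
  earMade? G (u ∷ x ∷ z ∷ t ∷ v ∷ y ∷ w ∷ []) = (ear? G u v z ×-dec adj? G x y ×-dec adj? G t w) ×-dec
    (all? λ i → all? λ j → all? λ k → ear? G i j k →-dec (1 ≤? touching G (u ∷ x ∷ z ∷ t ∷ v ∷ y ∷ w ∷ []) i))

  makeEar unmakeEar : Vec (Fin n) 7 → Graph n → Graph n
  makeEar (u ∷ x ∷ z ∷ t ∷ v ∷ y ∷ w ∷ []) G = switch v w z t (switch u x v y G)
  unmakeEar (u ∷ x ∷ z ∷ t ∷ v ∷ y ∷ w ∷ []) G = unswitch u x v y (unswitch v w z t G)

  module _ {G : Graph n} (noEar : ¬ HasEar G) {u x z t v y w : Fin n} (α : Anchor G u x z t) (ρ : Remote G u v y w) where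
    open Anchor α
    open Remote ρ

    private
      w₁ : ∀ {p} → Adj G u p → Within G 1 u p
      w₁ up = within-step within-refl up
      u≢v : u ≢ v
      u≢v refl = far (within-stay (within-stay (within-stay (within-stay within-refl))))
      ¬uv : ¬ Adj G u v
      ¬uv uv = far (within-stay (within-stay (within-stay (w₁ uv))))
      far₂ : ∀ {p} → Adj G u p → ¬ Adj G p v
      far₂ up pv = far (within-stay (within-stay (within-step (w₁ up) pv)))
      far₃ : ∀ {p q} → Adj G u p → Adj G p q → ¬ Adj G q v
      far₃ up pq qv = far (within-stay (within-step (within-step (w₁ up) pq) qv))
      far₄ : ∀ {p q r} → Adj G u p → Adj G p q → Adj G q r → ¬ Adj G r v
      far₄ up pq qr rv = far (within-step (within-step (within-step (w₁ up) pq) qr) rv)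
      yv = Adj-sym G vy
      wv = Adj-sym G vw
      x≢y : x ≢ y
      x≢y refl = far₂ ux yv
      x≢w : x ≢ w
      x≢w refl = far₂ ux wv
      u≢z : u ≢ z
      u≢z = Adj⇒≢ G uz
      v≢z : v ≢ z
      v≢z refl = ¬uv uz
      v≢t : v ≢ t
      v≢t refl = far₂ uz zt
      v≢x : v ≢ x
      v≢x refl = ¬uv ux
      u≢w : u ≢ w
      u≢w refl = ¬uv wv
      z≢y : z ≢ y
      z≢y refl = far₂ uz yv
      w≢t : w ≢ t
      w≢t refl = far₃ uz zt wv

      s₁ : Switchable G u x v y
      s₁ = switchable ux vy ¬uv (λ xy → far₃ ux xy yv) u≢v x≢y
      G₁ : Graph n
      G₁ = switch u x v y G
      vw₁ : Adj G₁ v w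
      vw₁ = switch-keeps s₁ v w vw
        (λ where (inj₁ (p , _)) → u≢v p
                 (inj₂ (p , _)) → u≢w p)
        (λ where (inj₁ (_ , p)) → y≢w p
                 (inj₂ (p , _)) → Adj⇒≢ G vw p)
      zt₁ : Adj G₁ z t
      zt₁ = switch-keeps s₁ z t zt
        (λ where (inj₁ (p , _)) → u≢z p
                 (inj₂ (p , _)) → t≢u (sym p))
        (λ where (inj₁ (p , _)) → v≢z p
                 (inj₂ (p , _)) → v≢t p)
      ¬vz₁ : ¬ Adj G₁ v z
      ¬vz₁ vz with switch-origin s₁ v z vz
      ... | inj₁ p = far₂ uz (Adj-sym G p)
      ... | inj₂ (inj₁ (inj₁ (p , _))) = u≢v p
      ... | inj₂ (inj₁ (inj₂ (p , _))) = u≢z p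
      ... | inj₂ (inj₂ (inj₁ (p , _))) = v≢x (sym p)
      ... | inj₂ (inj₂ (inj₂ (p , _))) = x≢z p
      ¬wt₁ : ¬ Adj G₁ w t
      ¬wt₁ wt with switch-origin s₁ w t wt
      ... | inj₁ p = far₄ uz zt (Adj-sym G p) wv
      ... | inj₂ (inj₁ (inj₁ (p , _))) = u≢w p
      ... | inj₂ (inj₁ (inj₂ (p , _))) = t≢u (sym p)
      ... | inj₂ (inj₂ (inj₁ (p , _))) = x≢w p
      ... | inj₂ (inj₂ (inj₂ (_ , p))) = y≢w p
      s₂ : Switchable G₁ v w z t
      s₂ = switchable vw₁ zt₁ ¬vz₁ ¬wt₁ v≢z w≢t
      G₂ : Graph n
      G₂ = switch v w z t G₁
      uv₂ : Adj G₂ u v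
      uv₂ = switch-keeps s₂ u v (switch-xa s₁)
        (λ where (inj₁ (p , _)) → u≢v (sym p)
                 (inj₂ (_ , p)) → u≢w (sym p))
        (λ where (inj₁ (p , _)) → u≢z (sym p)
                 (inj₂ (p , _)) → v≢z (sym p))
      uz₂ : Adj G₂ u z
      uz₂ = switch-keeps s₂ u z
        (switch-keeps s₁ u z uz
          (λ where (inj₁ (_ , p)) → x≢z p
                   (inj₂ (p , _)) → u≢z p)
          (λ where (inj₁ (p , _)) → u≢v (sym p)
                   (inj₂ (p , _)) → v≢z p))
        (λ where (inj₁ (p , _)) → u≢v (sym p)
                 (inj₂ (p , _)) → v≢z p)
        (λ where (inj₁ (p , _)) → u≢z (sym p)
                 (inj₂ (_ , p)) → t≢u p)
      xy₂ : Adj G₂ x y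
      xy₂ = switch-keeps s₂ x y (switch-yb s₁)
        (λ where (inj₁ (p , _)) → v≢x p
                 (inj₂ (p , _)) → Adj⇒≢ G vy p)
        (λ where (inj₁ (p , _)) → x≢z (sym p)
                 (inj₂ (p , _)) → z≢y p)
      vs : Vec (Fin n) 7
      vs = u ∷ x ∷ z ∷ t ∷ v ∷ y ∷ w ∷ []
      vl : List (Fin n)
      vl = u ∷ x ∷ z ∷ t ∷ v ∷ y ∷ w ∷ []

      origin : ∀ i j → Adj G₂ i j → Adj G i j ⊎ (i ∈ vl × j ∈ vl)
      origin i j ij with switch-origin s₂ i j ij
      ... | inj₂ (inj₁ (inj₁ (refl , refl))) = inj₂ (there (there (there (there (here refl)))) , there (there (here refl)))
      ... | inj₂ (inj₁ (inj₂ (refl , refl))) = inj₂ (there (there (here refl)) , there (there (there (there (here refl)))))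
      ... | inj₂ (inj₂ (inj₁ (refl , refl))) = inj₂ (there (there (there (there (there (there (here refl)))))) , there (there (there (here refl))))
      ... | inj₂ (inj₂ (inj₂ (refl , refl))) = inj₂ (there (there (there (here refl))) , there (there (there (there (there (there (here refl)))))))
      ... | inj₁ ij₁ with switch-origin s₁ i j ij₁
      ...   | inj₁ p = inj₁ p
      ...   | inj₂ (inj₁ (inj₁ (refl , refl))) = inj₂ (here refl , there (there (there (there (here refl)))))
      ...   | inj₂ (inj₁ (inj₂ (refl , refl))) = inj₂ (there (there (there (there (here refl)))) , here refl)
      ...   | inj₂ (inj₂ (inj₁ (refl , refl))) = inj₂ (there (here refl) , there (there (there (there (there (here refl))))))
      ...   | inj₂ (inj₂ (inj₂ (refl , refl))) = inj₂ (there (there (there (there (there (here refl))))) , there (here refl))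

      touch-here : ∀ {i} → i ∈ vl → 1 ≤ touching G₂ vl i
      touch-here {i} p = ≤-trans (≤-trans (⟦⟧-≥1 (i ≟ i) refl) (m≤m+n ⟦ i ≟ i ⟧ _))
        (∈⇒≤∑ (λ p → ⟦ p ≟ i ⟧ + 𝕀 (adj G₂ p i)) p)
      touch-next : ∀ {i j} → Adj G₂ i j → j ∈ vl → 1 ≤ touching G₂ vl i
      touch-next {i} {j} ij p = ≤-trans (≤-trans (𝕀-T (Adj-sym G₂ ij)) (m≤n+m _ ⟦ j ≟ i ⟧))
        (∈⇒≤∑ (λ p → ⟦ p ≟ i ⟧ + 𝕀 (adj G₂ p i)) p)

      ears-touch : ∀ i j k → Ear G₂ i j k → 1 ≤ touching G₂ vl i
      ears-touch i j k (ear di dj ij ik jk) with origin i j ij | origin i k ik | origin j k jk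
      ... | inj₂ (p , _) | _ | _ = touch-here p
      ... | inj₁ _ | inj₂ (p , _) | _ = touch-here p
      ... | inj₁ _ | inj₁ _ | inj₂ (p , _) = touch-next ij p
      ... | inj₁ p | inj₁ q | inj₁ r = contradiction (i , j , k , ear di dj p q r) noEar

    makeEar-made : EarMade (makeEar vs G) vs
    makeEar-made = (ear du dv uv₂ uz₂ (switch-xa s₂) , xy₂ , Adj-sym G₂ (switch-yb s₂)) , ears-touch

    unmake-make : unmakeEar vs (makeEar vs G) ≡ G
    unmake-make = trans (cong (unswitch u x v y) (unswitch-switch s₂)) (unswitch-switch s₁)

    deg-makeEar : ∀ i → deg (makeEar vs G) i ≡ deg G i
    deg-makeEar i = trans (deg-switch s₂ i) (deg-switch s₁ i)

  -- The factors bound, in this order, the choices of `u`, `x`, `z`, `t`, `v`, `y`, `w`: `u` touches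
  -- the seven vertices of one fixed making, `x` and `t` are free, `z` and `v` are neighbours of
  -- `u`, `y` is a neighbour of `x` and `w` one of `t`.
  earBound : ℕ
  earBound = 7 * (1 + Δ) * (n * (Δ * (n * (Δ * (Δ * (Δ * 1))))))

  few-makings : ∀ {G} → HasDegrees d G → ∑⃗ 7 (λ vs → ⟦ earMade? G vs ⟧) ≤ earBound * ⟦ hasEar? G ⟧
  few-makings {G} D = ∑⃗-bounded 7 (λ vs → ⟦ earMade? G vs ⟧) (earBound * ⟦ hasEar? G ⟧) made-once
    where
    nbr : Fin n → Fin n → ℕ
    nbr i j = 𝕀 (adj G i j)
    one : Fin n → ℕ
    one _ = 1
    ∑one : ∑F one ≤ n
    ∑one = ≤-reflexive (trans (∑F-const {n} 1) (*-identityʳ n))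
    touching-total : ∀ vl → ∑F (touching G vl) ≤ length vl * (1 + Δ)
    touching-total [] = ≤-reflexive (∑-zero (allFin n) (λ _ → refl))
    touching-total (p ∷ vl) = ≤-trans (≤-reflexive (∑-+ (allFin n) (λ i → ⟦ p ≟ i ⟧ + 𝕀 (adj G p i)) (touching G vl)))
      (+-mono-≤ (near-count D p) (touching-total vl))
    bound : ∀ vl → length vl ≤ 7 → (∀ i j k → Ear G i j k → 1 ≤ touching G vl i) → ∑⃗ 7 (λ vs → ⟦ earMade? G vs ⟧) ≤ earBound
    bound vl len touch =
      ∑⃗-factor 6 (touching G vl) (λ vs → ⟦ earMade? G vs ⟧) F₁
        (λ where u (x ∷ z ∷ t ∷ v ∷ y ∷ w ∷ []) → ⟦⟧≤ (earMade? G (u ∷ x ∷ z ∷ t ∷ v ∷ y ∷ w ∷ [])) (made u x z t v y w))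
        (≤-trans (touching-total vl) (*-monoˡ-≤ (1 + Δ) len)) λ u →
      ∑⃗-factor 5 one (F₁ u) (F₂ u) (λ where x (z ∷ t ∷ v ∷ y ∷ w ∷ []) → ≤-refl) ∑one λ x →
      ∑⃗-factor 4 (nbr u) (F₂ u x) (λ z → F₃ u x) (λ where z (t ∷ v ∷ y ∷ w ∷ []) → ≤-refl) (deg≤Δ D u) λ z →
      ∑⃗-factor 3 one (F₃ u x) (F₄ u x) (λ where t (v ∷ y ∷ w ∷ []) → ≤-refl) ∑one λ t →
      ∑⃗-factor 2 (nbr u) (F₄ u x t) (λ v → F₅ x t) (λ where v (y ∷ w ∷ []) → ≤-refl) (deg≤Δ D u) λ v →
      ∑⃗-factor 1 (nbr x) (F₅ x t) (λ y → F₆ t) (λ where y (w ∷ []) → ≤-refl) (deg≤Δ D x) λ y →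
      ∑⃗-factor 0 (nbr t) (F₆ t) (λ w _ → 1) (λ where w [] → ≤-refl) (deg≤Δ D t) λ w → ≤-refl
      where
      F₆ : Fin n → Vec (Fin n) 1 → ℕ
      F₆ t (w ∷ []) = nbr t w * 1
      F₅ : Fin n → Fin n → Vec (Fin n) 2 → ℕ
      F₅ x t (y ∷ vs) = nbr x y * F₆ t vs
      F₄ : Fin n → Fin n → Fin n → Vec (Fin n) 3 → ℕ
      F₄ u x t (v ∷ vs) = nbr u v * F₅ x t vs
      F₃ : Fin n → Fin n → Vec (Fin n) 4 → ℕ
      F₃ u x (t ∷ vs) = one t * F₄ u x t vs
      F₂ : Fin n → Fin n → Vec (Fin n) 5 → ℕ
      F₂ u x (z ∷ vs) = nbr u z * F₃ u x vs
      F₁ : Fin n → Vec (Fin n) 6 → ℕ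
      F₁ u (x ∷ vs) = one x * F₂ u x vs
      𝟙 : ∀ {i j} → Adj G i j → 1 ≤ nbr i j
      𝟙 ij = 𝕀-T ij
      made : ∀ u x z t v y w → EarMade G (u ∷ x ∷ z ∷ t ∷ v ∷ y ∷ w ∷ []) → 1 ≤ touching G vl u * F₁ u (x ∷ z ∷ t ∷ v ∷ y ∷ w ∷ [])
      made u x z t v y w ((e@(ear _ _ uv uz _) , xy , tw) , _) =
        *-mono-≤ {1} (touch u v z e) (*-mono-≤ {1} {1} ≤-refl (*-mono-≤ {1} (𝟙 uz) (*-mono-≤ {1} {1} ≤-refl
          (*-mono-≤ {1} (𝟙 uv) (*-mono-≤ {1} (𝟙 xy) (*-mono-≤ {1} (𝟙 tw) (≤-refl {1})))))))
    made-once : ∀ vs → ⟦ earMade? G vs ⟧ ≢ 0 → ∑⃗ 7 (λ vs → ⟦ earMade? G vs ⟧) ≤ earBound * ⟦ hasEar? G ⟧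
    made-once (u ∷ x ∷ z ∷ t ∷ v ∷ y ∷ w ∷ []) ne =
      let (made , touch) = ⟦⟧-pos (earMade? G (u ∷ x ∷ z ∷ t ∷ v ∷ y ∷ w ∷ [])) ne in
      subst (λ k → ∑⃗ 7 (λ vs → ⟦ earMade? G vs ⟧) ≤ earBound * k) (sym (⟦⟧-yes (hasEar? G) (u , v , z , proj₁ made)))
        (≤-trans (bound (u ∷ x ∷ z ∷ t ∷ v ∷ y ∷ w ∷ []) ≤-refl touch) (≤-reflexive (sym (*-identityʳ earBound))))

  few-without-ear : ∀ k₁ k₂ → k₁ + n₁ ≤ n₂ → k₂ + (1 + Δ) ^ 4 ≤ n₂ →
    k₁ * k₂ * ∑𝒢 d (λ G → ⟦ ¬? (hasEar? G) ⟧) ≤ earBound * ∑𝒢 d (λ G → ⟦ hasEar? G ⟧)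
  few-without-ear k₁ k₂ k₁≤ k₂≤ = begin
    k₁ * k₂ * ∑𝒢 d none
      ≡⟨ ∑𝒢-* d (k₁ * k₂) none ⟨
    ∑𝒢 d (λ G → k₁ * k₂ * none G)
      ≤⟨ ∑𝒢-mono d many ⟩
    ∑𝒢 d (λ G → ∑⃗ 7 (p G))
      ≡⟨ ∑𝒢-swap⃗ d 7 p ⟩
    ∑⃗ 7 (λ vs → ∑𝒢 d (λ G → p G vs))
      ≤⟨ ∑⃗-mono 7 (λ vs → ∑𝒢-retract d (makeEar vs) (unmakeEar vs) (λ G → p G vs) (λ G → ⟦ earMade? G vs ⟧) (perform vs)) ⟩
    ∑⃗ 7 (λ vs → ∑𝒢 d (λ G → ⟦ earMade? G vs ⟧))
      ≡⟨ ∑𝒢-swap⃗ d 7 (λ G vs → ⟦ earMade? G vs ⟧) ⟨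
    ∑𝒢 d (λ G → ∑⃗ 7 (λ vs → ⟦ earMade? G vs ⟧))
      ≤⟨ ∑𝒢-mono d (λ G D → few-makings D) ⟩
    ∑𝒢 d (λ G → earBound * ⟦ hasEar? G ⟧)
      ≡⟨ ∑𝒢-* d earBound (λ G → ⟦ hasEar? G ⟧) ⟩
    earBound * ∑𝒢 d (λ G → ⟦ hasEar? G ⟧) ∎
    where
    open ≤-Reasoning
    none : Graph n → ℕ
    none G = ⟦ ¬? (hasEar? G) ⟧
    p : Graph n → Vec (Fin n) 7 → ℕ
    p G (u ∷ x ∷ z ∷ t ∷ v ∷ y ∷ w ∷ []) = none G * (⟦ anchor? G u x z t ⟧ * ⟦ remote? G u v y w ⟧)
    many : ∀ G → HasDegrees d G → k₁ * k₂ * none G ≤ ∑⃗ 7 (p G)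
    many G D = begin
      k₁ * k₂ * none G
        ≡⟨ *-comm (k₁ * k₂) (none G) ⟩
      none G * (k₁ * k₂)
        ≤⟨ *-monoʳ-≤ (none G) (*-monoˡ-≤ k₂ (+-cancelʳ-≤ n₁ k₁ (∑⃗ 4 A) (≤-trans k₁≤ (many-anchors D)))) ⟩
      none G * (∑⃗ 4 A * k₂)
        ≡⟨ cong (none G *_) (∑⃗-*ʳ 4 k₂ A) ⟨
      none G * ∑⃗ 4 (λ v → A v * k₂)
        ≤⟨ *-monoʳ-≤ (none G) (∑⃗-mono 4 step) ⟩
      none G * ∑⃗ 4 AR
        ≡⟨ ∑⃗-*ˡ 4 (none G) AR ⟨
      ∑⃗ 4 (λ v → none G * AR v)
        ≤⟨ ∑⃗-mono 4 {λ v → none G * AR v} {nAR} (λ where (u ∷ x ∷ z ∷ t ∷ []) → ≤-reflexive (sym (∑⃗-*ˡ 3 (none G) (ar u x z t)))) ⟩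
      ∑⃗ 7 (p G) ∎
      where
      A AR nAR : Vec (Fin n) 4 → ℕ
      nAR (u ∷ x ∷ z ∷ t ∷ []) = ∑⃗ 3 (λ v → p G (u ∷ x ∷ z ∷ t ∷ v))
      A (u ∷ x ∷ z ∷ t ∷ []) = ⟦ anchor? G u x z t ⟧
      ar : (u x z t : Fin n) → Vec (Fin n) 3 → ℕ
      ar u x z t (v ∷ y ∷ w ∷ []) = ⟦ anchor? G u x z t ⟧ * ⟦ remote? G u v y w ⟧
      AR (u ∷ x ∷ z ∷ t ∷ []) = ∑⃗ 3 (ar u x z t)
      step : ∀ v → A v * k₂ ≤ AR v
      step (u ∷ x ∷ z ∷ t ∷ []) = begin
        ⟦ anchor? G u x z t ⟧ * k₂
          ≤⟨ *-monoʳ-≤ ⟦ anchor? G u x z t ⟧ (+-cancelʳ-≤ ((1 + Δ) ^ 4) k₂ (∑⃗ 3 (λ where (v ∷ y ∷ w ∷ []) → ⟦ remote? G u v y w ⟧)) (≤-trans k₂≤ (many-remotes D u))) ⟩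
        ⟦ anchor? G u x z t ⟧ * ∑⃗ 3 (λ where (v ∷ y ∷ w ∷ []) → ⟦ remote? G u v y w ⟧)
          ≡⟨ ∑⃗-*ˡ 3 ⟦ anchor? G u x z t ⟧ (λ where (v ∷ y ∷ w ∷ []) → ⟦ remote? G u v y w ⟧) ⟨
        ∑⃗ 3 (λ where (v ∷ y ∷ w ∷ []) → ⟦ anchor? G u x z t ⟧ * ⟦ remote? G u v y w ⟧) ∎
    perform : ∀ vs G → HasDegrees d G → p G vs ≢ 0 →
      unmakeEar vs (makeEar vs G) ≡ G × (∀ i → deg (makeEar vs G) i ≡ deg G i) × p G vs ≤ ⟦ earMade? (makeEar vs G) vs ⟧
    perform vs@(u ∷ x ∷ z ∷ t ∷ v ∷ y ∷ w ∷ []) G D ne =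
      unmake-make free α ρ , deg-makeEar free α ρ , (begin
      p G vs
        ≤⟨ *-mono-≤ (⟦⟧≤1 (¬? (hasEar? G))) (*-mono-≤ (⟦⟧≤1 (anchor? G u x z t)) (⟦⟧≤1 (remote? G u v y w))) ⟩
      1
        ≡⟨ ⟦⟧-yes (earMade? (makeEar vs G) vs) (makeEar-made free α ρ) ⟨
      ⟦ earMade? (makeEar vs G) vs ⟧ ∎)
      where
      ne₁ : ⟦ anchor? G u x z t ⟧ * ⟦ remote? G u v y w ⟧ ≢ 0
      ne₁ = *≢0ʳ (none G) ne
      free : ¬ HasEar G
      free = ⟦⟧-pos (¬? (hasEar? G)) (*≢0ˡ (none G) ne)
      α : Anchor G u x z t
      α = ⟦⟧-pos (anchor? G u x z t) (*≢0ˡ ⟦ anchor? G u x z t ⟧ ne₁)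
      ρ : Remote G u v y w
      ρ = ⟦⟧-pos (remote? G u v y w) (*≢0ʳ ⟦ anchor? G u x z t ⟧ ne₁)

-- Probabilities of isolated edges and ears: (b) and (c)

square-cancel-≤ : ∀ {a b} → a * a ≤ b * b → a ≤ b
square-cancel-≤ {a} {b} h = ≮⇒≥ λ b<a → <⇒≱ (*-mono-< b<a b<a) h

half-≤ : ∀ a b → 2 * b ≤ a → a ≤ 2 * (a ∸ b)
half-≤ a b h = +-cancelˡ-≤ (2 * b) a (2 * (a ∸ b)) (begin
  2 * b + a             ≤⟨ +-monoˡ-≤ a h ⟩
  a + a                 ≡⟨ cong (a +_) (+-identityʳ a) ⟨
  2 * a                 ≡⟨ cong (2 *_) (m+[n∸m]≡n (≤-trans (m≤m+n b _) h)) ⟨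
  2 * (b + (a ∸ b))     ≡⟨ *-distribˡ-+ 2 b (a ∸ b) ⟩
  2 * b + 2 * (a ∸ b)   ∎)
  where open ≤-Reasoning

cancel-≤ : ∀ k {a b} → 1 ≤ k → k * a ≤ k * b → a ≤ b
cancel-≤ (suc k) _ = *-cancelˡ-≤ (suc k)

module _ {n : ℕ} (d : Fin n → ℕ) where

  ∑𝒢-split : {P : Graph n → Set} (P? : ∀ G → Dec (P G)) →
    ∑𝒢 d (λ _ → 1) ≡ ∑𝒢 d (λ G → ⟦ ¬? (P? G) ⟧) + ∑𝒢 d (λ G → ⟦ P? G ⟧)
  ∑𝒢-split P? = trans (∑𝒢-cong d (λ G _ → sym (trans (+-comm ⟦ ¬? (P? G) ⟧ ⟦ P? G ⟧) (⟦⟧-¬ (P? G)))))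
    (∑𝒢-+ d (λ G → ⟦ ¬? (P? G) ⟧) (λ G → ⟦ P? G ⟧))

  ∑𝒢-term : (w : Graph n → ℕ) (G : Graph n) → HasDegrees d G → w G ≤ ∑𝒢 d w
  ∑𝒢-term w G D = ≤-trans (≤-reflexive (trans (sym (*-identityˡ (w G))) (cong (_* w G) (sym (⟦⟧-yes (hasDegrees? d G) D)))))
    (term≤∑ (graphE n) (λ G → ⟦ hasDegrees? d G ⟧ * w G) G)

  graphical⇒pos : Graphical d → 1 ≤ ∑𝒢 d (λ _ → 1)
  graphical⇒pos (G , D) = ∑𝒢-term (λ _ → 1) G D

  nj-1 : (Δ : ℕ) (d≤Δ : ∀ i → d i ≤ Δ) → nj d 1 ≡ LightVertices.n₁ d Δ d≤Δ
  nj-1 Δ d≤Δ = length-filter≡∑ (λ i → d i ℕ.≟ 1) (allFin n)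

  nj-2 : (Δ : ℕ) (d≤Δ : ∀ i → d i ≤ Δ) → nj d 2 ≡ LightVertices.n₂ d Δ d≤Δ
  nj-2 Δ d≤Δ = length-filter≡∑ (λ i → d i ℕ.≟ 2) (allFin n)

  module SymmetricGraphs (Δ : ℕ) (d≥1 : ∀ i → 1 ≤ d i) (d≤Δ : ∀ i → d i ≤ Δ) where
    open BoundedDegree d Δ d≤Δ
    open LightVertices d Δ d≤Δ
    open Ears d Δ d≥1 d≤Δ

    sym-count all-count : ℕ
    sym-count = ∑𝒢 d (λ G → ⟦ symmetric? G ⟧)
    all-count = ∑𝒢 d (λ _ → 1)

    private
      I₀ I₁ E₀ E₁ : ℕ
      I₀ = ∑𝒢 d (λ G → ⟦ ¬? (hasIsolatedEdge? G) ⟧)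
      I₁ = ∑𝒢 d (λ G → ⟦ hasIsolatedEdge? G ⟧)
      E₀ = ∑𝒢 d (λ G → ⟦ ¬? (hasEar? G) ⟧)
      E₁ = ∑𝒢 d (λ G → ⟦ hasEar? G ⟧)

    isolatedEdge-bound : ∀ C → 2 * slack ≤ n₁ → 1 ≤ n → n ≤ C * (n₁ * n₁) → I₀ ≤ 4 * C * Δ * I₁
    isolatedEdge-bound C 2s≤ 1≤n n≤ = cancel-≤ n 1≤n (begin
      n * I₀
        ≤⟨ *-monoˡ-≤ I₀ n≤ ⟩
      C * (n₁ * n₁) * I₀
        ≤⟨ *-monoˡ-≤ I₀ (*-monoʳ-≤ C (*-monoʳ-≤ n₁ (half-≤ n₁ slack 2s≤))) ⟩
      C * (n₁ * (2 * k)) * I₀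
        ≡⟨ lem₁ C n₁ k I₀ ⟩
      2 * C * (n₁ * k * I₀)
        ≤⟨ *-monoʳ-≤ (2 * C) (few-without-isolatedEdge k (≤-reflexive (m∸n+n≡m (≤-trans (m≤m+n slack _) 2s≤)))) ⟩
      2 * C * (2 * (n * Δ) * I₁)
        ≡⟨ lem₂ C n Δ I₁ ⟩
      n * (4 * C * Δ * I₁) ∎)
      where
      open ≤-Reasoning
      k : ℕ
      k = n₁ ∸ slack
      lem₁ : ∀ C a k I → C * (a * (2 * k)) * I ≡ 2 * C * (a * k * I)
      lem₁ = solve-∀
      lem₂ : ∀ C n D I → 2 * C * (2 * (n * D) * I) ≡ n * (4 * C * D * I)
      lem₂ = solve-∀

    ear-bound : ∀ Q → 2 * n₁ ≤ n₂ → 2 * (1 + Δ) ^ 4 ≤ n₂ → 1 ≤ n → n ≤ Q * n₂ →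
      E₀ ≤ 28 * (Q * Q) * (1 + Δ) * (Δ * Δ * Δ * Δ) * E₁
    ear-bound Q h₁ h₂ 1≤n n≤ = cancel-≤ (n * n) (*-mono-≤ 1≤n 1≤n) (begin
      n * n * E₀
        ≤⟨ *-monoˡ-≤ E₀ (*-mono-≤ n≤ n≤) ⟩
      Q * n₂ * (Q * n₂) * E₀
        ≤⟨ *-monoˡ-≤ E₀ (*-mono-≤ (*-monoʳ-≤ Q (half-≤ n₂ n₁ h₁)) (*-monoʳ-≤ Q (half-≤ n₂ ((1 + Δ) ^ 4) h₂))) ⟩
      Q * (2 * k₁) * (Q * (2 * k₂)) * E₀
        ≡⟨ lem₁ Q k₁ k₂ E₀ ⟩
      4 * (Q * Q) * (k₁ * k₂ * E₀)
        ≤⟨ *-monoʳ-≤ (4 * (Q * Q)) (few-without-ear k₁ k₂ (≤-reflexive (m∸n+n≡m (≤-trans (m≤m+n n₁ _) h₁))) (≤-reflexive (m∸n+n≡m (≤-trans (m≤m+n ((1 + Δ) ^ 4) _) h₂)))) ⟩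
      4 * (Q * Q) * (earBound * E₁)
        ≡⟨ lem₂ Q n Δ E₁ ⟩
      n * n * (28 * (Q * Q) * (1 + Δ) * (Δ * Δ * Δ * Δ) * E₁) ∎)
      where
      open ≤-Reasoning
      k₁ k₂ : ℕ
      k₁ = n₂ ∸ n₁
      k₂ = n₂ ∸ (1 + Δ) ^ 4
      lem₁ : ∀ Q a b E → Q * (2 * a) * (Q * (2 * b)) * E ≡ 4 * (Q * Q) * (a * b * E)
      lem₁ = solve-∀
      lem₂ : ∀ Q n D E → 4 * (Q * Q) * (7 * (1 + D) * (n * (D * (n * (D * (D * (D * 1)))))) * E) ≡ n * n * (28 * (Q * Q) * (1 + D) * (D * D * D * D) * E)
      lem₂ = solve-∀

    I₁≤sym : I₁ ≤ sym-count
    I₁≤sym = ∑𝒢-mono d (λ G D → ⟦⟧-mono (hasIsolatedEdge? G) (symmetric? G) (isolatedEdge⇒symmetric D))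

    E₁≤sym : E₁ ≤ sym-count
    E₁≤sym = ∑𝒢-mono d (λ G D → ⟦⟧-mono (hasEar? G) (symmetric? G) (ear⇒symmetric D))

    all≤isolatedEdge : ∀ C → 2 * slack ≤ n₁ → 1 ≤ n → n ≤ C * (n₁ * n₁) → all-count ≤ (4 * C * Δ + 1) * sym-count
    all≤isolatedEdge C h₁ h₂ h₃ = begin
      all-count                     ≡⟨ ∑𝒢-split hasIsolatedEdge? ⟩
      I₀ + I₁                       ≤⟨ +-monoˡ-≤ I₁ (isolatedEdge-bound C h₁ h₂ h₃) ⟩
      4 * C * Δ * I₁ + I₁           ≡⟨ lem (4 * C * Δ) I₁ ⟩
      (4 * C * Δ + 1) * I₁          ≤⟨ *-monoʳ-≤ (4 * C * Δ + 1) I₁≤sym ⟩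
      (4 * C * Δ + 1) * sym-count   ∎
      where
      open ≤-Reasoning
      lem : ∀ a b → a * b + b ≡ (a + 1) * b
      lem = solve-∀

    all≤ear : ∀ Q → 2 * n₁ ≤ n₂ → 2 * (1 + Δ) ^ 4 ≤ n₂ → 1 ≤ n → n ≤ Q * n₂ →
      all-count ≤ (28 * (Q * Q) * (1 + Δ) * (Δ * Δ * Δ * Δ) + 1) * sym-count
    all≤ear Q h₁ h₂ h₃ h₄ = begin
      all-count           ≡⟨ ∑𝒢-split hasEar? ⟩
      E₀ + E₁             ≤⟨ +-monoˡ-≤ E₁ (ear-bound Q h₁ h₂ h₃ h₄) ⟩
      K * E₁ + E₁         ≡⟨ lem K E₁ ⟩
      (K + 1) * E₁        ≤⟨ *-monoʳ-≤ (K + 1) E₁≤sym ⟩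
      (K + 1) * sym-count ∎
      where
      open ≤-Reasoning
      K : ℕ
      K = 28 * (Q * Q) * (1 + Δ) * (Δ * Δ * Δ * Δ)
      lem : ∀ a b → a * b + b ≡ (a + 1) * b
      lem = solve-∀

    aas-symmetric : ∀ e M → 4 * Δ * suc e ≤ M → 1 ≤ Δ → 2 * slack ≤ n₁ → 1 ≤ n → M * M * n ≤ n₁ * n₁ →
      e * all-count ≤ suc e * sym-count
    aas-symmetric e M M≥ 1≤Δ h₁ 1≤n h₃ = begin
      e * all-count        ≡⟨ cong (e *_) (∑𝒢-split hasIsolatedEdge?) ⟩
      e * (I₀ + I₁)        ≡⟨ *-distribˡ-+ e I₀ I₁ ⟩
      e * I₀ + e * I₁      ≤⟨ +-monoˡ-≤ (e * I₁) eI₀≤ ⟩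
      suc e * I₁           ≤⟨ *-monoʳ-≤ (suc e) I₁≤sym ⟩
      suc e * sym-count    ∎
      where
      open ≤-Reasoning
      k : ℕ
      k = n₁ ∸ slack
      lem₁ : ∀ n D e I → n * (4 * D) * (e * I) ≡ 4 * D * e * 1 * n * I
      lem₁ = solve-∀
      lem₂ : ∀ n D I → 2 * (2 * (n * D) * I) ≡ n * (4 * D) * I
      lem₂ = solve-∀
      lem₃ : ∀ a k I → a * (2 * k) * I ≡ 2 * (a * k * I)
      lem₃ = solve-∀
      -- Since n₁ - slack is at least n₁/2, the odds against an isolated edge are at most 4nΔ/n₁².
      -- In M²n ≤ n₁², one factor `M` absorbs 4Δe and the other is at least 1.
      eI₀≤ : e * I₀ ≤ I₁
      eI₀≤ = cancel-≤ (n * (4 * Δ)) (*-mono-≤ 1≤n (*-mono-≤ {1} {4} (s≤s z≤n) 1≤Δ)) (begin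
        n * (4 * Δ) * (e * I₀)
          ≡⟨ lem₁ n Δ e I₀ ⟩
        4 * Δ * e * 1 * n * I₀
          ≤⟨ *-monoˡ-≤ I₀ (*-monoˡ-≤ n (*-mono-≤ (≤-trans (*-monoʳ-≤ (4 * Δ) (n≤1+n e)) M≥)
               (≤-trans (*-mono-≤ {1} {4 * Δ} (*-mono-≤ {1} {4} (s≤s z≤n) 1≤Δ) (s≤s {0} {e} z≤n)) M≥))) ⟩
        M * M * n * I₀
          ≤⟨ *-monoˡ-≤ I₀ h₃ ⟩
        n₁ * n₁ * I₀
          ≤⟨ *-monoˡ-≤ I₀ (*-monoʳ-≤ n₁ (half-≤ n₁ slack h₁)) ⟩
        n₁ * (2 * k) * I₀
          ≡⟨ lem₃ n₁ k I₀ ⟩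
        2 * (n₁ * k * I₀)
          ≤⟨ *-monoʳ-≤ 2 (few-without-isolatedEdge k (≤-reflexive (m∸n+n≡m (≤-trans (m≤m+n slack _) h₁)))) ⟩
        2 * (2 * (n * Δ) * I₁)
          ≡⟨ lem₂ n Δ I₁ ⟩
        n * (4 * Δ) * I₁ ∎)

    -- Strictness needs a symmetric graph to exist. It does: there is at least one graph with these
    -- degrees, and the number of all graphs is at most `K` times the number of symmetric ones.
    strictly : ∀ K e → K ≤ e → Graphical d → all-count ≤ K * sym-count → all-count < suc e * sym-count
    strictly K e K≤e g h = ≤-trans (s≤s h) (≤-trans (+-monoˡ-≤ (K * sym-count) pos) (≤-trans (≤-reflexive (lem K sym-count)) (*-monoˡ-≤ sym-count (s≤s K≤e))))
      where
      lem : ∀ K s → s + K * s ≡ suc K * s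
      lem = solve-∀
      pos : 1 ≤ sym-count
      pos = ≢0⇒≥1 λ z → <⇒≱ (≤-trans (graphical⇒pos g) h) (≤-reflexive (trans (cong (K *_) z) (*-zeroʳ K)))

slackOf : ℕ → ℕ
slackOf Δ = (1 + Δ) * Δ + (1 + Δ) * Δ

theorem-b : (Δ : ℕ) → 1 ≤ Δ → (d : DegSeqs) → (∀ n i → 1 ≤ d n i × d n i ≤ Δ) →
  Eventually (λ n → Graphical (d n)) →
  (∀ (M : ℕ) → Eventually λ n → M * M * n < nj (d n) 1 * nj (d n) 1) → AAS d Symmetric
theorem-b Δ 1≤Δ d range _ many e = suc (Nₘ + 2 * s * (2 * s)) , λ n N≤n →
  let open SymmetricGraphs (d n) Δ (λ i → proj₁ (range n i)) (λ i → proj₂ (range n i))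
      1≤n = ≤-trans (s≤s z≤n) N≤n
      n₁-large : M * M * n < nj (d n) 1 * nj (d n) 1
      n₁-large = proj₂ (many M) n (≤-trans (≤-trans (m≤m+n Nₘ _) (n≤1+n _)) N≤n)
      2s≤n₁ : 2 * s ≤ nj (d n) 1
      -- As `M` is at least 1, the growth hypothesis gives n₁² > n ≥ (2s)².
      2s≤n₁ = square-cancel-≤ (≤-trans (≤-trans (≤-trans (m≤n+m (2 * s * (2 * s)) Nₘ) (n≤1+n _))
        (≤-trans N≤n (≤-trans (≤-reflexive (sym (*-identityˡ n))) (*-monoˡ-≤ n (*-mono-≤ 1≤M 1≤M))))) (<⇒≤ n₁-large))
      eq = nj-1 (d n) Δ (λ i → proj₂ (range n i))
  in sym-count , all-count , probCounts (d n) symmetric? ,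
     aas-symmetric e M ≤-refl 1≤Δ (subst (2 * s ≤_) eq 2s≤n₁) 1≤n
       (subst (λ k → M * M * n ≤ k * k) eq (<⇒≤ n₁-large))
  where
  s M Nₘ : ℕ
  s = slackOf Δ
  M = 4 * Δ * suc e
  Nₘ = proj₁ (many M)
  1≤M : 1 ≤ M
  1≤M = *-mono-≤ {1} {4 * Δ} (*-mono-≤ {1} {4} (s≤s z≤n) 1≤Δ) (s≤s {0} {e} z≤n)

theorem-c : (Δ : ℕ) → (p q : ℕ) → ∃ λ (e : ℕ) → (d : DegSeqs) → (∀ n i → 1 ≤ d n i × d n i ≤ Δ) →
  Eventually (λ n → Graphical (d n)) →
  Eventually (λ n → (suc p * suc p * n < suc q * suc q * (nj (d n) 1 * nj (d n) 1)) ⊎ (suc p * n < suc q * nj (d n) 2)) →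
  Eventually λ n → ∃ λ s → ∃ λ t → ProbCounts (d n) Symmetric s t × t < suc e * s
-- Isolated edges may be used for some n and ears for others, so the constant has to dominate both.
theorem-c Δ p q = K₁ + K₂ , λ d range (N₀ , graphical) (N₁ , light) →
  suc (N₀ + N₁ + (C * (2 * s * (2 * s)) + (4 * C + suc q * (2 * (1 + Δ) ^ 4)))) , λ n N≤n →
  let open SymmetricGraphs (d n) Δ (λ i → proj₁ (range n i)) (λ i → proj₂ (range n i))
      g = graphical n (≤-trans (≤-trans (m≤m+n N₀ N₁) (≤-trans (m≤m+n (N₀ + N₁) _) (n≤1+n _))) N≤n)
      l = light n (≤-trans (≤-trans (m≤n+m N₁ N₀) (≤-trans (m≤m+n (N₀ + N₁) _) (n≤1+n _))) N≤n)
      rest≤n = ≤-trans (≤-trans (m≤n+m _ (N₀ + N₁)) (n≤1+n _)) N≤n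
      Cs≤n = ≤-trans (m≤m+n _ _) rest≤n
      rest′≤n = ≤-trans (m≤n+m _ (C * (2 * s * (2 * s)))) rest≤n
      4C≤n = ≤-trans (m≤m+n (4 * C) _) rest′≤n
      q≤n = ≤-trans (m≤n+m _ (4 * C)) rest′≤n
      1≤n = ≤-trans (s≤s z≤n) N≤n
      eq₁ = nj-1 (d n) Δ (λ i → proj₂ (range n i))
      eq₂ = nj-2 (d n) Δ (λ i → proj₂ (range n i))
      via-edge : n ≤ C * (nj (d n) 1 * nj (d n) 1) → all-count < suc (K₁ + K₂) * sym-count
      via-edge h = strictly K₁ (K₁ + K₂) (m≤m+n K₁ K₂) g
        (all≤isolatedEdge C (subst (2 * s ≤_) eq₁ (square-cancel-≤ (cancel-≤ C (s≤s z≤n) (≤-trans Cs≤n h)))) 1≤n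
          (subst (λ k → n ≤ C * (k * k)) eq₁ h))
      via-ear : n ≤ suc q * nj (d n) 2 → nj (d n) 1 * nj (d n) 1 ≤ n → all-count < suc (K₁ + K₂) * sym-count
      via-ear h k = strictly K₂ (K₁ + K₂) (m≤n+m K₂ K₁) g
        (all≤ear (suc q) (subst₂ (λ a b → 2 * a ≤ b) eq₁ eq₂ (cancel-≤ (suc q) (s≤s z≤n) (≤-trans (square-cancel-≤ (few (nj (d n) 1) n k 4C≤n)) h)))
          (subst (2 * (1 + Δ) ^ 4 ≤_) eq₂ (cancel-≤ (suc q) (s≤s z≤n) (≤-trans q≤n h))) 1≤n
          (subst (λ k → n ≤ suc q * k) eq₂ h))
  in sym-count , all-count , probCounts (d n) symmetric? ,
     [ (λ h → via-edge (≤-trans (m≤m+n n _) (<⇒≤ h)))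
     -- With many vertices of degree 2 there are still two cases. If n ≤ n₁², isolated edges
     -- suffice. Otherwise n₁ is at most sqrt n, so it is below half of n₂ and few anchors are lost
     -- to leaves.
     , (λ h → [ (λ k → via-edge (≤-trans k (m≤m+n (nj (d n) 1 * nj (d n) 1) _))) , (λ k → via-ear (≤-trans (m≤m+n n _) (<⇒≤ h)) k) ]′ (≤-total n (nj (d n) 1 * nj (d n) 1))) ]′ l
  where
  s C K₁ K₂ : ℕ
  s = slackOf Δ
  C = suc q * suc q
  K₁ = 4 * C * Δ + 1
  K₂ = 28 * (suc q * suc q) * (1 + Δ) * (Δ * Δ * Δ * Δ) + 1
  few : ∀ a n → a * a ≤ n → 4 * C ≤ n → suc q * (2 * a) * (suc q * (2 * a)) ≤ n * n
  few a n h₁ h₂ = ≤-trans (≤-reflexive (lem (suc q) a)) (*-mono-≤ h₂ h₁)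
    where
    lem : ∀ q a → q * (2 * a) * (q * (2 * a)) ≡ 4 * (q * q) * (a * a)
    lem = solve-∀

-- Powers and products

-- Bernoulli's inequality 1 - r/(Q+1) ≤ (1 - 1/(Q+1))^r with denominators cleared. Writing Q + 1 as
-- r + s avoids subtraction.
double-^ : ∀ Q r s → r + s ≡ suc Q → suc Q ^ r * s ≤ suc Q * Q ^ r
double-^ Q zero s refl = ≤-reflexive (trans (*-identityˡ (suc Q)) (sym (*-identityʳ (suc Q))))
double-^ Q (suc r) s eq = begin
  suc Q * suc Q ^ r * s           ≡⟨ lem₁ (suc Q) (suc Q ^ r) s ⟩
  suc Q ^ r * (suc Q * s)         ≤⟨ *-monoʳ-≤ (suc Q ^ r) (+-mono-≤ s≤Q ≤-refl) ⟩
  suc Q ^ r * (Q + Q * s)         ≡⟨ lem₂ (suc Q ^ r) Q s ⟩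
  suc Q ^ r * suc s * Q           ≤⟨ *-monoˡ-≤ Q (double-^ Q r (suc s) (trans (+-suc r s) eq)) ⟩
  suc Q * Q ^ r * Q               ≡⟨ lem₃ (suc Q) (Q ^ r) Q ⟩
  suc Q * (Q * Q ^ r)             ∎
  where
  open ≤-Reasoning
  s≤Q : s ≤ Q
  s≤Q = subst (s ≤_) (suc-injective eq) (m≤n+m s r)
  lem₁ : ∀ a b c → a * b * c ≡ b * (a * c)
  lem₁ = solve-∀
  lem₂ : ∀ a b c → a * (b + b * c) ≡ a * suc c * b
  lem₂ = solve-∀
  lem₃ : ∀ a b c → a * b * c ≡ a * (c * b)
  lem₃ = solve-∀

half-^ : ∀ Q r → r + r ≤ suc Q → suc Q ^ r ≤ 2 * Q ^ r
half-^ Q r h = cancel-≤ (suc Q) (s≤s z≤n) (begin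
  suc Q * suc Q ^ r          ≡⟨ *-comm (suc Q) (suc Q ^ r) ⟩
  suc Q ^ r * suc Q          ≤⟨ *-monoʳ-≤ (suc Q ^ r) (≤-trans (≤-reflexive (sym eq)) (≤-trans (+-monoˡ-≤ s r≤s) (≤-reflexive (cong (s +_) (sym (+-identityʳ s)))))) ⟩
  suc Q ^ r * (2 * s)        ≡⟨ lem (suc Q ^ r) 2 s ⟩
  2 * (suc Q ^ r * s)        ≤⟨ *-monoʳ-≤ 2 (double-^ Q r s eq) ⟩
  2 * (suc Q * Q ^ r)        ≡⟨ lem 2 (suc Q) (Q ^ r) ⟩
  suc Q * (2 * Q ^ r)        ∎)
  where
  open ≤-Reasoning
  s : ℕ
  s = suc Q ∸ r
  eq : r + s ≡ suc Q
  eq = m+[n∸m]≡n (≤-trans (m≤m+n r r) h)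
  r≤s : r ≤ s
  r≤s = +-cancelˡ-≤ r r s (≤-trans h (≤-reflexive (sym eq)))
  lem : ∀ a b c → a * (b * c) ≡ b * (a * c)
  lem = solve-∀

-- (1 + 1/Q)^Q ≤ 4, in two factors of at most 2.
succ-^ : ∀ Q h → h ≤ Q → suc Q ^ h ≤ 4 * Q ^ h
succ-^ Q h h≤Q = begin
  suc Q ^ h                                ≡⟨ cong (suc Q ^_) (⌊n/2⌋+⌈n/2⌉≡n h) ⟨
  suc Q ^ (ℕ.⌊ h /2⌋ + ℕ.⌈ h /2⌉)           ≡⟨ ^-distribˡ-+-* (suc Q) ℕ.⌊ h /2⌋ ℕ.⌈ h /2⌉ ⟩
  suc Q ^ ℕ.⌊ h /2⌋ * suc Q ^ ℕ.⌈ h /2⌉     ≤⟨ *-mono-≤ (half-^ Q ℕ.⌊ h /2⌋ lo) (half-^ Q ℕ.⌈ h /2⌉ hi) ⟩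
  2 * Q ^ ℕ.⌊ h /2⌋ * (2 * Q ^ ℕ.⌈ h /2⌉)   ≡⟨ lem (Q ^ ℕ.⌊ h /2⌋) (Q ^ ℕ.⌈ h /2⌉) ⟩
  4 * (Q ^ ℕ.⌊ h /2⌋ * Q ^ ℕ.⌈ h /2⌉)       ≡⟨ cong (4 *_) (trans (sym (^-distribˡ-+-* Q ℕ.⌊ h /2⌋ ℕ.⌈ h /2⌉)) (cong (Q ^_) (⌊n/2⌋+⌈n/2⌉≡n h))) ⟩
  4 * Q ^ h                                ∎
  where
  open ≤-Reasoning
  lem : ∀ a b → 2 * a * (2 * b) ≡ 4 * (a * b)
  lem = solve-∀
  lo : ℕ.⌊ h /2⌋ + ℕ.⌊ h /2⌋ ≤ suc Q
  lo = ≤-trans (+-monoʳ-≤ ℕ.⌊ h /2⌋ (⌊n/2⌋≤⌈n/2⌉ h)) (≤-trans (≤-reflexive (⌊n/2⌋+⌈n/2⌉≡n h)) (≤-trans h≤Q (n≤1+n Q)))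
  hi : ℕ.⌈ h /2⌉ + ℕ.⌈ h /2⌉ ≤ suc Q
  hi = ≤-trans (+-monoʳ-≤ ℕ.⌈ h /2⌉ (⌊n/2⌋≤⌈n/2⌉ (suc h))) (≤-trans (≤-reflexive (⌊n/2⌋+⌈n/2⌉≡n (suc h))) (s≤s h≤Q))

-- Each unit added to the base multiplies the q-th power by at most 4, because the exponent never
-- exceeds the base.
add-^ : ∀ q L → (q + L) ^ q ≤ 4 ^ L * q ^ q
add-^ q zero = ≤-reflexive (trans (cong (_^ q) (+-identityʳ q)) (sym (*-identityˡ (q ^ q))))
add-^ q (suc L) = begin
  (q + suc L) ^ q             ≡⟨ cong (_^ q) (+-suc q L) ⟩
  suc (q + L) ^ q             ≤⟨ succ-^ (q + L) q (m≤m+n q L) ⟩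
  4 * (q + L) ^ q             ≤⟨ *-monoʳ-≤ 4 (add-^ q L) ⟩
  4 * (4 ^ L * q ^ q)         ≡⟨ *-assoc 4 (4 ^ L) (q ^ q) ⟨
  4 ^ suc L * q ^ q           ∎
  where open ≤-Reasoning

^-cancelʳ-≤ : ∀ k {a b} → 1 ≤ k → a ^ k ≤ b ^ k → a ≤ b
^-cancelʳ-≤ (suc k) _ h = ≮⇒≥ λ b<a → <⇒≱ (^-monoˡ-< (suc k) b<a) h

^-distribʳ-* : ∀ a b k → (a * b) ^ k ≡ a ^ k * b ^ k
^-distribʳ-* a b zero = refl
^-distribʳ-* a b (suc k) = trans (cong (a * b *_) (^-distribʳ-* a b k)) (lem a b (a ^ k) (b ^ k))
  where
  lem : ∀ a b c d → a * b * (c * d) ≡ a * c * (b * d)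
  lem = solve-∀

^-swap : ∀ a k l → (a ^ k) ^ l ≡ (a ^ l) ^ k
^-swap a k l = trans (^-*-assoc a k l) (trans (cong (a ^_) (*-comm k l)) (sym (^-*-assoc a l k)))

^-pos : ∀ {a} k → 1 ≤ a → 1 ≤ a ^ k
^-pos zero _ = ≤-refl
^-pos (suc k) h = *-mono-≤ {1} h (^-pos k h)

^-mono : ∀ {a k l} → 1 ≤ a → k ≤ l → a ^ k ≤ a ^ l
^-mono {a} {k} {l} h k≤l = ^-monoʳ-≤ a {{>-nonZero h}} k≤l

-- The integer form of (1 + L/q)^N ≤ exp(NL/q), with base 4 in place of e.
exp-bound : ∀ q L N K → 1 ≤ q → N * L ≤ K * q → (q + L) ^ N ≤ 4 ^ K * q ^ N
exp-bound q L N K 1≤q h = ^-cancelʳ-≤ q 1≤q (begin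
  ((q + L) ^ N) ^ q             ≡⟨ ^-swap (q + L) N q ⟩
  ((q + L) ^ q) ^ N             ≤⟨ ^-monoˡ-≤ N (add-^ q L) ⟩
  (4 ^ L * q ^ q) ^ N           ≡⟨ ^-distribʳ-* (4 ^ L) (q ^ q) N ⟩
  (4 ^ L) ^ N * (q ^ q) ^ N     ≡⟨ cong₂ _*_ (trans (^-*-assoc 4 L N) (cong (4 ^_) (*-comm L N))) (^-swap q q N) ⟩
  4 ^ (N * L) * (q ^ N) ^ q     ≤⟨ *-monoˡ-≤ ((q ^ N) ^ q) (^-mono (s≤s z≤n) h) ⟩
  4 ^ (K * q) * (q ^ N) ^ q     ≡⟨ cong (_* (q ^ N) ^ q) (sym (^-*-assoc 4 K q)) ⟩
  (4 ^ K) ^ q * (q ^ N) ^ q     ≡⟨ ^-distribʳ-* (4 ^ K) (q ^ N) q ⟨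
  (4 ^ K * q ^ N) ^ q           ∎)
  where open ≤-Reasoning

∏ : ∀ {n} → (Fin n → ℕ) → ℕ
∏ {zero} f = 1
∏ {suc n} f = f zero * ∏ (f ∘ suc)

∏-cong : ∀ {n} {f g : Fin n → ℕ} → (∀ i → f i ≡ g i) → ∏ f ≡ ∏ g
∏-cong {zero} h = refl
∏-cong {suc n} h = cong₂ _*_ (h zero) (∏-cong (h ∘ suc))

∏-* : ∀ {n} (f g : Fin n → ℕ) → ∏ (λ i → f i * g i) ≡ ∏ f * ∏ g
∏-* {zero} f g = refl
∏-* {suc n} f g = trans (cong (f zero * g zero *_) (∏-* (f ∘ suc) (g ∘ suc))) (lem (f zero) (g zero) (∏ (f ∘ suc)) (∏ (g ∘ suc)))
  where
  lem : ∀ a b c d → a * b * (c * d) ≡ a * c * (b * d)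
  lem = solve-∀

∏-const : ∀ n c → ∏ {n} (λ _ → c) ≡ c ^ n
∏-const zero c = refl
∏-const (suc n) c = cong (c *_) (∏-const n c)

∏-mono : ∀ {n} {f g : Fin n → ℕ} → (∀ i → f i ≤ g i) → ∏ f ≤ ∏ g
∏-mono {zero} h = ≤-refl
∏-mono {suc n} h = *-mono-≤ (h zero) (∏-mono (h ∘ suc))

∏-pos : ∀ {n} (f : Fin n → ℕ) → (∀ i → 1 ≤ f i) → 1 ≤ ∏ f
∏-pos {zero} f h = ≤-refl
∏-pos {suc n} f h = *-mono-≤ {1} (h zero) (∏-pos (f ∘ suc) (h ∘ suc))

^-∑ : ∀ {n} a (f : Fin n → ℕ) → a ^ ∑F f ≡ ∏ (λ i → a ^ f i)
^-∑ {zero} a f = refl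
^-∑ {suc n} a f = trans (cong (a ^_) (∑F-suc f)) (trans (^-distribˡ-+-* a (f zero) _) (cong (a ^ f zero *_) (^-∑ a (f ∘ suc))))

∣_∣ : ∀ {n} → Vec Bool n → ℕ
∣ S ∣ = ∑F (λ i → 𝕀 (lookup S i))

weigh : ∀ {n} → Vec Bool n → (p q : Fin n → ℕ) → ℕ
weigh S p q = ∏ (λ i → if lookup S i then p i else q i)

-- Expansion of a product of binomials. Sums over all subsets are evaluated in this way, without
-- binomial coefficients.
∑-subsets : ∀ {n} (p q : Fin n → ℕ) → ∑ (allVecs n) (λ S → weigh S p q) ≡ ∏ (λ i → p i + q i)
∑-subsets {zero} p q = refl
∑-subsets {suc n} p q = begin
  ∑ (allVecs (suc n)) (λ S → weigh S p q)
    ≡⟨ ∑-concatMap _ (allVecs n) (λ S → weigh S p q) ⟩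
  ∑ (allVecs n) (λ S → p zero * rest S + (q zero * rest S + 0))
    ≡⟨ ∑-cong (allVecs n) (λ S → lem (p zero) (q zero) (rest S)) ⟩
  ∑ (allVecs n) (λ S → (p zero + q zero) * rest S)
    ≡⟨ ∑-*ˡ (allVecs n) (p zero + q zero) rest ⟩
  (p zero + q zero) * ∑ (allVecs n) rest
    ≡⟨ cong ((p zero + q zero) *_) (∑-subsets (p ∘ suc) (q ∘ suc)) ⟩
  (p zero + q zero) * ∏ (λ i → p (suc i) + q (suc i)) ∎
  where
  open ≡-Reasoning
  rest : Vec Bool n → ℕ
  rest S = weigh S (p ∘ suc) (q ∘ suc)
  lem : ∀ a b c → a * c + (b * c + 0) ≡ (a + b) * c
  lem = solve-∀

weigh-* : ∀ {n} (S : Vec Bool n) (p q p′ q′ : Fin n → ℕ) → weigh S p q * weigh S p′ q′ ≡ weigh S (λ i → p i * p′ i) (λ i → q i * q′ i)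
weigh-* S p q p′ q′ = trans (sym (∏-* (λ i → if lookup S i then p i else q i) (λ i → if lookup S i then p′ i else q′ i))) (∏-cong (λ i → lem (lookup S i) i))
  where
  lem : ∀ b i → (if b then p i else q i) * (if b then p′ i else q′ i) ≡ (if b then p i * p′ i else q i * q′ i)
  lem true i = refl
  lem false i = refl

weigh-same : ∀ {n} (S : Vec Bool n) (p : Fin n → ℕ) → weigh S p p ≡ ∏ p
weigh-same S p = ∏-cong (λ i → lem (lookup S i) i)
  where
  lem : ∀ b i → (if b then p i else p i) ≡ p i
  lem true i = refl
  lem false i = refl

^-size : ∀ {n} (S : Vec Bool n) a (e : Fin n → ℕ) → a ^ ∑F (λ i → 𝕀 (lookup S i) * e i) ≡ weigh S (λ i → a ^ e i) (λ _ → 1)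
^-size S a e = trans (^-∑ a (λ i → 𝕀 (lookup S i) * e i)) (∏-cong (λ i → lem (lookup S i) i))
  where
  lem : ∀ b i → a ^ (𝕀 b * e i) ≡ (if b then a ^ e i else 1)
  lem true i = cong (a ^_) (+-identityʳ (e i))
  lem false i = refl

In : ∀ {n} → Vec Bool n → Fin n → Set
In S i = T (lookup S i)

in? : ∀ {n} (S : Vec Bool n) i → Dec (In S i)
in? S i = T? (lookup S i)

∑F-product : ∀ {n} (f g : Fin n → ℕ) → ∑F (λ a → ∑F (λ b → f a * g b)) ≡ ∑F f * ∑F g
∑F-product {n} f g = trans (∑-cong (allFin n) (λ a → ∑-*ˡ (allFin n) (f a) g)) (∑-*ʳ (allFin n) (∑F g) f)

∑-cartesianProduct : {A B : Set} (xs : List A) (ys : List B) (f : A × B → ℕ) →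
  ∑ (List.cartesianProduct xs ys) f ≡ ∑ xs (λ x → ∑ ys (λ y → f (x , y)))
∑-cartesianProduct [] ys f = refl
∑-cartesianProduct (x ∷ xs) ys f = trans (∑-++ (map (x ,_) ys) (List.cartesianProduct xs ys) f)
  (cong₂ _+_ (∑-map (x ,_) ys f) (∑-cartesianProduct xs ys f))

∑-filter : {A : Set} {P : A → Set} (P? : ∀ x → Dec (P x)) (xs : List A) (f : A → ℕ) →
  ∑ (filter P? xs) f ≡ ∑ xs (λ x → ⟦ P? x ⟧ * f x)
∑-filter P? [] f = refl
∑-filter P? (x ∷ xs) f with P? x
... | yes _ = cong₂ _+_ (sym (+-identityʳ (f x))) (∑-filter P? xs f)
... | no _ = ∑-filter P? xs f

length≡∑ : {A : Set} (xs : List A) → length xs ≡ ∑ xs (λ _ → 1)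
length≡∑ [] = refl
length≡∑ (x ∷ xs) = cong suc (length≡∑ xs)

_<ᶠ?_ : ∀ {n} (i j : Fin n) → Dec (toℕ i < toℕ j)
i <ᶠ? j = toℕ i <? toℕ j

handshake : ∀ {n} (f : Fin n → Fin n → ℕ) → (∀ i j → f i j ≡ f j i) → (∀ i → f i i ≡ 0) →
  ∑F (λ i → ∑F (f i)) ≡ 2 * ∑F (λ i → ∑F (λ j → ⟦ i <ᶠ? j ⟧ * f i j))
handshake {n} f f-sym f-irr = begin
  ∑F (λ i → ∑F (f i))
    ≡⟨ ∑-cong (allFin n) (λ i → ∑-cong (allFin n) (point i)) ⟩
  ∑F (λ i → ∑F (λ j → up i j + up j i))
    ≡⟨ ∑∑-+ up (λ i j → up j i) ⟩
  U + ∑F (λ i → ∑F (λ j → up j i))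
    ≡⟨ cong (U +_) (trans (∑-swap (allFin n) (allFin n) (λ i j → up j i)) (sym (+-identityʳ U))) ⟩
  2 * U ∎
  where
  open ≡-Reasoning
  up : Fin n → Fin n → ℕ
  up i j = ⟦ i <ᶠ? j ⟧ * f i j
  U : ℕ
  U = ∑F (λ i → ∑F (up i))
  point : ∀ i j → f i j ≡ up i j + up j i
  point i j = go (i <ᶠ? j) (j <ᶠ? i)
    where
    go : (p? : Dec (toℕ i < toℕ j)) (q? : Dec (toℕ j < toℕ i)) → f i j ≡ ⟦ p? ⟧ * f i j + ⟦ q? ⟧ * f j i
    go (yes p) (yes q) = contradiction q (<-asym p)
    go (yes p) (no _) = sym (trans (+-identityʳ _) (+-identityʳ _))
    go (no _) (yes q) = trans (f-sym i j) (sym (+-identityʳ _))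
    go (no p) (no q) with toℕ-injective (≤-antisym (≮⇒≥ q) (≮⇒≥ p))
    ... | refl = f-irr i

-- Automorphisms of small support

degree-into : ∀ {n} → Graph n → Vec Bool n → Fin n → ℕ
degree-into G S y = ∑F (λ i → 𝕀 (lookup S i) * 𝕀 (adj G i y))

Tangled : ∀ {n} → Vec Bool n → Graph n → Set
Tangled S G = ∀ y → ¬ In S y → degree-into G S y ≢ 1

tangled? : ∀ {n} (S : Vec Bool n) (G : Graph n) → Dec (Tangled S G)
tangled? S G = all? λ y → ¬? (in? S y) →-dec ¬? (degree-into G S y ℕ.≟ 1)

boundary : ∀ {n} → Vec Bool n → Graph n → Vec Bool n
boundary S G = Vec.tabulate (λ y → does (¬? (in? S y) ×-dec (1 ≤? degree-into G S y)))

-- A fixed vertex adjacent to a moved vertex `x` is also adjacent to `f x`, which is moved too and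
-- differs from `x`.
moved-tangled : ∀ {n} {G : Graph n} {f g : Fin n → Fin n} → IsAut G f g → Tangled (moved f) G
moved-tangled {n} {G} {f} {g} (isAut fg gf pres) y y∉S k≡1 =
  contradiction (subst (2 ≤_) k≡1 (two-terms k x (f x) (x≢fx ∘ sym) kx kfx)) λ where (s≤s ())
  where
  k : Fin n → ℕ
  k i = 𝕀 (lookup (moved f) i) * 𝕀 (adj G i y)
  fixed : f y ≡ y
  fixed with f y ≟ y
  ... | yes e = e
  ... | no ne = contradiction (moved-⁺ f ne) y∉S
  some : ∃ λ x → k x ≢ 0
  some = ∑-nonzero (allFin n) k (λ z → contradiction (trans (sym z) k≡1) λ ())
  x : Fin n
  x = proj₁ some
  kx : 1 ≤ k x
  kx = ≢0⇒≥1 (proj₂ some)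
  x∈S : In (moved f) x
  x∈S = ⟦⟧-pos (in? (moved f) x) (*≢0ˡ (𝕀 (lookup (moved f) x)) (proj₂ some))
  xy : Adj G x y
  xy = ⟦⟧-pos (adj? G x y) (*≢0ʳ (𝕀 (lookup (moved f) x)) (proj₂ some))
  x≢fx : f x ≢ x
  x≢fx = moved-⁻ f x∈S
  fx∈S : In (moved f) (f x)
  fx∈S = moved-⁺ f (λ e → x≢fx (trans (sym (gf (f x))) (trans (cong g e) (gf x))))
  fxy : Adj G (f x) y
  fxy = subst T (sym (trans (cong (adj G (f x)) (sym fixed)) (pres x y))) xy
  kfx : 1 ≤ k (f x)
  kfx = *-mono-≤ {1} (𝕀-T fx∈S) (𝕀-T fxy)

-- `Λ` to the number of listed pairs that are edges. Its sum over the graphs is an exponential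
-- moment, to be fed into a Markov bound.
edgeWeight : ∀ {n} → ℕ → List (Fin n × Fin n) → Graph n → ℕ
edgeWeight Λ [] G = 1
edgeWeight Λ ((x , y) ∷ zs) G = (if adj G x y then Λ else 1) * edgeWeight Λ zs G

edgeWeight-^ : ∀ {n} a zs (G : Graph n) → edgeWeight (a * a) zs G ≡ a ^ (2 * ∑ zs (λ (x , y) → 𝕀 (adj G x y)))
edgeWeight-^ a [] G = refl
edgeWeight-^ a ((x , y) ∷ zs) G with adj G x y
... | false = trans (+-identityʳ _) (edgeWeight-^ a zs G)
... | true = trans (cong (a * a *_) (edgeWeight-^ a zs G)) (trans (*-assoc a a _) (cong (a ^_) (sym (lem (∑ zs (λ (x , y) → 𝕀 (adj G x y)))))))
  where
  lem : ∀ k → 2 * (1 + k) ≡ suc (suc (2 * k))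
  lem = solve-∀

module SmallSupport {n : ℕ} (d : Fin n → ℕ) (Δ : ℕ) (d≥1 : ∀ i → 1 ≤ d i) (d≤Δ : ∀ i → d i ≤ Δ) where
  open BoundedDegree d Δ d≤Δ
  open LightVertices d Δ d≤Δ

  all-count : ℕ
  all-count = ∑𝒢 d (λ _ → 1)

  module _ (S : Vec Bool n) where

    s : Fin n → ℕ
    s i = 𝕀 (lookup S i)

    m D : ℕ
    m = ∣ S ∣
    D = ∑F (λ i → s i * d i)

    outside : Fin n → Fin n → ℕ
    outside a b = ⟦ ¬? (in? S a) ⟧ * ⟦ ¬? (in? S b) ⟧

    -- Every vertex starts an edge. A vertex is either in `S`, or adjacent to `S`, or the start of
    -- an edge with both ends outside `S`; the first two kinds number at most m + mΔ.
    many-outside : ∀ {G} → HasDegrees d G → n ≤ ∑F (λ a → ∑F (λ b → outside a b * 𝕀 (adj G a b))) + (m + m * Δ)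
    many-outside {G} Dg = begin
      n
        ≡⟨ trans (∑F-const {n} 1) (*-identityʳ n) ⟨
      ∑F {n} (λ _ → 1)
        ≤⟨ ∑-mono (allFin n) (λ a → point a (in? S a)) ⟩
      ∑F (λ a → out a + (s a + into a))
        ≡⟨ trans (∑-+ (allFin n) out (λ a → s a + into a)) (cong (∑F out +_) (∑-+ (allFin n) s into)) ⟩
      ∑F out + (m + ∑F into)
        ≤⟨ +-monoʳ-≤ (∑F out) (+-monoʳ-≤ m into≤) ⟩
      ∑F out + (m + m * Δ) ∎
      where
      open ≤-Reasoning
      out into : Fin n → ℕ
      out a = ∑F (λ b → outside a b * 𝕀 (adj G a b))
      into a = ∑F (λ b → s b * 𝕀 (adj G b a))
      into≤ : ∑F into ≤ m * Δ
      into≤ = begin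
        ∑F into                                  ≡⟨ ∑-swap (allFin n) (allFin n) (λ a b → s b * 𝕀 (adj G b a)) ⟩
        ∑F (λ b → ∑F (λ a → s b * 𝕀 (adj G b a))) ≡⟨ ∑-cong (allFin n) (λ b → ∑-*ˡ (allFin n) (s b) (λ a → 𝕀 (adj G b a))) ⟩
        ∑F (λ b → s b * deg G b)                 ≤⟨ ∑-mono (allFin n) (λ b → *-monoʳ-≤ (s b) (deg≤Δ Dg b)) ⟩
        ∑F (λ b → s b * Δ)                       ≡⟨ ∑-*ʳ (allFin n) Δ s ⟩
        m * Δ                                    ∎
      point : ∀ a → Dec (In S a) → 1 ≤ out a + (s a + into a)
      point a (yes a∈) = ≤-trans (𝕀-T a∈) (≤-trans (m≤m+n (s a) (into a)) (m≤n+m (s a + into a) (out a)))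
      point a (no a∉) = let (b , ab) = some-neighbour G a (subst (1 ≤_) (sym (Dg a)) (d≥1 a)) in via b ab (in? S b)
        where
        via : ∀ b → Adj G a b → Dec (In S b) → 1 ≤ out a + (s a + into a)
        via b ab (yes b∈) = ≤-trans (*-mono-≤ {1} (𝕀-T b∈) (𝕀-T (Adj-sym G ab)))
          (≤-trans (term≤∑ (finE n) (λ b → s b * 𝕀 (adj G b a)) b) (≤-trans (m≤n+m (into a) (s a)) (m≤n+m (s a + into a) (out a))))
        via b ab (no b∉) = ≤-trans (*-mono-≤ {1} (≤-reflexive (sym (cong₂ _*_ (⟦⟧-yes (¬? (in? S a)) a∉) (⟦⟧-yes (¬? (in? S b)) b∉)))) (𝕀-T ab))
          (≤-trans (term≤∑ (finE n) (λ b → outside a b * 𝕀 (adj G a b)) b) (m≤m+n (out a) _))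

    module _ (F : Vec Bool n) where

      -- The pairs that can be edges at `S` once `F` is its outside neighbourhood. The order
      -- condition lists each pair inside `S` once, so that distinct entries are distinct unordered
      -- pairs.
      Zone : Fin n × Fin n → Set
      Zone (i , j) = In S i × (In F j ⊎ (In S j × toℕ i < toℕ j))

      zone? : ∀ z → Dec (Zone z)
      zone? (i , j) = in? S i ×-dec (in? F j ⊎-dec (in? S j ×-dec i <ᶠ? j))

      zone : List (Fin n × Fin n)
      zone = filter zone? (List.cartesianProduct (allFin n) (allFin n))

      Disjoint : Set
      Disjoint = ∀ i → In F i → ¬ In S i

      module _ (disj : Disjoint) where

        zone-separated : ∀ {x y i j} → Zone (x , y) → Zone (i , j) → (x , y) ≢ (i , j) → ¬ SamePair x y i j
        zone-separated z z′ ne (inj₁ (refl , refl)) = ne refl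
        zone-separated (x∈ , inj₁ y∈F) (y∈ , _) ne (inj₂ (refl , refl)) = disj _ y∈F y∈
        zone-separated (x∈ , inj₂ (y∈ , x<y)) (_ , inj₁ x∈F) ne (inj₂ (refl , refl)) = disj _ x∈F x∈
        zone-separated (x∈ , inj₂ (y∈ , x<y)) (_ , inj₂ (_ , y<x)) ne (inj₂ (refl , refl)) = <-asym x<y y<x

        -- Revealing one pair at a time, each pair costs a factor 1 + ΛΔ²/β.
        mgf : ∀ β Λ → 1 ≤ Λ → β + slack + (m + m * Δ) ≤ n → ∀ zs → Unique zs → All Zone zs →
          β ^ length zs * ∑𝒢 d (edgeWeight Λ zs) ≤ (β + Λ * (Δ * Δ)) ^ length zs * all-count
        mgf β Λ 1≤Λ β≤ [] _ _ = ≤-refl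
        mgf β Λ 1≤Λ β≤ ((x , y) ∷ zs) (z∉ ∷ uniq) (z ∷ zones) = begin
          β * β ^ length zs * ∑𝒢 d (edgeWeight Λ ((x , y) ∷ zs))
            ≤⟨ *-monoʳ-≤ (β * β ^ length zs) (≤-trans (∑𝒢-mono d split) (≤-reflexive (trans (∑𝒢-+ d W (λ G → Λ * (𝕀 (adj G x y) * W G))) (cong (∑𝒢 d W +_) (∑𝒢-* d Λ (λ G → 𝕀 (adj G x y) * W G)))))) ⟩
          β * β ^ length zs * (∑𝒢 d W + Λ * V)
            ≡⟨ lem₁ β (β ^ length zs) (∑𝒢 d W) Λ V ⟩
          β ^ length zs * (β * ∑𝒢 d W + Λ * (β * V))
            ≤⟨ *-monoʳ-≤ (β ^ length zs) (+-monoʳ-≤ (β * ∑𝒢 d W) (*-monoʳ-≤ Λ (switching-bound x y outside W β outside≤1 mono many))) ⟩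
          β ^ length zs * (β * ∑𝒢 d W + Λ * (Δ * Δ * ∑𝒢 d W))
            ≡⟨ lem₂ (β ^ length zs) β (∑𝒢 d W) Λ (Δ * Δ) ⟩
          (β + Λ * (Δ * Δ)) * (β ^ length zs * ∑𝒢 d W)
            ≤⟨ *-monoʳ-≤ (β + Λ * (Δ * Δ)) (mgf β Λ 1≤Λ β≤ zs uniq zones) ⟩
          (β + Λ * (Δ * Δ)) * ((β + Λ * (Δ * Δ)) ^ length zs * all-count)
            ≡⟨ *-assoc (β + Λ * (Δ * Δ)) ((β + Λ * (Δ * Δ)) ^ length zs) all-count ⟨
          (β + Λ * (Δ * Δ)) * (β + Λ * (Δ * Δ)) ^ length zs * all-count ∎
          where
          open ≤-Reasoning
          W : Graph n → ℕ
          W = edgeWeight Λ zs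
          V : ℕ
          V = ∑𝒢 d (λ G → 𝕀 (adj G x y) * W G)
          lem₁ : ∀ b p w L v → b * p * (w + L * v) ≡ p * (b * w + L * (b * v))
          lem₁ = solve-∀
          lem₂ : ∀ p b w L D → p * (b * w + L * (D * w)) ≡ (b + L * D) * (p * w)
          lem₂ = solve-∀
          split : ∀ G → HasDegrees d G → edgeWeight Λ ((x , y) ∷ zs) G ≤ W G + Λ * (𝕀 (adj G x y) * W G)
          split G _ with adj G x y
          ... | true = ≤-trans (*-monoʳ-≤ Λ (≤-reflexive (sym (*-identityˡ (W G))))) (m≤n+m _ (W G))
          ... | false = ≤-trans (≤-reflexive (*-identityˡ (W G))) (m≤m+n (W G) _)
          outside≤1 : ∀ a b → outside a b ≤ 1
          outside≤1 a b = *-mono-≤ (⟦⟧≤1 (¬? (in? S a))) (⟦⟧≤1 (¬? (in? S b)))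
          many : ∀ G → HasDegrees d G → β + slack ≤ ∑F (λ a → ∑F (λ b → outside a b * 𝕀 (adj G a b)))
          many G Dg = +-cancelʳ-≤ (m + m * Δ) (β + slack) (∑F (λ a → ∑F (λ b → outside a b * 𝕀 (adj G a b)))) (≤-trans β≤ (many-outside Dg))
          -- Every pair of the zone has an end in `S`, so removing an edge `ab` outside `S` destroys
          -- none of them.
          mono : ∀ G a b → outside a b ≢ 0 → Switchable G x y a b → W G ≤ W (switch x y a b G)
          mono G a b out sw = go zs z∉ zones
            where
            a∉ : ¬ In S a
            a∉ = ⟦⟧-pos (¬? (in? S a)) (*≢0ˡ ⟦ ¬? (in? S a) ⟧ out)
            b∉ : ¬ In S b
            b∉ = ⟦⟧-pos (¬? (in? S b)) (*≢0ʳ ⟦ ¬? (in? S a) ⟧ out)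
            keep : ∀ i j → (x , y) ≢ (i , j) → Zone (i , j) → Adj G i j → Adj (switch x y a b G) i j
            keep i j ne z′ ij = switch-keeps sw i j ij (zone-separated z z′ ne)
              (λ where (inj₁ (refl , refl)) → a∉ (proj₁ z′)
                       (inj₂ (refl , refl)) → b∉ (proj₁ z′))
            factor : ∀ b c → (T b → T c) → (if b then Λ else 1) ≤ (if c then Λ else 1)
            factor true true _ = ≤-refl
            factor true false h = ⊥-elim (h tt)
            factor false true _ = 1≤Λ
            factor false false _ = ≤-refl
            go : ∀ zs → All ((x , y) ≢_) zs → All Zone zs → edgeWeight Λ zs G ≤ edgeWeight Λ zs (switch x y a b G)
            go [] _ _ = ≤-refl
            go ((i , j) ∷ zs) (ne ∷ nes) (z′ ∷ zs′) = *-mono-≤ (factor (adj G i j) (adj (switch x y a b G) i j) (keep i j ne z′)) (go zs nes zs′)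

        zone-indicator : ∀ i j → ⟦ zone? (i , j) ⟧ ≡ s i * (𝕀 (lookup F j) + ⟦ i <ᶠ? j ⟧ * s j)
        zone-indicator i j = trans (⟦⟧-× (in? S i) (in? F j ⊎-dec (in? S j ×-dec i <ᶠ? j))) (cong (s i *_) (lem (lookup F j) (lookup S j) (i <ᶠ? j) (disj j)))
          where
          lem : ∀ f t {P : Set} (p? : Dec P) → (T f → ¬ T t) → ⟦ T? f ⊎-dec (T? t ×-dec p?) ⟧ ≡ 𝕀 f + ⟦ p? ⟧ * 𝕀 t
          lem true true _ h = ⊥-elim (h tt tt)
          lem true false p? h = cong suc (sym (*-zeroʳ ⟦ p? ⟧))
          lem false true p? h = sym (*-identityʳ ⟦ p? ⟧)
          lem false false p? h = sym (*-zeroʳ ⟦ p? ⟧)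

        zone-sum : ∀ (g : Fin n → Fin n → ℕ) → ∑ zone (λ (i , j) → g i j) ≡ ∑F (λ i → ∑F (λ j → s i * (𝕀 (lookup F j) + ⟦ i <ᶠ? j ⟧ * s j) * g i j))
        zone-sum g = trans (∑-filter zone? (List.cartesianProduct (allFin n) (allFin n)) (λ (i , j) → g i j))
          (trans (∑-cartesianProduct (allFin n) (allFin n) (λ z → ⟦ zone? z ⟧ * g (proj₁ z) (proj₂ z)))
            (∑-cong (allFin n) (λ i → ∑-cong (allFin n) (λ j → cong (_* g i j) (zone-indicator i j)))))

        zone-length : length zone ≤ m * (∣ F ∣ + m)
        zone-length = begin
          length zone
            ≡⟨ trans (length≡∑ zone) (zone-sum (λ _ _ → 1)) ⟩
          ∑F (λ i → ∑F (λ j → s i * (𝕀 (lookup F j) + ⟦ i <ᶠ? j ⟧ * s j) * 1))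
            ≤⟨ double-∑F-mono (λ i j → ≤-trans (≤-reflexive (*-identityʳ _)) (*-monoʳ-≤ (s i) (+-monoʳ-≤ (𝕀 (lookup F j)) (≤-trans (*-monoˡ-≤ (s j) (⟦⟧≤1 (i <ᶠ? j))) (≤-reflexive (*-identityˡ (s j))))))) ⟩
          ∑F (λ i → ∑F (λ j → s i * (𝕀 (lookup F j) + s j)))
            ≡⟨ ∑F-product s (λ j → 𝕀 (lookup F j) + s j) ⟩
          m * ∑F (λ j → 𝕀 (lookup F j) + s j)
            ≡⟨ cong (m *_) (∑-+ (allFin n) (λ j → 𝕀 (lookup F j)) s) ⟩
          m * (∣ F ∣ + m) ∎
          where open ≤-Reasoning

      module _ {G : Graph n} (Dg : HasDegrees d G) (tangled : Tangled S G) (bd : boundary S G ≡ F) where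

        private
          boundary-⁻ : ∀ y → In F y → ¬ In S y × 1 ≤ degree-into G S y
          boundary-⁻ y y∈F = ⟦⟧-pos (¬? (in? S y) ×-dec (1 ≤? degree-into G S y))
            (λ z → contradiction (trans (sym (cong 𝕀 (T⇒≡ y∈F))) (trans (cong 𝕀 (trans (cong (λ F → lookup F y) (sym bd)) (Vec.lookup∘tabulate _ y))) z)) λ ())
          boundary-⁺ : ∀ y → ¬ In S y → 1 ≤ degree-into G S y → In F y
          boundary-⁺ y y∉ k = ≡⇒T (trans (cong (λ F → lookup F y) (sym bd)) (trans (Vec.lookup∘tabulate _ y) (does-yes (¬? (in? S y) ×-dec (1 ≤? degree-into G S y)) (y∉ , k))))
          A : Fin n → Fin n → ℕ
          A i j = 𝕀 (adj G i j)
          F′ : Fin n → ℕ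
          F′ j = 𝕀 (lookup F j)
          X Y Y′ : ℕ
          X = ∑F (λ i → ∑F (λ j → s i * F′ j * A i j))
          Y = ∑F (λ i → ∑F (λ j → s i * s j * A i j))
          Y′ = ∑F (λ i → ∑F (λ j → ⟦ i <ᶠ? j ⟧ * (s i * s j * A i j)))
          D≡ : D ≡ ∑F (λ i → ∑F (λ j → s i * A i j))
          D≡ = ∑-cong (allFin n) (λ i → trans (cong (s i *_) (sym (Dg i))) (sym (∑-*ˡ (allFin n) (s i) (A i))))
          Y≡ : Y ≡ 2 * Y′
          Y≡ = handshake (λ i j → s i * s j * A i j) (λ i j → cong₂ _*_ (*-comm (s i) (s j)) (cong 𝕀 (adj-sym G i j)))
            (λ i → trans (cong (λ b → s i * s i * 𝕀 b) (adj-irrefl G i)) (*-zeroʳ (s i * s i)))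
          D≤ : D ≤ X + Y
          D≤ = subst₂ _≤_ (sym D≡) (∑∑-+ (λ i j → s i * F′ j * A i j) (λ i j → s i * s j * A i j)) (double-∑F-mono point)
            where
            point : ∀ i j → s i * A i j ≤ s i * F′ j * A i j + s i * s j * A i j
            point i j = ≤-trans (⟦⟧*≤ (in? S i) λ i∈ → ⟦⟧≤ (adj? G i j) λ ij → by i∈ ij (in? S j)) (≤-reflexive (*-distribʳ-+ (A i j) (s i * F′ j) (s i * s j)))
              where
              by : In S i → Adj G i j → Dec (In S j) → 1 ≤ (s i * F′ j + s i * s j) * A i j
              by i∈ ij j? = *-mono-≤ {1} (≤-trans (one j?) (≤-reflexive (*-distribˡ-+ (s i) (F′ j) (s j)))) (𝕀-T ij)
                where
                si : 1 ≤ s i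
                si = 𝕀-T i∈
                one : Dec (In S j) → 1 ≤ s i * (F′ j + s j)
                one (yes j∈) = *-mono-≤ {1} si (≤-trans (𝕀-T j∈) (m≤n+m (s j) (F′ j)))
                one (no j∉) = *-mono-≤ {1} si (≤-trans (𝕀-T (boundary-⁺ j j∉ k)) (m≤m+n (F′ j) (s j)))
                  where
                  k : 1 ≤ degree-into G S j
                  k = ≤-trans (*-mono-≤ {1} si (𝕀-T ij)) (term≤∑ (finE n) (λ i → s i * A i j) i)
          X≡ : ∑F (λ j → F′ j * degree-into G S j) ≡ X
          X≡ = trans (∑-cong (allFin n) (λ j → trans (sym (∑-*ˡ (allFin n) (F′ j) (λ i → s i * A i j))) (∑-cong (allFin n) (λ i → lem (F′ j) (s i) (A i j)))))
            (∑-swap (allFin n) (allFin n) (λ j i → s i * F′ j * A i j))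
            where
            lem : ∀ a b c → a * (b * c) ≡ b * a * c
            lem = solve-∀
          2f≤X : 2 * ∣ F ∣ ≤ X
          2f≤X = subst₂ _≤_ (∑-*ˡ (allFin n) 2 F′) X≡ (∑-mono (allFin n) point)
            where
            point : ∀ j → 2 * F′ j ≤ F′ j * degree-into G S j
            point j = ≤-trans (≤-reflexive (*-comm 2 (F′ j))) (⟦⟧*≤ (in? F j) λ j∈ →
              let (j∉S , k) = boundary-⁻ j j∈ in ≤-trans (≤∧≢⇒< k (λ e → tangled j j∉S (sym e)))
                (≤-trans (≤-reflexive (sym (*-identityˡ _))) (*-monoˡ-≤ (degree-into G S j) (𝕀-T j∈))))

        boundary-disjoint : Disjoint
        boundary-disjoint i i∈F = proj₁ (boundary-⁻ i i∈F)

        boundary-size : ∣ F ∣ ≤ m * Δ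
        boundary-size = begin
          ∣ F ∣                ≤⟨ m≤m+n ∣ F ∣ _ ⟩
          2 * ∣ F ∣            ≤⟨ 2f≤X ⟩
          X                    ≤⟨ double-∑F-mono (λ i j → *-monoˡ-≤ (A i j) (≤-trans (*-monoʳ-≤ (s i) (⟦⟧≤1 (in? F j))) (≤-reflexive (*-identityʳ (s i))))) ⟩
          ∑F (λ i → ∑F (λ j → s i * A i j)) ≡⟨ D≡ ⟨
          D                    ≤⟨ ∑-mono (allFin n) (λ i → *-monoʳ-≤ (s i) (d≤Δ i)) ⟩
          ∑F (λ i → s i * Δ)   ≡⟨ ∑-*ʳ (allFin n) Δ s ⟩
          m * Δ                ∎
          where open ≤-Reasoning

        -- Let X count the edges between `S` and `F`, and Y′ those inside `S`. Then D ≤ X + 2Y′, and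
        -- X is at least 2|F| because every vertex of `F` has two neighbours in `S`. Adding the two
        -- gives twice the number of edges in the zone.
        zone-edges : D + 2 * ∣ F ∣ ≤ 2 * ∑ zone (λ (x , y) → 𝕀 (adj G x y))
        zone-edges = begin
          D + 2 * ∣ F ∣         ≤⟨ +-mono-≤ D≤ 2f≤X ⟩
          X + Y + X             ≡⟨ cong (λ y → X + y + X) Y≡ ⟩
          X + 2 * Y′ + X        ≡⟨ lem X Y′ ⟩
          2 * (X + Y′)          ≡⟨ cong (2 *_) (trans (zone-sum boundary-disjoint A) (trans (∑-cong (allFin n) (λ i → ∑-cong (allFin n) (λ j → lem₂ (s i) (F′ j) ⟦ i <ᶠ? j ⟧ (s j) (A i j))))
                                     (∑∑-+ (λ i j → s i * F′ j * A i j) (λ i j → ⟦ i <ᶠ? j ⟧ * (s i * s j * A i j))))) ⟨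
          2 * ∑ zone (λ (x , y) → 𝕀 (adj G x y)) ∎
          where
          open ≤-Reasoning
          lem : ∀ x y → x + 2 * y + x ≡ 2 * (x + y)
          lem = solve-∀
          lem₂ : ∀ a f p b e → a * (f + p * b) * e ≡ a * f * e + p * (a * b * e)
          lem₂ = solve-∀

-- First moment over small vertex sets

greatest : {P : ℕ → Set} (P? : ∀ k → Dec (P k)) → P 0 → ∀ N → ¬ P N → ∃ λ a → P a × ¬ P (suc a)
greatest P? p zero ¬p = contradiction p ¬p
greatest P? p (suc N) ¬p with P? N
... | yes q = N , q , ¬p
... | no ¬q = greatest P? p N ¬q

geometric : ∀ N (y : ℕ → ℕ) t → (∀ k → y k * 2 ^ suc k ≤ t) → ∑F {N} (λ i → y (toℕ i)) ≤ t
geometric zero y t h = z≤n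
geometric (suc N) y t h = cancel-≤ 2 (s≤s z≤n) (begin
  2 * ∑F {suc N} (λ i → y (toℕ i))
    ≡⟨ cong (2 *_) (∑F-suc {N} (λ i → y (toℕ i))) ⟩
  2 * (y 0 + ∑F {N} (λ i → y (suc (toℕ i))))
    ≡⟨ *-distribˡ-+ 2 (y 0) _ ⟩
  2 * y 0 + 2 * ∑F {N} (λ i → y (suc (toℕ i)))
    ≡⟨ cong₂ _+_ (*-comm 2 (y 0)) (sym (∑-*ˡ (allFin N) 2 (λ i → y (suc (toℕ i))))) ⟩
  y 0 * 2 + ∑F {N} (λ i → 2 * y (suc (toℕ i)))
    ≤⟨ +-mono-≤ (h 0) (geometric N (λ k → 2 * y (suc k)) t (λ k → ≤-trans (≤-reflexive (lem (y (suc k)) (2 ^ suc k))) (h (suc k)))) ⟩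
  t + t
    ≡⟨ cong (t +_) (+-identityʳ t) ⟨
  2 * t ∎)
  where
  open ≤-Reasoning
  lem : ∀ a b → 2 * a * b ≡ a * (2 * b)
  lem = solve-∀

^-double : ∀ a k → a ^ (2 * k) ≡ (a * a) ^ k
^-double a k = trans (sym (^-*-assoc a 2 k)) (cong (_^ k) (cong (a *_) (*-identityʳ a)))

module SmallSupportCount {n : ℕ} (d : Fin n → ℕ) (Δ : ℕ) (d≥1 : ∀ i → 1 ≤ d i) (d≤Δ : ∀ i → d i ≤ Δ) where
  open BoundedDegree d Δ d≤Δ
  open LightVertices d Δ d≤Δ
  open SmallSupport d Δ d≥1 d≤Δ

  K : ℕ
  K = (1 + Δ) * (Δ * Δ)

  ∣S∣≤n : (S : Vec Bool n) → ∣ S ∣ ≤ n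
  ∣S∣≤n S = ≤-trans (∑-mono (allFin n) (λ i → ⟦⟧≤1 (in? S i))) (≤-reflexive (trans (∑F-const {n} 1) (*-identityʳ n)))

  module _ (S : Vec Bool n) (β a : ℕ) (1≤a : 1 ≤ a) (1≤β : 1 ≤ β) (β≤ : β + slack + (m S + m S * Δ) ≤ n) (maa≤β : m S * (a * a) ≤ β) where

    -- Exponential Markov inequality with Λ = a². On the event the weight is at least a^(D + 2|F|)
    -- by `zone-edges`; by `mgf` its mean is at most 1 + a²Δ²/β to the number of zone pairs. There
    -- are at most m²(1 + Δ) such pairs, so m a² ≤ β bounds the mean by 4^(Km).
    tangled-boundary-bound : ∀ F → a ^ (D S + 2 * ∣ F ∣) * ∑𝒢 d (λ G → ⟦ _≟ᴱ_ (vecE n) (boundary S G) F ⟧ * ⟦ tangled? S G ⟧) ≤ 4 ^ (K * m S) * all-count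
    tangled-boundary-bound F = go (all? (λ i → in? F i →-dec ¬? (in? S i))) (∣ F ∣ ≤? m S * Δ)
      where
      open ≤-Reasoning
      X : Graph n → ℕ
      X G = ⟦ _≟ᴱ_ (vecE n) (boundary S G) F ⟧ * ⟦ tangled? S G ⟧
      facts : ∀ G → X G ≢ 0 → boundary S G ≡ F × Tangled S G
      facts G ne = ⟦⟧-pos (_≟ᴱ_ (vecE n) (boundary S G) F) (*≢0ˡ ⟦ _≟ᴱ_ (vecE n) (boundary S G) F ⟧ ne) , ⟦⟧-pos (tangled? S G) (*≢0ʳ ⟦ _≟ᴱ_ (vecE n) (boundary S G) F ⟧ ne)
      impossible : (∀ {G} → HasDegrees d G → boundary S G ≡ F → Tangled S G → ⊥) → a ^ (D S + 2 * ∣ F ∣) * ∑𝒢 d X ≤ 4 ^ (K * m S) * all-count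
      impossible h = ≡0⇒≤ (trans (cong (a ^ (D S + 2 * ∣ F ∣) *_) (n≤0⇒n≡0 (≤-trans (∑𝒢-mono d {w = λ _ → 0} zero-at) (≤-reflexive (∑𝒢-* d 0 (λ _ → 0)))))) (*-zeroʳ (a ^ (D S + 2 * ∣ F ∣))))
        where
        zero-at : ∀ G → HasDegrees d G → X G ≤ 0
        zero-at G Dg with X G ℕ.≟ 0
        ... | yes z = ≤-reflexive z
        ... | no ne = let (b , t) = facts G ne in ⊥-elim (h Dg b t)
      go : Dec (Disjoint S F) → Dec (∣ F ∣ ≤ m S * Δ) → a ^ (D S + 2 * ∣ F ∣) * ∑𝒢 d X ≤ 4 ^ (K * m S) * all-count
      -- A set that meets `S` or is too large is never the boundary, and the sum is empty.
      go (no ¬disj) _ = impossible (λ Dg b t → ¬disj (boundary-disjoint S F Dg t b))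
      go (yes _) (no ¬le) = impossible (λ Dg b t → ¬le (boundary-size S F Dg t b))
      go (yes disj) (yes le) = cancel-≤ (β ^ l) (^-pos l 1≤β) (begin
        β ^ l * (a ^ (D S + 2 * ∣ F ∣) * ∑𝒢 d X)
          ≤⟨ *-monoʳ-≤ (β ^ l) (≤-trans (≤-reflexive (sym (∑𝒢-* d (a ^ (D S + 2 * ∣ F ∣)) X))) (∑𝒢-mono d markov)) ⟩
        β ^ l * ∑𝒢 d (edgeWeight (a * a) zs)
          ≤⟨ mgf S F disj β (a * a) (*-mono-≤ {1} 1≤a 1≤a) β≤ zs
               (Unique.filter⁺ (zone? S F) (Unique.cartesianProduct⁺ (Unique.allFin⁺ n) (Unique.allFin⁺ n)))
               (All.all-filter (zone? S F) (List.cartesianProduct (allFin n) (allFin n))) ⟩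
        (β + a * a * (Δ * Δ)) ^ l * all-count
          ≤⟨ *-monoˡ-≤ all-count (exp-bound β (a * a * (Δ * Δ)) l (K * m S) 1≤β exponent) ⟩
        4 ^ (K * m S) * β ^ l * all-count
          ≡⟨ lem₁ (4 ^ (K * m S)) (β ^ l) all-count ⟩
        β ^ l * (4 ^ (K * m S) * all-count) ∎)
        where
        zs : List (Fin n × Fin n)
        zs = zone S F
        l : ℕ
        l = length zs
        lem₁ : ∀ a b c → a * b * c ≡ b * (a * c)
        lem₁ = solve-∀
        lem₂ : ∀ m a D → m * (m * D + m) * (a * a * (D * D)) ≡ (1 + D) * (D * D) * m * (m * (a * a))
        lem₂ = solve-∀
        exponent : l * (a * a * (Δ * Δ)) ≤ K * m S * β
        exponent = begin
          l * (a * a * (Δ * Δ))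
            ≤⟨ *-monoˡ-≤ (a * a * (Δ * Δ)) (≤-trans (zone-length S F disj) (*-monoʳ-≤ (m S) (+-monoˡ-≤ (m S) le))) ⟩
          m S * (m S * Δ + m S) * (a * a * (Δ * Δ))
            ≡⟨ lem₂ (m S) a Δ ⟩
          K * m S * (m S * (a * a))
            ≤⟨ *-monoʳ-≤ (K * m S) maa≤β ⟩
          K * m S * β ∎
        markov : ∀ G → HasDegrees d G → a ^ (D S + 2 * ∣ F ∣) * X G ≤ edgeWeight (a * a) zs G
        markov G Dg with X G ℕ.≟ 0
        ... | yes z = ≡0⇒≤ (trans (cong (a ^ (D S + 2 * ∣ F ∣) *_) z) (*-zeroʳ (a ^ (D S + 2 * ∣ F ∣))))
        ... | no ne = let (b , t) = facts G ne in begin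
          a ^ (D S + 2 * ∣ F ∣) * X G
            ≤⟨ *-monoʳ-≤ (a ^ (D S + 2 * ∣ F ∣)) (*-mono-≤ (⟦⟧≤1 (_≟ᴱ_ (vecE n) (boundary S G) F)) (⟦⟧≤1 (tangled? S G))) ⟩
          a ^ (D S + 2 * ∣ F ∣) * 1
            ≡⟨ *-identityʳ _ ⟩
          a ^ (D S + 2 * ∣ F ∣)
            ≤⟨ ^-mono 1≤a (zone-edges S F Dg t b) ⟩
          a ^ (2 * ∑ zs (λ (x , y) → 𝕀 (adj G x y)))
            ≡⟨ edgeWeight-^ a zs G ⟨
          edgeWeight (a * a) zs G ∎

    -- Summing over all `F`, the factors a^(-2|F|) add up to (1 + 1/a²)^n, which is at most 4^(Cm)
    -- since n ≤ C m a². Multiplying by (a²)^n keeps every term integral.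
    tangled-bound : ∀ C → n ≤ C * (m S * (a * a)) → a ^ D S * ∑𝒢 d (λ G → ⟦ tangled? S G ⟧) ≤ 4 ^ ((C + K) * m S) * all-count
    tangled-bound C n≤ = cancel-≤ ((a * a) ^ n) (^-pos n (*-mono-≤ {1} 1≤a 1≤a)) (begin
      (a * a) ^ n * (a ^ D S * ∑𝒢 d (λ G → ⟦ tangled? S G ⟧))
        ≡⟨ cong (λ k → (a * a) ^ n * (a ^ D S * k)) by-boundary ⟩
      (a * a) ^ n * (a ^ D S * ∑ (allVecs n) X)
        ≡⟨ *-assoc ((a * a) ^ n) (a ^ D S) (∑ (allVecs n) X) ⟨
      (a * a) ^ n * a ^ D S * ∑ (allVecs n) X
        ≡⟨ ∑-*ˡ (allVecs n) ((a * a) ^ n * a ^ D S) X ⟨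
      ∑ (allVecs n) (λ F → (a * a) ^ n * a ^ D S * X F)
        ≤⟨ ∑-mono (allVecs n) step ⟩
      ∑ (allVecs n) (λ F → weigh F (λ _ → 1) (λ _ → a * a) * (4 ^ (K * m S) * all-count))
        ≡⟨ ∑-*ʳ (allVecs n) (4 ^ (K * m S) * all-count) (λ F → weigh F (λ _ → 1) (λ _ → a * a)) ⟩
      ∑ (allVecs n) (λ F → weigh F (λ _ → 1) (λ _ → a * a)) * (4 ^ (K * m S) * all-count)
        ≡⟨ cong (_* (4 ^ (K * m S) * all-count)) (trans (∑-subsets {n} (λ _ → 1) (λ _ → a * a)) (trans (∏-const n (1 + a * a)) (cong (_^ n) (+-comm 1 (a * a))))) ⟩
      (a * a + 1) ^ n * (4 ^ (K * m S) * all-count)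
        ≤⟨ *-monoˡ-≤ (4 ^ (K * m S) * all-count) (exp-bound (a * a) 1 n (C * m S) (*-mono-≤ {1} 1≤a 1≤a) (≤-trans (≤-reflexive (*-identityʳ n)) (≤-trans n≤ (≤-reflexive (sym (*-assoc C (m S) (a * a))))))) ⟩
      4 ^ (C * m S) * (a * a) ^ n * (4 ^ (K * m S) * all-count)
        ≡⟨ trans (lem (4 ^ (C * m S)) ((a * a) ^ n) (4 ^ (K * m S)) all-count) (cong (λ k → (a * a) ^ n * (k * all-count)) (trans (sym (^-distribˡ-+-* 4 (C * m S) (K * m S))) (cong (4 ^_) (sym (*-distribʳ-+ (m S) C K))))) ⟩
      (a * a) ^ n * (4 ^ ((C + K) * m S) * all-count) ∎)
      where
      open ≤-Reasoning
      X : Vec Bool n → ℕ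
      X F = ∑𝒢 d (λ G → ⟦ _≟ᴱ_ (vecE n) (boundary S G) F ⟧ * ⟦ tangled? S G ⟧)
      lem : ∀ a b c e → a * b * (c * e) ≡ b * (a * c * e)
      lem = solve-∀
      by-boundary : ∑𝒢 d (λ G → ⟦ tangled? S G ⟧) ≡ ∑ (allVecs n) X
      by-boundary = trans (∑𝒢-cong d (λ G _ → sym (pick (vecE n) (boundary S G) (λ _ → ⟦ tangled? S G ⟧))))
        (∑𝒢-swap d (allVecs n) (λ G F → ⟦ _≟ᴱ_ (vecE n) (boundary S G) F ⟧ * ⟦ tangled? S G ⟧))
      square-power : ∀ F → (a * a) ^ n ≡ weigh F (λ _ → 1) (λ _ → a * a) * a ^ (2 * ∣ F ∣)
      square-power F = sym (trans (cong (weigh F (λ _ → 1) (λ _ → a * a) *_) (trans (^-double a ∣ F ∣)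
        (trans (cong ((a * a) ^_) (∑-cong (allFin n) (λ i → sym (*-identityʳ (𝕀 (lookup F i)))))) (^-size F (a * a) (λ _ → 1)))))
        (trans (weigh-* F (λ _ → 1) (λ _ → a * a) (λ _ → (a * a) ^ 1) (λ _ → 1))
          (trans (∏-cong (λ i → same (lookup F i))) (∏-const n (a * a)))))
        where
        same : ∀ b → (if b then 1 * (a * a) ^ 1 else (a * a) * 1) ≡ a * a
        same true = trans (*-identityˡ _) (*-identityʳ (a * a))
        same false = *-identityʳ (a * a)
      step : ∀ F → (a * a) ^ n * a ^ D S * X F ≤ weigh F (λ _ → 1) (λ _ → a * a) * (4 ^ (K * m S) * all-count)
      step F = begin
        (a * a) ^ n * a ^ D S * X F
          ≡⟨ cong (λ k → k * a ^ D S * X F) (square-power F) ⟩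
        weigh F (λ _ → 1) (λ _ → a * a) * a ^ (2 * ∣ F ∣) * a ^ D S * X F
          ≡⟨ lem₂ (weigh F (λ _ → 1) (λ _ → a * a)) (a ^ (2 * ∣ F ∣)) (a ^ D S) (X F) ⟩
        weigh F (λ _ → 1) (λ _ → a * a) * (a ^ D S * a ^ (2 * ∣ F ∣) * X F)
          ≡⟨ cong (λ k → weigh F (λ _ → 1) (λ _ → a * a) * (k * X F)) (^-distribˡ-+-* a (D S) (2 * ∣ F ∣)) ⟨
        weigh F (λ _ → 1) (λ _ → a * a) * (a ^ (D S + 2 * ∣ F ∣) * X F)
          ≤⟨ *-monoʳ-≤ (weigh F (λ _ → 1) (λ _ → a * a)) (tangled-boundary-bound F) ⟩
        weigh F (λ _ → 1) (λ _ → a * a) * (4 ^ (K * m S) * all-count) ∎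
        where
        lem₂ : ∀ w u p x → w * u * p * x ≡ w * (p * u * x)
        lem₂ = solve-∀

  -- This is where the numbers of vertices of degree 1 and 2 enter: the product of the factors 1 +
  -- L/a^(d i) is bounded separately over degree 1, degree 2 and degree at least 3, each part
  -- contributing 4^m.
  degree-product-bound : ∀ a L m → 1 ≤ a → n₁ * L ≤ m * a → n₂ * L ≤ m * (a * a) → n * L ≤ m * (a * a * a) →
    ∏ (λ i → a ^ d i + L) ≤ 4 ^ (3 * m) * ∏ (λ i → a ^ d i)
  degree-product-bound a L m 1≤a h₁ h₂ h₃ = cancel-≤ Z Z-pos (begin
    Z * ∏ (λ i → a ^ d i + L)
      ≡⟨ cong (_* ∏ (λ i → a ^ d i + L)) (powers a (a * a) (a * a * a)) ⟩
    ∏ (f a (a * a) (a * a * a)) * ∏ (λ i → a ^ d i + L)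
      ≡⟨ ∏-* (f a (a * a) (a * a * a)) (λ i → a ^ d i + L) ⟨
    ∏ (λ i → f a (a * a) (a * a * a) i * (a ^ d i + L))
      ≤⟨ ∏-mono (λ i → point (d i) (d≥1 i)) ⟩
    ∏ (λ i → f (a + L) (a * a + L) (a * a * a + L) i * a ^ d i)
      ≡⟨ ∏-* (f (a + L) (a * a + L) (a * a * a + L)) (λ i → a ^ d i) ⟩
    ∏ (f (a + L) (a * a + L) (a * a * a + L)) * A
      ≡⟨ cong (_* A) (powers (a + L) (a * a + L) (a * a * a + L)) ⟨
    (a + L) ^ n₁ * ((a * a + L) ^ n₂ * (a * a * a + L) ^ n₃) * A
      ≤⟨ *-monoˡ-≤ A (*-mono-≤ (exp-bound a L n₁ m 1≤a h₁) (*-mono-≤ (exp-bound (a * a) L n₂ m 1≤a² h₂) (exp-bound (a * a * a) L n₃ m 1≤a³ (≤-trans (*-monoˡ-≤ L n₃≤n) h₃)))) ⟩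
    4 ^ m * a ^ n₁ * (4 ^ m * (a * a) ^ n₂ * (4 ^ m * (a * a * a) ^ n₃)) * A
      ≡⟨ lem (4 ^ m) (a ^ n₁) ((a * a) ^ n₂) ((a * a * a) ^ n₃) A ⟩
    Z * (4 ^ m * (4 ^ m * (4 ^ m * 1)) * A)
      ≡⟨ cong (λ k → Z * (k * A)) (trans (^-*-assoc 4 m 3) (cong (4 ^_) (*-comm m 3))) ⟩
    Z * (4 ^ (3 * m) * A) ∎)
    where
    open ≤-Reasoning
    A : ℕ
    A = ∏ (λ i → a ^ d i)
    n₃ : ℕ
    n₃ = ∑F (λ i → ⟦ 3 ≤? d i ⟧)
    n₃≤n : n₃ ≤ n
    n₃≤n = ≤-trans (∑-mono (allFin n) (λ i → ⟦⟧≤1 (3 ≤? d i))) (≤-reflexive (trans (∑F-const {n} 1) (*-identityʳ n)))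
    1≤a² : 1 ≤ a * a
    1≤a² = *-mono-≤ {1} 1≤a 1≤a
    1≤a³ : 1 ≤ a * a * a
    1≤a³ = *-mono-≤ {1} 1≤a² 1≤a
    Z : ℕ
    Z = a ^ n₁ * ((a * a) ^ n₂ * (a * a * a) ^ n₃)
    Z-pos : 1 ≤ Z
    Z-pos = *-mono-≤ {1} (^-pos n₁ 1≤a) (*-mono-≤ {1} (^-pos n₂ 1≤a²) (^-pos n₃ 1≤a³))
    g : ℕ → ℕ → ℕ → ℕ → ℕ
    g p q r k = p ^ ⟦ k ℕ.≟ 1 ⟧ * (q ^ ⟦ k ℕ.≟ 2 ⟧ * r ^ ⟦ 3 ≤? k ⟧)
    f : ℕ → ℕ → ℕ → Fin n → ℕ
    f p q r i = g p q r (d i)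
    powers : ∀ p q r → p ^ n₁ * (q ^ n₂ * r ^ n₃) ≡ ∏ (f p q r)
    powers p q r = trans (cong₂ _*_ (^-∑ p (λ i → ⟦ d i ℕ.≟ 1 ⟧)) (trans (cong₂ _*_ (^-∑ q (λ i → ⟦ d i ℕ.≟ 2 ⟧)) (^-∑ r (λ i → ⟦ 3 ≤? d i ⟧)))
      (sym (∏-* (λ i → q ^ ⟦ d i ℕ.≟ 2 ⟧) (λ i → r ^ ⟦ 3 ≤? d i ⟧)))))
      (sym (∏-* (λ i → p ^ ⟦ d i ℕ.≟ 1 ⟧) (λ i → q ^ ⟦ d i ℕ.≟ 2 ⟧ * r ^ ⟦ 3 ≤? d i ⟧)))
    lem : ∀ x p q r A → x * p * (x * q * (x * r)) * A ≡ p * (q * r) * (x * (x * (x * 1)) * A)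
    lem = solve-∀
    point : ∀ k → 1 ≤ k → g a (a * a) (a * a * a) k * (a ^ k + L) ≤ g (a + L) (a * a + L) (a * a * a + L) k * a ^ k
    point 1 _ = ≤-reflexive (eq a L)
      where
      eq : ∀ a L → a * 1 * (1 * 1) * (a * 1 + L) ≡ (a + L) * 1 * (1 * 1) * (a * 1)
      eq = solve-∀
    point 2 _ = ≤-reflexive (eq a L)
      where
      eq : ∀ a L → 1 * (a * a * 1 * 1) * (a * (a * 1) + L) ≡ 1 * ((a * a + L) * 1 * 1) * (a * (a * 1))
      eq = solve-∀
    point (suc (suc (suc k))) _ = begin
      1 * (1 * (a * a * a * 1)) * (P + L)   ≡⟨ eq₁ (a * a * a) P L ⟩
      -- For degree at least 3, L/a^k is at most L/a³.
      a * a * a * P + a * a * a * L         ≤⟨ +-monoʳ-≤ (a * a * a * P) (*-monoˡ-≤ L (≤-trans (≤-reflexive (eq₃ a)) (^-mono {k = 3} {l = 3 + k} 1≤a (m≤m+n 3 k)))) ⟩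
      a * a * a * P + P * L                 ≡⟨ eq₂ (a * a * a) P L ⟩
      1 * (1 * ((a * a * a + L) * 1)) * P   ∎
      where
      P : ℕ
      P = a ^ (3 + k)
      eq₁ : ∀ c P L → 1 * (1 * (c * 1)) * (P + L) ≡ c * P + c * L
      eq₁ = solve-∀
      eq₂ : ∀ c P L → c * P + P * L ≡ 1 * (1 * ((c + L) * 1)) * P
      eq₂ = solve-∀
      eq₃ : ∀ a → a * a * a ≡ a * (a * (a * 1))
      eq₃ = solve-∀

  tangledOfSize : ℕ → ℕ
  tangledOfSize k = ∑ (allVecs n) (λ S → ⟦ ∣ S ∣ ℕ.≟ k ⟧ * ∑𝒢 d (λ G → ⟦ tangled? S G ⟧))

  -- Weighting `S` by L^|S| turns the sum of a^(-D) over sets of size k into a part of the product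
  -- of the factors 1 + L/a^(d i). Each vertex of `S` thus gains a factor L against a loss of 4^(C +
  -- K + 3).
  tangledOfSize-bound : ∀ k β a C L → 1 ≤ a → 1 ≤ β → β + slack + (k + k * Δ) ≤ n → k * (a * a) ≤ β → n ≤ C * (k * (a * a)) →
    n₁ * L ≤ k * a → n₂ * L ≤ k * (a * a) → n * L ≤ k * (a * a * a) →
    L ^ k * tangledOfSize k ≤ 4 ^ ((C + K + 3) * k) * all-count
  tangledOfSize-bound k β a C L 1≤a 1≤β β≤ kaa≤β n≤ h₁ h₂ h₃ = cancel-≤ A A-pos (begin
    A * (L ^ k * tangledOfSize k)
      ≡⟨ trans (sym (*-assoc A (L ^ k) (tangledOfSize k))) (sym (∑-*ˡ (allVecs n) (A * L ^ k) _)) ⟩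
    ∑ (allVecs n) (λ S → A * L ^ k * (⟦ ∣ S ∣ ℕ.≟ k ⟧ * X S))
      ≤⟨ ∑-mono (allVecs n) step ⟩
    ∑ (allVecs n) (λ S → weigh S (λ _ → L) (λ i → a ^ d i) * E)
      ≡⟨ ∑-*ʳ (allVecs n) E (λ S → weigh S (λ _ → L) (λ i → a ^ d i)) ⟩
    ∑ (allVecs n) (λ S → weigh S (λ _ → L) (λ i → a ^ d i)) * E
      ≡⟨ cong (_* E) (trans (∑-subsets (λ _ → L) (λ i → a ^ d i)) (∏-cong (λ i → +-comm L (a ^ d i)))) ⟩
    ∏ (λ i → a ^ d i + L) * E
      ≤⟨ *-monoˡ-≤ E (degree-product-bound a L k 1≤a h₁ h₂ h₃) ⟩
    4 ^ (3 * k) * A * E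
      ≡⟨ trans (lem (4 ^ (3 * k)) A (4 ^ ((C + K) * k)) all-count) (cong (λ e → A * (e * all-count)) (trans (sym (^-distribˡ-+-* 4 ((C + K) * k) (3 * k))) (cong (4 ^_) (sym (*-distribʳ-+ k (C + K) 3))))) ⟩
    A * (4 ^ ((C + K + 3) * k) * all-count) ∎)
    where
    open ≤-Reasoning
    A E : ℕ
    A = ∏ (λ i → a ^ d i)
    E = 4 ^ ((C + K) * k) * all-count
    A-pos : 1 ≤ A
    A-pos = ∏-pos (λ i → a ^ d i) (λ i → ^-pos (d i) 1≤a)
    X : Vec Bool n → ℕ
    X S = ∑𝒢 d (λ G → ⟦ tangled? S G ⟧)
    lem : ∀ x A e t → x * A * (e * t) ≡ A * (e * x * t)
    lem = solve-∀
    step : ∀ S → A * L ^ k * (⟦ ∣ S ∣ ℕ.≟ k ⟧ * X S) ≤ weigh S (λ _ → L) (λ i → a ^ d i) * E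
    step S = ≤-trans (≤-reflexive (lem₁ (A * L ^ k) ⟦ ∣ S ∣ ℕ.≟ k ⟧ (X S))) (⟦⟧*≤ (∣ S ∣ ℕ.≟ k) by)
      where
      lem₁ : ∀ a b c → a * (b * c) ≡ b * (a * c)
      lem₁ = solve-∀
      by : ∣ S ∣ ≡ k → A * L ^ k * X S ≤ weigh S (λ _ → L) (λ i → a ^ d i) * E
      by refl = begin
        A * L ^ ∣ S ∣ * X S
          ≡⟨ cong (_* X S) split ⟩
        weigh S (λ _ → L) (λ i → a ^ d i) * a ^ D S * X S
          ≡⟨ *-assoc (weigh S (λ _ → L) (λ i → a ^ d i)) (a ^ D S) (X S) ⟩
        weigh S (λ _ → L) (λ i → a ^ d i) * (a ^ D S * X S)
          ≤⟨ *-monoʳ-≤ (weigh S (λ _ → L) (λ i → a ^ d i)) (tangled-bound S β a 1≤a 1≤β β≤ kaa≤β C n≤) ⟩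
        weigh S (λ _ → L) (λ i → a ^ d i) * E ∎
        where
        L^ : L ^ ∣ S ∣ ≡ weigh S (λ _ → L ^ 1) (λ _ → 1)
        L^ = trans (cong (L ^_) (∑-cong (allFin n) (λ i → sym (*-identityʳ (𝕀 (lookup S i)))))) (^-size S L (λ _ → 1))
        same : ∀ b i → (if b then a ^ d i * L ^ 1 else a ^ d i * 1) ≡ (if b then L * a ^ d i else a ^ d i * 1)
        same true i = trans (cong (a ^ d i *_) (*-identityʳ L)) (*-comm (a ^ d i) L)
        same false i = refl
        split : A * L ^ ∣ S ∣ ≡ weigh S (λ _ → L) (λ i → a ^ d i) * a ^ D S
        split = trans (cong₂ _*_ (sym (weigh-same S (λ i → a ^ d i))) L^)
          (trans (weigh-* S (λ i → a ^ d i) (λ i → a ^ d i) (λ _ → L ^ 1) (λ _ → 1))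
            (trans (∏-cong (λ i → same (lookup S i) i))
              (trans (sym (weigh-* S (λ _ → L) (λ i → a ^ d i) (λ i → a ^ d i) (λ _ → 1)))
                (cong (weigh S (λ _ → L) (λ i → a ^ d i) *_) (sym (^-size S a d))))))

n≤2⌊n/2⌋+1 : ∀ n → n ≤ 2 * ℕ.⌊ n /2⌋ + 1
n≤2⌊n/2⌋+1 n = begin
  n                              ≡⟨ ⌊n/2⌋+⌈n/2⌉≡n n ⟨
  ℕ.⌊ n /2⌋ + ℕ.⌈ n /2⌉           ≤⟨ +-monoʳ-≤ ℕ.⌊ n /2⌋ (ceil n) ⟩
  ℕ.⌊ n /2⌋ + (ℕ.⌊ n /2⌋ + 1)     ≡⟨ lem ℕ.⌊ n /2⌋ ⟩
  2 * ℕ.⌊ n /2⌋ + 1              ∎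
  where
  open ≤-Reasoning
  lem : ∀ a → a + (a + 1) ≡ 2 * a + 1
  lem = solve-∀
  ceil : ∀ n → ℕ.⌈ n /2⌉ ≤ ℕ.⌊ n /2⌋ + 1
  ceil 0 = z≤n
  ceil 1 = ≤-refl
  ceil (suc (suc n)) = s≤s (ceil n)

2⌊n/2⌋≤n : ∀ n → 2 * ℕ.⌊ n /2⌋ ≤ n
2⌊n/2⌋≤n n = ≤-trans (+-monoʳ-≤ ℕ.⌊ n /2⌋ (≤-trans (≤-reflexive (+-identityʳ _)) (⌊n/2⌋≤⌈n/2⌉ n))) (≤-reflexive (⌊n/2⌋+⌈n/2⌉≡n n))

-- Abstract, since comparing terms that contain powers of 4 must not unfold them.
module SmallParameters (Δ E : ℕ) where
  abstract
    -- `growth` is the exponent C + K + 3 of `tangledOfSize-bound` with C = 12; `scale` is its L,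
    -- chosen to leave a gain of 2E per vertex. A size k with `k * cutoff ≤ n` satisfies 3k(12L)² ≤
    -- n and 4k(1 + Δ) ≤ n.
    growth scale cutoff : ℕ
    growth = 12 + (1 + Δ) * (Δ * Δ) + 3
    scale = 4 ^ growth * (2 * E)
    cutoff = 3 * (12 * scale * (12 * scale)) + 4 * (1 + Δ)

    growth≡ : growth ≡ 12 + (1 + Δ) * (Δ * Δ) + 3
    growth≡ = refl

    scale≡ : scale ≡ 4 ^ growth * (2 * E)
    scale≡ = refl

    cutoff≡ : cutoff ≡ 3 * (12 * scale * (12 * scale)) + 4 * (1 + Δ)
    cutoff≡ = refl

module SmallSupportRare {n : ℕ} (d : Fin n → ℕ) (Δ : ℕ) (d≥1 : ∀ i → 1 ≤ d i) (d≤Δ : ∀ i → d i ≤ Δ) (E : ℕ) (1≤E : 1 ≤ E) where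
  open BoundedDegree d Δ d≤Δ
  open LightVertices d Δ d≤Δ
  open SmallSupport d Δ d≥1 d≤Δ
  open SmallSupportCount d Δ d≥1 d≤Δ
  open SmallParameters Δ E

  private
    L : ℕ
    L = scale
    1≤L : 1 ≤ L
    1≤L = subst (1 ≤_) (sym scale≡) (*-mono-≤ {1} (^-pos {4} growth (s≤s z≤n)) (*-mono-≤ {1} {2} (s≤s z≤n) 1≤E))

  module _ (n₁-few : 4 * L * n₁ * (4 * L * n₁) ≤ n) (n₂-few : 12 * L * n₂ ≤ n) (n-large : 4 * slack ≤ n) where

    -- Take β to be n/2 rounded down and `a` the largest number with k a² ≤ β, so that n ≤ 12 k a².
    -- The condition on n₁ follows from 16 L² n₁² ≤ n ≤ 16 k² a² by taking roots, the one on n₂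
    -- directly, and the one on n from a ≥ 12L, which the cutoff provides.
    tangledOfSize-rare : ∀ k → 1 ≤ k → k * cutoff ≤ n → (2 * E) ^ k * tangledOfSize k ≤ all-count
    tangledOfSize-rare k 1≤k k-fits = cancel-≤ ((4 ^ growth) ^ k) (^-pos k (^-pos {4} growth (s≤s z≤n))) (begin
      (4 ^ growth) ^ k * ((2 * E) ^ k * tangledOfSize k)
        ≡⟨ trans (sym (*-assoc ((4 ^ growth) ^ k) ((2 * E) ^ k) (tangledOfSize k))) (cong (_* tangledOfSize k) (trans (sym (^-distribʳ-* (4 ^ growth) (2 * E) k)) (cong (_^ k) (sym scale≡)))) ⟩
      L ^ k * tangledOfSize k
        ≤⟨ tangledOfSize-bound k β a 12 L 1≤a 1≤β β≤ (proj₁ (proj₂ best)) n≤12 n₁L≤ n₂L≤ nL≤ ⟩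
      4 ^ ((12 + K + 3) * k) * all-count
        ≡⟨ cong (λ e → 4 ^ (e * k) * all-count) growth≡ ⟨
      4 ^ (growth * k) * all-count
        ≡⟨ cong (_* all-count) (sym (^-*-assoc 4 growth k)) ⟩
      (4 ^ growth) ^ k * all-count ∎)
      where
      open ≤-Reasoning
      kz≤n : k * (3 * (12 * L * (12 * L)) + 4 * (1 + Δ)) ≤ n
      kz≤n = subst (λ z → k * z ≤ n) cutoff≡ k-fits
      β : ℕ
      β = ℕ.⌊ n /2⌋
      4≤n : 4 ≤ n
      4≤n = ≤-trans (*-mono-≤ {1} 1≤k (≤-trans (*-monoʳ-≤ 4 {1} (s≤s z≤n)) (m≤n+m (4 * (1 + Δ)) (3 * (12 * L * (12 * L)))))) kz≤n
      1≤β : 1 ≤ β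
      1≤β = ≤-trans (n≤1+n 1) (⌊n/2⌋-mono 4≤n)
      n≤3β : n ≤ 3 * β
      n≤3β = ≤-trans (n≤2⌊n/2⌋+1 n) (≤-trans (+-monoʳ-≤ (2 * β) 1≤β) (≤-reflexive (lem β)))
        where
        lem : ∀ b → 2 * b + b ≡ 3 * b
        lem = solve-∀
      k4≤n : 4 * (k + k * Δ) ≤ n
      k4≤n = ≤-trans (≤-reflexive (lem k Δ)) (≤-trans (*-monoʳ-≤ k (m≤n+m (4 * (1 + Δ)) (3 * (12 * L * (12 * L))))) kz≤n)
        where
        lem : ∀ k D → 4 * (k + k * D) ≡ k * (4 * (1 + D))
        lem = solve-∀
      β≤ : β + slack + (k + k * Δ) ≤ n
      β≤ = cancel-≤ 4 (s≤s z≤n) (begin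
        4 * (β + slack + (k + k * Δ))
          ≡⟨ lem₁ β slack (k + k * Δ) ⟩
        2 * (2 * β) + 4 * slack + 4 * (k + k * Δ)
          ≤⟨ +-mono-≤ (+-mono-≤ (*-monoʳ-≤ 2 (2⌊n/2⌋≤n n)) n-large) k4≤n ⟩
        2 * n + n + n
          ≡⟨ lem₂ n ⟩
        4 * n ∎)
        where
        lem₁ : ∀ b s k → 4 * (b + s + k) ≡ 2 * (2 * b) + 4 * s + 4 * k
        lem₁ = solve-∀
        lem₂ : ∀ n → 2 * n + n + n ≡ 4 * n
        lem₂ = solve-∀
      b₀ : ℕ
      b₀ = 12 * L
      kb₀≤β : k * (b₀ * b₀) ≤ β
      kb₀≤β = cancel-≤ 3 (s≤s z≤n) (≤-trans (≤-reflexive (lem k (b₀ * b₀))) (≤-trans (*-monoʳ-≤ k (m≤m+n (3 * (b₀ * b₀)) (4 * (1 + Δ)))) (≤-trans kz≤n n≤3β)))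
        where
        lem : ∀ k b → 3 * (k * b) ≡ k * (3 * b)
        lem = solve-∀
      best : ∃ λ a → (k * (a * a) ≤ β) × ¬ (k * (suc a * suc a) ≤ β)
      best = greatest (λ a → k * (a * a) ≤? β) (subst (_≤ β) (sym (*-zeroʳ k)) z≤n) (suc β)
        (λ h → <⇒≱ (≤-trans (m≤m+n (suc β) _) (*-mono-≤ {1} 1≤k (m≤m+n (suc β) (β * suc β)))) h)
      a : ℕ
      a = proj₁ best
      β<4kaa : 1 ≤ a → β ≤ 4 * (k * (a * a))
      β<4kaa 1≤a = ≤-trans (<⇒≤ (≰⇒> (proj₂ (proj₂ best)))) (≤-trans (*-monoʳ-≤ k (*-mono-≤ sa≤2a sa≤2a)) (≤-reflexive (lem k a)))
        where
        sa≤2a : suc a ≤ a + a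
        sa≤2a = +-monoˡ-≤ a 1≤a
        lem : ∀ k a → k * ((a + a) * (a + a)) ≡ 4 * (k * (a * a))
        lem = solve-∀
      b₀≤a : b₀ ≤ a
      b₀≤a = ≮⇒≥ λ a<b₀ → proj₂ (proj₂ best) (≤-trans (*-monoʳ-≤ k (*-mono-≤ a<b₀ a<b₀)) kb₀≤β)
      1≤a : 1 ≤ a
      1≤a = ≤-trans (*-mono-≤ {1} {12} (s≤s z≤n) 1≤L) b₀≤a
      -- The constant is 3 · 4: rounding down in β costs 3, and (a + 1)² ≤ 4a² costs 4.
      n≤12 : n ≤ 12 * (k * (a * a))
      n≤12 = ≤-trans n≤3β (≤-trans (*-monoʳ-≤ 3 (β<4kaa 1≤a)) (≤-reflexive (sym (*-assoc 3 4 (k * (a * a))))))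
      n₁L≤ : n₁ * L ≤ k * a
      n₁L≤ = cancel-≤ 4 (s≤s z≤n) (square-cancel-≤ (begin
        4 * (n₁ * L) * (4 * (n₁ * L))    ≡⟨ lem₁ n₁ L ⟩
        4 * L * n₁ * (4 * L * n₁)        ≤⟨ n₁-few ⟩
        n                                ≤⟨ n≤12 ⟩
        12 * (k * (a * a))               ≤⟨ *-mono-≤ {12} {16} (m≤m+n 12 4) (≤-trans (≤-reflexive (sym (*-identityˡ _))) (*-monoˡ-≤ (k * (a * a)) 1≤k)) ⟩
        16 * (k * (k * (a * a)))         ≡⟨ lem₂ k a ⟩
        4 * (k * a) * (4 * (k * a))      ∎))
        where
        lem₁ : ∀ n L → 4 * (n * L) * (4 * (n * L)) ≡ 4 * L * n * (4 * L * n)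
        lem₁ = solve-∀
        lem₂ : ∀ k a → 16 * (k * (k * (a * a))) ≡ 4 * (k * a) * (4 * (k * a))
        lem₂ = solve-∀
      n₂L≤ : n₂ * L ≤ k * (a * a)
      n₂L≤ = cancel-≤ 12 (s≤s z≤n) (≤-trans (≤-reflexive (lem n₂ L)) (≤-trans n₂-few n≤12))
        where
        lem : ∀ n L → 12 * (n * L) ≡ 12 * L * n
        lem = solve-∀
      nL≤ : n * L ≤ k * (a * a * a)
      nL≤ = begin
        n * L                        ≤⟨ *-monoˡ-≤ L n≤12 ⟩
        12 * (k * (a * a)) * L       ≡⟨ lem₁ k (a * a) L ⟩
        k * (a * a) * (12 * L)       ≤⟨ *-monoʳ-≤ (k * (a * a)) b₀≤a ⟩
        k * (a * a) * a              ≡⟨ *-assoc k (a * a) a ⟩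
        k * (a * a * a)              ∎
        where
        lem₁ : ∀ k a L → 12 * (k * a) * L ≡ k * a * (12 * L)
        lem₁ = solve-∀

    small? : (S : Vec Bool n) → Dec (1 ≤ ∣ S ∣ × ∣ S ∣ * cutoff ≤ n)
    small? S = (1 ≤? ∣ S ∣) ×-dec (∣ S ∣ * cutoff ≤? n)

    small-tangled-rare : E * ∑𝒢 d (λ G → ∑ (allVecs n) (λ S → ⟦ small? S ⟧ * ⟦ tangled? S G ⟧)) ≤ all-count
    small-tangled-rare = begin
      E * ∑𝒢 d (λ G → ∑ (allVecs n) (λ S → ⟦ small? S ⟧ * ⟦ tangled? S G ⟧))
        ≡⟨ cong (E *_) (trans (∑𝒢-swap d (allVecs n) (λ G S → ⟦ small? S ⟧ * ⟦ tangled? S G ⟧)) (∑-cong (allVecs n) (λ S → ∑𝒢-* d ⟦ small? S ⟧ (λ G → ⟦ tangled? S G ⟧)))) ⟩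
      E * ∑ (allVecs n) (λ S → ⟦ small? S ⟧ * X S)
        ≤⟨ *-monoʳ-≤ E (∑-mono (allVecs n) by-size) ⟩
      E * ∑ (allVecs n) (λ S → ∑F (λ k → fits k * (⟦ ∣ S ∣ ℕ.≟ suc (toℕ k) ⟧ * X S)))
        ≡⟨ cong (E *_) (∑-swap (allVecs n) (allFin n) (λ S k → fits k * (⟦ ∣ S ∣ ℕ.≟ suc (toℕ k) ⟧ * X S))) ⟩
      E * ∑F (λ k → ∑ (allVecs n) (λ S → fits k * (⟦ ∣ S ∣ ℕ.≟ suc (toℕ k) ⟧ * X S)))
        ≡⟨ trans (sym (∑-*ˡ (allFin n) E _)) (∑-cong (allFin n) (λ k → cong (E *_) (∑-*ˡ (allVecs n) (fits k) (λ S → ⟦ ∣ S ∣ ℕ.≟ suc (toℕ k) ⟧ * X S)))) ⟩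
      ∑F {n} (λ k → y (toℕ k))
        ≤⟨ geometric n y all-count y≤ ⟩
      all-count ∎
      where
      open ≤-Reasoning
      X : Vec Bool n → ℕ
      X S = ∑𝒢 d (λ G → ⟦ tangled? S G ⟧)
      fits : Fin n → ℕ
      fits k = ⟦ suc (toℕ k) * cutoff ≤? n ⟧
      y : ℕ → ℕ
      y k = E * (⟦ suc k * cutoff ≤? n ⟧ * tangledOfSize (suc k))
      -- Of the gain (2E)^k, one factor E is kept for the final bound, and 2^k makes the sum over
      -- the sizes geometric.
      y≤ : ∀ k → y k * 2 ^ suc k ≤ all-count
      y≤ k = ≤-trans (≤-reflexive (lem E ⟦ suc k * cutoff ≤? n ⟧ (tangledOfSize (suc k)) (2 ^ suc k))) (⟦⟧*≤ (suc k * cutoff ≤? n) λ le → begin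
        2 ^ suc k * E * tangledOfSize (suc k)
          ≤⟨ *-monoˡ-≤ (tangledOfSize (suc k)) (*-monoʳ-≤ (2 ^ suc k) (≤-trans (≤-reflexive (sym (*-identityʳ E))) (^-mono {k = 1} 1≤E (s≤s {0} {k} z≤n)))) ⟩
        2 ^ suc k * E ^ suc k * tangledOfSize (suc k)
          ≡⟨ cong (_* tangledOfSize (suc k)) (^-distribʳ-* 2 E (suc k)) ⟨
        (2 * E) ^ suc k * tangledOfSize (suc k)
          ≤⟨ tangledOfSize-rare (suc k) (s≤s z≤n) le ⟩
        all-count ∎)
        where
        lem : ∀ E i x p → E * (i * x) * p ≡ i * (p * E * x)
        lem = solve-∀
      by-size : ∀ S → ⟦ small? S ⟧ * X S ≤ ∑F (λ k → fits k * (⟦ ∣ S ∣ ℕ.≟ suc (toℕ k) ⟧ * X S))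
      by-size S = ⟦⟧*≤ (small? S) λ (1≤ , fit) → go ∣ S ∣ refl 1≤ fit (∣S∣≤n S)
        where
        go : ∀ j → ∣ S ∣ ≡ j → 1 ≤ j → j * cutoff ≤ n → j ≤ n → X S ≤ ∑F (λ k → fits k * (⟦ ∣ S ∣ ℕ.≟ suc (toℕ k) ⟧ * X S))
        go (suc j) eq _ fit j<n = ≤-trans (≤-reflexive (sym one))
          (term≤∑ (finE n) (λ k → fits k * (⟦ ∣ S ∣ ℕ.≟ suc (toℕ k) ⟧ * X S)) (fromℕ< j<n))
          where
          k≡ : toℕ (fromℕ< j<n) ≡ j
          k≡ = toℕ-fromℕ< j<n
          one : fits (fromℕ< j<n) * (⟦ ∣ S ∣ ℕ.≟ suc (toℕ (fromℕ< j<n)) ⟧ * X S) ≡ X S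
          one = trans (cong₂ (λ a b → a * (b * X S)) (⟦⟧-yes (suc (toℕ (fromℕ< j<n)) * cutoff ≤? n) (subst (λ k → suc k * cutoff ≤ n) (sym k≡) fit)) (⟦⟧-yes (∣ S ∣ ℕ.≟ suc (toℕ (fromℕ< j<n))) (trans eq (cong suc (sym k≡)))))
            (trans (*-identityˡ _) (*-identityˡ (X S)))

-- Orbits

iter : {X : Set} → (X → X) → ℕ → X → X
iter F zero x = x
iter F (suc k) x = F (iter F k x)

module _ {X : Set} (F : X → X) where

  iter-+ : ∀ j k x → iter F (j + k) x ≡ iter F j (iter F k x)
  iter-+ zero k x = refl
  iter-+ (suc j) k x = cong F (iter-+ j k x)

  iter-multiple : ∀ {p x} → iter F p x ≡ x → ∀ k → iter F (k * p) x ≡ x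
  iter-multiple e zero = refl
  iter-multiple {p} {x} e (suc k) = trans (iter-+ p (k * p) x) (trans (cong (iter F p) (iter-multiple e k)) e)

  iter-% : ∀ {p x} .{{_ : NonZero p}} → iter F p x ≡ x → ∀ k → iter F k x ≡ iter F (k % p) x
  iter-% {p} {x} e k = trans (cong (λ m → iter F m x) (m≡m%n+[m/n]*n k p))
    (trans (iter-+ (k % p) (k / p * p) x) (cong (iter F (k % p)) (iter-multiple e (k / p))))

least-witness : {P : ℕ → Set} (P? : ∀ k → Dec (P k)) → ∀ N → P N → ∃ λ l → P l × (∀ k → k < l → ¬ P k)
least-witness {P} P? N p = go N (ℕInd.<-wellFounded N) p
  where
  go : ∀ N → Acc _<_ N → P N → ∃ λ l → P l × (∀ k → k < l → ¬ P k)
  go N (acc rs) p with any? {n = N} (λ i → P? (toℕ i))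
  ... | yes (i , q) = go (toℕ i) (rs (toℕ<n i)) q
  ... | no none = N , p , λ k k<N q → none (fromℕ< k<N , subst P (sym (toℕ-fromℕ< k<N)) q)

-- Used for vertices and for half-edges under the same automorphism. The period `P` makes orbits
-- finite searches and lets powers be inverted; the key singles out one representative of each
-- orbit.
module Orbits {X : Set} (F : X → X) (P : ℕ) (1≤P : 1 ≤ P) (periodic : ∀ x → iter F P x ≡ x)
              (key : X → ℕ) (key-injective : ∀ {x y} → key x ≡ key y → x ≡ y) where

  Least : X → Set
  Least x = ∀ i → key x ≤ key (iter F i x)

  least⊎ : ∀ x → Least x ⊎ (∃ λ i → key (iter F i x) < key x)
  least⊎ x with any? {n = P} (λ i → key (iter F (toℕ i) x) <? key x)
  ... | yes (i , lt) = inj₂ (toℕ i , lt)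
  ... | no none = inj₁ λ i → ≮⇒≥ λ lt → none (fromℕ< (m%n<n i P) ,
        subst (λ y → key y < key x) (trans (iter-% F (periodic x) i) (cong (λ k → iter F k x) (sym (toℕ-fromℕ< (m%n<n i P))))) lt)
    where instance _ = >-nonZero 1≤P

  least? : ∀ x → Dec (Least x)
  least? x with least⊎ x
  ... | inj₁ l = yes l
  ... | inj₂ (i , lt) = no λ l → <⇒≱ lt (l i)

  back : ∀ i x → ∃ λ j → iter F j (iter F i x) ≡ x
  back i x = i * P ∸ i , trans (sym (iter-+ F (i * P ∸ i) i x))
    (trans (cong (λ k → iter F k x) (m∸n+n≡m (m≤m*n i P {{>-nonZero 1≤P}}))) (iter-multiple F (periodic x) i))

  least-exists : ∀ x → ∃ λ i → Least (iter F i x)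
  least-exists x = go x (ℕInd.<-wellFounded (key x))
    where
    go : ∀ x → Acc _<_ (key x) → ∃ λ i → Least (iter F i x)
    go x (acc rs) with least⊎ x
    ... | inj₁ l = 0 , l
    ... | inj₂ (i , lt) = let (j , l) = go (iter F i x) (rs lt) in j + i , subst Least (sym (iter-+ F j i x)) l

  least-orbit : ∀ {x} → Least x → ∀ i j → key x ≤ key (iter F j (iter F i x))
  least-orbit {x} l i j = subst (λ y → key x ≤ key y) (iter-+ F j i x) (l (j + i))

  least-unique : ∀ {x} i → Least x → Least (iter F i x) → iter F i x ≡ x
  least-unique {x} i l l′ = let (j , e) = back i x in
    key-injective (≤-antisym (≤-trans (l′ j) (≤-reflexive (cong key e))) (l i))

  any-power? : (Q : X → Set) → (∀ x → Dec (Q x)) → ∀ x → Dec (∃ λ i → Q (iter F i x))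
  any-power? Q Q? x = map′ (λ (i , q) → toℕ i , q)
    (λ (i , q) → fromℕ< (m%n<n i P) , subst Q (trans (iter-% F (periodic x) i) (cong (λ k → iter F k x) (sym (toℕ-fromℕ< (m%n<n i P))))) q)
    (any? {n = P} (λ i → Q? (iter F (toℕ i) x)))
    where instance _ = >-nonZero 1≤P

  all-powers? : (Q : X → Set) → (∀ x → Dec (Q x)) → ∀ x → Dec (∀ i → Q (iter F i x))
  all-powers? Q Q? x with any-power? (λ y → ¬ Q y) (λ y → ¬? (Q? y)) x
  ... | yes (i , ¬q) = no λ h → ¬q (h i)
  ... | no none = yes λ i → [ id , (λ ¬q → contradiction (i , ¬q) none) ]′ (dec⊎ (Q? (iter F i x)))
    where
    dec⊎ : {P : Set} → Dec P → P ⊎ ¬ P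
    dec⊎ (yes p) = inj₁ p
    dec⊎ (no ¬p) = inj₂ ¬p

module _ {n : ℕ} (f g : Fin n → Fin n) (gf : ∀ i → g (f i) ≡ i) where

  iter-injective : ∀ k x y → iter f k x ≡ iter f k y → x ≡ y
  iter-injective zero x y e = e
  iter-injective (suc k) x y e = iter-injective k x y (trans (sym (gf (iter f k x))) (trans (cong g e) (gf (iter f k y))))

  point-period : ∀ x → ∃ λ p → 1 ≤ p × iter f p x ≡ x
  point-period x with pigeonhole (n<1+n n) (λ i → iter f (toℕ i) x)
  ... | i , j , i<j , e = toℕ j ∸ toℕ i , m<n⇒0<n∸m i<j , sym (iter-injective (toℕ i) x (iter f (toℕ j ∸ toℕ i) x)
    (trans e (trans (cong (λ k → iter f k x) (sym (m+[n∸m]≡n (<⇒≤ i<j)))) (iter-+ f (toℕ i) (toℕ j ∸ toℕ i) x))))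

  -- The product of the periods of all vertices; minimality is not asked for.
  common-period : ∃ λ P → 1 ≤ P × (∀ x → iter f P x ≡ x)
  common-period = let (P , 1≤P , h) = go (allFin n) in P , 1≤P , λ x → h (∈-allFin x)
    where
    go : ∀ xs → ∃ λ P → 1 ≤ P × (∀ {x} → x ∈ xs → iter f P x ≡ x)
    go [] = 1 , ≤-refl , λ ()
    go (y ∷ xs) with point-period y | go xs
    ... | p , 1≤p , e | P , 1≤P , h = P * p , *-mono-≤ {1} 1≤P 1≤p , both
      where
      both : ∀ {x} → x ∈ y ∷ xs → iter f (P * p) x ≡ x
      both (here refl) = iter-multiple f e P
      both {x} (there x∈) = trans (cong (λ k → iter f k x) (*-comm P p)) (iter-multiple f (h x∈) p)

  -- If f^i exchanges `x` and `y`, then 2i but not i is a multiple of the least period l of `x`. So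
  -- i is l/2 modulo l, and `y` is the point opposite to `x` on its cycle.
  antipode-unique : ∀ {x y y′} i j → iter f i x ≡ y → iter f i y ≡ x → y ≢ x → iter f j x ≡ y′ → iter f j y′ ≡ x → y′ ≢ x → y ≡ y′
  antipode-unique {x} {y} {y′} i j ei ey ny ej ey′ ny′ =
    let (p , h) = point-period x
        (l , (1≤l , lx) , none) = least-witness (λ k → (1 ≤? k) ×-dec (iter f k x ≟ x)) p h
    in core l {{>-nonZero 1≤l}} lx (λ k k<l 1≤k e → none k k<l (1≤k , e))
    where
    open ≡-Reasoning
    double-injective : ∀ a b → a + a ≡ b + b → a ≡ b
    double-injective a b e = *-cancelˡ-≡ a b 2 (trans (cong (a +_) (+-identityʳ a)) (trans e (cong (b +_) (sym (+-identityʳ b)))))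
    half : ∀ l .{{_ : NonZero l}} → iter f l x ≡ x → (∀ k → k < l → 1 ≤ k → iter f k x ≢ x) →
      ∀ i → iter f i (iter f i x) ≡ x → iter f i x ≢ x → i % l + i % l ≡ l
    half l lx none i e ne = ≤-antisym (≮⇒≥ too-big) (≮⇒≥ too-small)
      where
      r : ℕ
      r = i % l
      r<l : r < l
      r<l = m%n<n i l
      1≤r : 1 ≤ r
      1≤r = ≢0⇒≥1 λ z → ne (trans (iter-% f lx i) (cong (λ k → iter f k x) z))
      rr : iter f (r + r) x ≡ x
      rr = trans (iter-+ f r r x) (trans (cong (iter f r) (sym (iter-% f lx i)))
        (trans (sym (iter-% f {l} {iter f i x} l-at i)) e))
        where
        l-at : iter f l (iter f i x) ≡ iter f i x
        l-at = trans (sym (iter-+ f l i x)) (trans (cong (λ k → iter f k x) (+-comm l i)) (trans (iter-+ f i l x) (cong (iter f i) lx)))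
      too-small : ¬ (r + r < l)
      too-small lt = none (r + r) lt (≤-trans 1≤r (m≤m+n r r)) rr
      too-big : ¬ (l < r + r)
      too-big lt = none s s<l (m<n⇒0<n∸m lt) (iter-injective l (iter f s x) x (trans (sym (iter-+ f l s x)) (trans (cong (λ k → iter f k x) (m+[n∸m]≡n (<⇒≤ lt))) (trans rr (sym lx)))))
        where
        s : ℕ
        s = r + r ∸ l
        s<l : s < l
        s<l = +-cancelˡ-< l s l (≤-trans (≤-reflexive (cong suc (m+[n∸m]≡n (<⇒≤ lt)))) (+-mono-< r<l r<l))
    core : ∀ l .{{_ : NonZero l}} → iter f l x ≡ x → (∀ k → k < l → 1 ≤ k → iter f k x ≢ x) → y ≡ y′
    core l lx none = begin
      y                   ≡⟨ ei ⟨
      iter f i x          ≡⟨ iter-% f lx i ⟩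
      iter f (i % l) x    ≡⟨ cong (λ k → iter f k x) (double-injective (i % l) (j % l) (trans
                               (half l lx none i (trans (cong (iter f i) ei) ey) (λ e → ny (trans (sym ei) e)))
                               (sym (half l lx none j (trans (cong (iter f j) ej) ey′) (λ e → ny′ (trans (sym ej) e)))))) ⟩
      iter f (j % l) x    ≡⟨ iter-% f lx j ⟨
      iter f j x          ≡⟨ ej ⟩
      y′                  ∎

swapPair : {A : Set} → A × A → A × A
swapPair (x , y) = y , x

-- Half-edges (x , y) are represented by the least element of their orbit.  Of two mutually reversed orbits only the
-- smaller one is recorded (Chosen); in an orbit that is its own reverse, y is determined by x as its antipode.
module AutCode {n : ℕ} (G : Graph n) (f g : Fin n → Fin n) (aut : IsAut G f g) where
  open IsAut aut

  private
    common : ∃ λ P → 1 ≤ P × (∀ x → iter f P x ≡ x)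
    common = common-period f g gf
    P : ℕ
    P = proj₁ common

  F : Fin n × Fin n → Fin n × Fin n
  F (x , y) = f x , f y

  iter-F : ∀ i x y → iter F i (x , y) ≡ (iter f i x , iter f i y)
  iter-F zero x y = refl
  iter-F (suc i) x y = cong F (iter-F i x y)

  iter-swap : ∀ i p → iter F i (swapPair p) ≡ swapPair (iter F i p)
  iter-swap zero p = refl
  iter-swap (suc i) p = cong F (iter-swap i p)

  -- Lexicographic order: a half-edge that is least in its orbit starts at a vertex that is least in
  -- its own orbit.
  key : Fin n × Fin n → ℕ
  key (x , y) = toℕ (combine x y)

  key-injective : ∀ {p q} → key p ≡ key q → p ≡ q
  key-injective {x , y} {x′ , y′} e with combine-injective x y x′ y′ (toℕ-injective e)
  ... | refl , refl = refl

  module V = Orbits f P (proj₁ (proj₂ common)) (proj₂ (proj₂ common)) toℕ toℕ-injective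
  module E = Orbits F P (proj₁ (proj₂ common))
    (λ (x , y) → trans (iter-F P x y) (cong₂ _,_ (proj₂ (proj₂ common) x) (proj₂ (proj₂ common) y))) key key-injective

  Root : Fin n → Set
  Root = V.Least

  Edge : Fin n × Fin n → Set
  Edge (x , y) = Adj G x y

  -- `Backs` stores `f` by one pair for each non-root, namely its predecessor. The step that returns
  -- to the root closes the cycle and need not be stored.
  Backs Chosen : Fin n × Fin n → Set
  Backs (w , z) = ¬ Root w × f z ≡ w
  Chosen p = Edge p × E.Least p × (∀ i → key p < key (iter F i (swapPair p)))

  Antipodal : Fin n → Set
  Antipodal x = ∃ λ y → Adj G x y × E.Least (x , y) × ∃ λ i → iter F i (y , x) ≡ (x , y)

  backs? : ∀ p → Dec (Backs p)
  backs? (w , z) = ¬? (V.least? w) ×-dec (f z ≟ w)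

  chosen? : ∀ p → Dec (Chosen p)
  chosen? p = adj? G (proj₁ p) (proj₂ p) ×-dec E.least? p ×-dec E.all-powers? (λ q → key p < key q) (λ q → key p <? key q) (swapPair p)

  antipodal? : ∀ x → Dec (Antipodal x)
  antipodal? x = any? λ y → adj? G x y ×-dec E.least? (x , y) ×-dec E.any-power? (_≡ (x , y)) (λ q → ≡-dec _≟_ _≟_ q (x , y)) (y , x)

  edge-iter : ∀ i p → Edge p → Edge (iter F i p)
  edge-iter zero p e = e
  edge-iter (suc i) p e = subst T (sym (preserves _ _)) (edge-iter i p e)

  edge-uniter : ∀ i p → Edge (iter F i p) → Edge p
  edge-uniter zero p e = e
  edge-uniter (suc i) p e = edge-uniter i p (subst T (preserves _ _) e)

  least⇒root : ∀ {x y} → E.Least (x , y) → Root x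
  least⇒root {x} {y} l i = ≮⇒≥ λ lt → <⇒≱ (combine-monoˡ-< (iter f i y) y lt) (subst (λ q → key (x , y) ≤ key q) (iter-F i x y) (l i))

  partner : Fin n × Fin n → Fin n × Fin n
  partner p = iter F (proj₁ (E.least-exists (swapPair p))) (swapPair p)

  partner-least : ∀ p → E.Least (partner p)
  partner-least p = proj₂ (E.least-exists (swapPair p))

  data Kind (x y : Fin n) : Set where
    here-chosen : Chosen (x , y) → Kind x y
    self-paired : (∃ λ i → iter F i (y , x) ≡ (x , y)) → Kind x y
    there-chosen : ∀ i → Chosen (iter F i (y , x)) → Kind x y

  -- Compares the least half-edge of an orbit with the least one of the reversed orbit; equality
  -- means that the orbit is its own reverse.
  kind : ∀ x y → Adj G x y → E.Least (x , y) → Kind x y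
  kind x y xy l = go (E.least-exists (y , x))
    where
    go : (∃ λ i → E.Least (iter F i (y , x))) → Kind x y
    go (i , l′) with key (x , y) <? key (iter F i (y , x)) | key (iter F i (y , x)) <? key (x , y)
    ... | yes lt | _ = here-chosen (xy , l , λ j → <-≤-trans lt
            (let (k , e) = E.back i (y , x) in subst (λ q → key (iter F i (y , x)) ≤ key (iter F j q)) e (E.least-orbit l′ k j)))
    ... | no _ | yes gt = there-chosen i (edge-iter i (y , x) (Adj-sym G xy) , l′ , λ j → <-≤-trans gt
            (subst (λ q → key (x , y) ≤ key (iter F j q)) (iter-swap i (y , x)) (E.least-orbit l i j)))
    ... | no ¬lt | no ¬gt = self-paired (i , sym (key-injective (≤-antisym (≮⇒≥ ¬gt) (≮⇒≥ ¬lt))))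

module Decode {n : ℕ} {G₁ G₂ : Graph n} {f₁ g₁ f₂ g₂ : Fin n → Fin n} (aut₁ : IsAut G₁ f₁ g₁) (aut₂ : IsAut G₂ f₂ g₂) where
  module C₁ = AutCode G₁ f₁ g₁ aut₁
  module C₂ = AutCode G₂ f₂ g₂ aut₂

  module _ (backs : ∀ p → C₁.Backs p → C₂.Backs p) (backs′ : ∀ p → C₂.Backs p → C₁.Backs p) where

    private
      root : ∀ {x} → C₁.Root x → C₂.Root x
      root {x} r with C₂.V.least? x
      ... | yes r₂ = r₂
      ... | no ¬r = contradiction r (proj₁ (backs′ (x , g₂ x) (¬r , IsAut.fg aut₂ x)))

      -- Along a cycle that starts at its root, a non-root image is stored by one of the two maps
      -- and hence shared. If both images are roots, both cycles have closed and both images are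
      -- `t`.
      from-root : ∀ {t} → C₁.Root t → ∀ i → iter f₁ i t ≡ iter f₂ i t
      from-root r zero = refl
      from-root {t} r (suc i) = step (C₁.V.least? (f₁ y₁)) (C₂.V.least? (f₂ y₂))
        where
        y₁ y₂ : Fin n
        y₁ = iter f₁ i t
        y₂ = iter f₂ i t
        y≡ : y₁ ≡ y₂
        y≡ = from-root r i
        step : Dec (C₁.Root (f₁ y₁)) → Dec (C₂.Root (f₂ y₂)) → f₁ y₁ ≡ f₂ y₂
        step (no ¬r) _ = trans (sym (proj₂ (backs (f₁ y₁ , y₁) (¬r , refl)))) (cong f₂ y≡)
        step (yes _) (no ¬r) = trans (cong f₁ y≡) (proj₂ (backs′ (f₂ y₂ , y₂) (¬r , refl)))
        step (yes r₁) (yes r₂) = trans (C₁.V.least-unique (suc i) r r₁) (sym (C₂.V.least-unique (suc i) (root r) r₂))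

    same-map : ∀ w → f₁ w ≡ f₂ w
    same-map w =
      let (i , r) = C₁.V.least-exists w
          (j , e) = C₁.V.back i w
          t = iter f₁ i w
      in begin
      f₁ w                   ≡⟨ cong f₁ e ⟨
      f₁ (iter f₁ j t)       ≡⟨ from-root r (suc j) ⟩
      f₂ (iter f₂ j t)       ≡⟨ cong f₂ (from-root r j) ⟨
      f₂ (iter f₁ j t)       ≡⟨ cong f₂ e ⟩
      f₂ w                   ∎
      where open ≡-Reasoning

    same-iter : ∀ i p → iter C₁.F i p ≡ iter C₂.F i p
    same-iter zero p = refl
    same-iter (suc i) p = trans (cong₂ _,_ (same-map _) (same-map _)) (cong C₂.F (same-iter i p))

    module _ (chosen : ∀ p → C₁.Chosen p → C₂.Chosen p) (antipodal : ∀ x → C₁.Antipodal x → C₂.Antipodal x) where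

      -- The maps agree, so an edge may be moved to the representative of its orbit. There it is
      -- chosen itself, or its reversed orbit is chosen, or it is self-paired; in the last case the
      -- mark at `x` gives some edge to an antipode, and the antipode is unique.
      decode-edge : ∀ i j → Adj G₁ i j → Adj G₂ i j
      decode-edge i j ij = let (k , l) = C₁.E.least-exists (i , j) in
        C₂.edge-uniter k (i , j) (subst C₂.Edge (same-iter k (i , j)) (at (iter C₁.F k (i , j)) (C₁.edge-iter k (i , j) ij) l))
        where
        at : ∀ p → C₁.Edge p → C₁.E.Least p → C₂.Edge p
        at (x , y) xy l with C₁.kind x y xy l
        ... | C₁.here-chosen c = proj₁ (chosen (x , y) c)
        ... | C₁.there-chosen k c = Adj-sym G₂ (C₂.edge-uniter k (y , x) (subst C₂.Edge (same-iter k (y , x)) (proj₁ (chosen _ c))))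
        ... | C₁.self-paired (k , e) with antipodal x (y , xy , l , k , e)
        ...   | y′ , xy′ , _ , k′ , e′ = subst (Adj G₂ x) (sym y≡) xy′
          where
          e₁ : (iter f₁ k y , iter f₁ k x) ≡ (x , y)
          e₁ = trans (sym (C₁.iter-F k y x)) e
          e₂ : (iter f₁ k′ y′ , iter f₁ k′ x) ≡ (x , y′)
          e₂ = trans (sym (C₁.iter-F k′ y′ x)) (trans (same-iter k′ (y′ , x)) e′)
          y≡ : y ≡ y′
          y≡ = antipode-unique f₁ g₁ (IsAut.gf aut₁) k k′ (cong proj₂ e₁) (cong proj₁ e₁) (Adj⇒≢ G₁ xy ∘ sym)
            (cong proj₂ e₂) (cong proj₁ e₂) (Adj⇒≢ G₂ xy′ ∘ sym)

-- Products of enumerations, and sets of pairs as bit vectors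

productE : {A B : Set} → Enumeration A → Enumeration B → Enumeration (A × B)
productE {A} {B} EA EB = record { elements = List.cartesianProduct (elements EA) (elements EB) ; _≟ᴱ_ = _≟×_ ; once = one }
  where
  _≟×_ : (p q : A × B) → Dec (p ≡ q)
  _≟×_ = ≡-dec (_≟ᴱ_ EA) (_≟ᴱ_ EB)
  one : ∀ p → ∑ (List.cartesianProduct (elements EA) (elements EB)) (λ q → ⟦ p ≟× q ⟧) ≡ 1
  one (a , b) = trans (∑-cartesianProduct (elements EA) (elements EB) (λ q → ⟦ (a , b) ≟× q ⟧))
    (trans (∑-cong (elements EA) (λ x → trans (∑-cong (elements EB) (λ y → split x y)) (trans (∑-*ˡ (elements EB) ⟦ _≟ᴱ_ EA a x ⟧ (λ y → ⟦ _≟ᴱ_ EB b y ⟧))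
      (trans (cong (⟦ _≟ᴱ_ EA a x ⟧ *_) (once EB b)) (*-identityʳ _))))) (once EA a))
    where
    split : ∀ x y → ⟦ (a , b) ≟× (x , y) ⟧ ≡ ⟦ _≟ᴱ_ EA a x ⟧ * ⟦ _≟ᴱ_ EB b y ⟧
    split x y = trans (⟦⟧-cong ((a , b) ≟× (x , y)) (_≟ᴱ_ EA a x ×-dec _≟ᴱ_ EB b y) (λ where refl → refl , refl) (λ where (refl , refl) → refl))
      (⟦⟧-× (_≟ᴱ_ EA a x) (_≟ᴱ_ EB b y))

pairE : ∀ n → Enumeration (Fin n × Fin n)
pairE n = productE (finE n) (finE n)

∑-pairs : ∀ {n} (h : Fin n × Fin n → ℕ) → ∑ (elements (pairE n)) h ≡ ∑F (λ i → ∑F (λ j → h (i , j)))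
∑-pairs {n} h = ∑-cartesianProduct (allFin n) (allFin n) h

module _ {n : ℕ} where

  bits : {Q : Fin n × Fin n → Set} → (∀ p → Dec (Q p)) → Vec Bool (n * n)
  bits Q? = Vec.tabulate (λ k → does (Q? (remQuot n k)))

  bits-size : {Q : Fin n × Fin n → Set} (Q? : ∀ p → Dec (Q p)) → ∣ bits Q? ∣ ≤ ∑F (λ i → ∑F (λ j → ⟦ Q? (i , j) ⟧))
  bits-size Q? = ≤-trans (∑-retract (finE (n * n)) (pairE n) (remQuot n) (λ (i , j) → combine i j) (λ k → 𝕀 (lookup (bits Q?) k)) (λ p → ⟦ Q? p ⟧)
      (λ k _ → combine-remQuot {n} n k , ≤-reflexive (cong 𝕀 (Vec.lookup∘tabulate (λ k → does (Q? (remQuot n k))) k))))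
    (≤-reflexive (∑-pairs (λ p → ⟦ Q? p ⟧)))

  bits-transfer : {Q R : Fin n × Fin n → Set} (Q? : ∀ p → Dec (Q p)) (R? : ∀ p → Dec (R p)) → bits Q? ≡ bits R? → ∀ p → Q p → R p
  bits-transfer Q? R? e (i , j) q = ⟦⟧-pos (R? (i , j)) λ z → contradiction (trans (sym (⟦⟧-yes (Q? (i , j)) q)) (trans (cong 𝕀 same) z)) λ ()
    where
    at : {Q : Fin n × Fin n → Set} (Q? : ∀ p → Dec (Q p)) → lookup (bits Q?) (combine i j) ≡ does (Q? (i , j))
    at Q? = trans (Vec.lookup∘tabulate (λ k → does (Q? (remQuot n k))) (combine i j)) (cong (λ p → does (Q? p)) (remQuot-combine i j))
    same : does (Q? (i , j)) ≡ does (R? (i , j))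
    same = trans (sym (at Q?)) (trans (cong (λ v → lookup v (combine i j)) e) (at R?))

  marks : {Q : Fin n → Set} → (∀ x → Dec (Q x)) → Vec Bool n
  marks Q? = Vec.tabulate (λ x → does (Q? x))

  marks-transfer : {Q R : Fin n → Set} (Q? : ∀ p → Dec (Q p)) (R? : ∀ p → Dec (R p)) → marks Q? ≡ marks R? → ∀ x → Q x → R x
  marks-transfer Q? R? e x q = ⟦⟧-pos (R? x) λ z → contradiction (trans (sym (⟦⟧-yes (Q? x) q)) (trans (cong 𝕀 same) z)) λ ()
    where
    same : does (Q? x) ≡ does (R? x)
    same = trans (sym (Vec.lookup∘tabulate (λ x → does (Q? x)) x)) (trans (cong (λ v → lookup v x) e) (Vec.lookup∘tabulate (λ x → does (R? x)) x))

-- Automorphisms of large support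

module LargeSupport {n : ℕ} (d : Fin n → ℕ) (Δ : ℕ) (d≥1 : ∀ i → 1 ≤ d i) (d≤Δ : ∀ i → d i ≤ Δ) where
  open LightVertices d Δ d≤Δ

  module _ {G : Graph n} (Dg : HasDegrees d G) {f g : Fin n → Fin n} (aut : IsAut G f g) where
    open IsAut aut
    open AutCode G f g aut

    private
      u B A : ℕ
      u = ∑F (λ x → ⟦ ¬? (V.least? x) ⟧)
      B = ∑F (λ w → ∑F (λ z → ⟦ backs? (w , z) ⟧))
      A = ∑F (λ x → ∑F (λ y → ⟦ chosen? (x , y) ⟧))

      B≤u : B ≤ u
      B≤u = ∑-mono (allFin n) λ w → begin
        ∑F (λ z → ⟦ backs? (w , z) ⟧)
          ≤⟨ ∑-mono (allFin n) (λ z → point w z) ⟩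
        ∑F (λ z → ⟦ g w ≟ z ⟧ * ⟦ ¬? (V.least? w) ⟧)
          ≡⟨ pick (finE n) (g w) (λ _ → ⟦ ¬? (V.least? w) ⟧) ⟩
        ⟦ ¬? (V.least? w) ⟧ ∎
        where
        open ≤-Reasoning
        point : ∀ w z → ⟦ backs? (w , z) ⟧ ≤ ⟦ g w ≟ z ⟧ * ⟦ ¬? (V.least? w) ⟧
        point w z = ⟦⟧≤ (backs? (w , z)) λ (¬r , e) → *-mono-≤ {1}
          (⟦⟧-≥1 (g w ≟ z) (trans (cong g (sym e)) (gf z))) (⟦⟧-≥1 (¬? (V.least? w)) ¬r)

      Passive : Fin n × Fin n → Set
      Passive p = Edge p × E.Least p × ¬ Chosen p

      passive? : ∀ p → Dec (Passive p)
      passive? p = adj? G (proj₁ p) (proj₂ p) ×-dec E.least? p ×-dec ¬? (chosen? p)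

      partner-injective : ∀ p q → Chosen p → Chosen q → partner p ≡ partner q → p ≡ q
      partner-injective p q (_ , lp , _) (_ , lq , _) e =
        trans (sym (proj₂ orbit)) (E.least-unique (proj₁ orbit) lq (subst E.Least (sym (proj₂ orbit)) lp))
        where
        i j : ℕ
        i = proj₁ (E.least-exists (swapPair p))
        j = proj₁ (E.least-exists (swapPair q))
        orbit : ∃ λ k → iter F k q ≡ p
        orbit = let (k , b) = E.back i p in k + j , trans (iter-+ F k j q)
          (trans (cong (iter F k) (trans (sym (cong swapPair (iter-swap j q))) (trans (cong swapPair (sym e)) (cong swapPair (iter-swap i p))))) b)

      -- If a chosen orbit and its reverse were both chosen, each would have a strictly smaller key
      -- than the other.
      partner-passive : ∀ p → Chosen p → Passive (partner p)
      partner-passive p (e , l , lt) = edge-iter i (swapPair p) (Adj-sym G e) , partner-least p , λ (_ , _ , lt′) →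
        let (j , b) = E.back i p in <-asym (lt i) (subst (λ q → key (partner p) < key q) (trans (cong (iter F j) (cong swapPair (iter-swap i p))) b) (lt′ j))
        where
        i : ℕ
        i = proj₁ (E.least-exists (swapPair p))

      A≤passive : A ≤ ∑F (λ x → ∑F (λ y → ⟦ passive? (x , y) ⟧))
      A≤passive = subst₂ _≤_ (∑-pairs (λ p → ⟦ chosen? p ⟧)) (∑-pairs (λ p → ⟦ passive? p ⟧))
        (∑-inject (pairE n) (pairE n) partner (λ p → ⟦ chosen? p ⟧) (λ p → ⟦ passive? p ⟧)
          (λ p q hp hq → partner-injective p q (⟦⟧-pos (chosen? p) hp) (⟦⟧-pos (chosen? q) hq))
          (λ p → ⟦⟧≤ (chosen? p) (λ c → ⟦⟧-≥1 (passive? (partner p)) (partner-passive p c))))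

      -- A chosen half-edge and its partner are different least half-edges, and both start at roots.
      -- Each chosen pair therefore uses up two units of root degree.
      root-degrees : A + A ≤ ∑F (λ x → ⟦ V.least? x ⟧ * d x)
      root-degrees = begin
        A + A
          ≤⟨ +-monoʳ-≤ A A≤passive ⟩
        A + ∑F (λ x → ∑F (λ y → ⟦ passive? (x , y) ⟧))
          ≡⟨ ∑∑-+ (λ x y → ⟦ chosen? (x , y) ⟧) (λ x y → ⟦ passive? (x , y) ⟧) ⟨
        ∑F (λ x → ∑F (λ y → ⟦ chosen? (x , y) ⟧ + ⟦ passive? (x , y) ⟧))
          ≤⟨ double-∑F-mono (λ x y → point x y (chosen? (x , y)) (passive? (x , y))) ⟩
        ∑F (λ x → ∑F (λ y → ⟦ V.least? x ⟧ * 𝕀 (adj G x y)))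
          ≡⟨ ∑-cong (allFin n) (λ x → trans (∑-*ˡ (allFin n) ⟦ V.least? x ⟧ (λ y → 𝕀 (adj G x y))) (cong (⟦ V.least? x ⟧ *_) (Dg x))) ⟩
        ∑F (λ x → ⟦ V.least? x ⟧ * d x) ∎
        where
        open ≤-Reasoning
        rooted : ∀ x y → Edge (x , y) → E.Least (x , y) → 1 ≤ ⟦ V.least? x ⟧ * 𝕀 (adj G x y)
        rooted x y e l = *-mono-≤ {1} (⟦⟧-≥1 (V.least? x) (least⇒root l)) (𝕀-T e)
        point : ∀ x y (c : Dec (Chosen (x , y))) (p : Dec (Passive (x , y))) → ⟦ c ⟧ + ⟦ p ⟧ ≤ ⟦ V.least? x ⟧ * 𝕀 (adj G x y)
        point x y (yes c) (yes (_ , _ , ¬c)) = contradiction c ¬c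
        point x y (yes (e , l , _)) (no _) = rooted x y e l
        point x y (no _) (yes (e , l , _)) = rooted x y e l
        point x y (no _) (no _) = z≤n

      -- The correction supplies what vertices of degree 1 and 2 lack to reach 3.
      nonroot-degrees : 3 * u ≤ ∑F (λ x → ⟦ ¬? (V.least? x) ⟧ * d x) + (2 * n₁ + n₂)
      nonroot-degrees = begin
        3 * u
          ≡⟨ ∑-*ˡ (allFin n) 3 (λ x → ⟦ ¬? (V.least? x) ⟧) ⟨
        ∑F (λ x → 3 * ⟦ ¬? (V.least? x) ⟧)
          ≤⟨ ∑-mono (allFin n) (λ x → point (d x) (d≥1 x) (¬? (V.least? x))) ⟩
        ∑F (λ x → ⟦ ¬? (V.least? x) ⟧ * d x + (2 * ⟦ d x ℕ.≟ 1 ⟧ + ⟦ d x ℕ.≟ 2 ⟧))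
          ≡⟨ trans (∑-+ (allFin n) (λ x → ⟦ ¬? (V.least? x) ⟧ * d x) (λ x → 2 * ⟦ d x ℕ.≟ 1 ⟧ + ⟦ d x ℕ.≟ 2 ⟧))
               (cong (∑F (λ x → ⟦ ¬? (V.least? x) ⟧ * d x) +_) (trans (∑-+ (allFin n) (λ x → 2 * ⟦ d x ℕ.≟ 1 ⟧) (λ x → ⟦ d x ℕ.≟ 2 ⟧))
                 (cong (_+ n₂) (∑-*ˡ (allFin n) 2 (λ x → ⟦ d x ℕ.≟ 1 ⟧))))) ⟩
        ∑F (λ x → ⟦ ¬? (V.least? x) ⟧ * d x) + (2 * n₁ + n₂) ∎
        where
        open ≤-Reasoning
        point : ∀ k → 1 ≤ k → {P : Set} (p? : Dec P) → 3 * ⟦ p? ⟧ ≤ ⟦ p? ⟧ * k + (2 * ⟦ k ℕ.≟ 1 ⟧ + ⟦ k ℕ.≟ 2 ⟧)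
        point k _ (no _) = z≤n
        point 1 _ (yes _) = ≤-refl
        point 2 _ (yes _) = ≤-refl
        point (suc (suc (suc k))) _ (yes _) = s≤s (s≤s (s≤s z≤n))

      -- If `x` is moved, then `x` and `f x` are distinct in one orbit, so one of them is not a
      -- root.
      moved≤ : ∣ moved f ∣ ≤ 2 * u
      moved≤ = begin
        ∣ moved f ∣
          ≤⟨ ∑-mono (allFin n) (λ x → ⟦⟧≤ (T? (lookup (moved f) x)) (λ m → point x (moved-⁻ f m) (V.least? x) (V.least? (f x)))) ⟩
        ∑F (λ x → ⟦ ¬? (V.least? x) ⟧ + ⟦ ¬? (V.least? (f x)) ⟧)
          ≡⟨ ∑-+ (allFin n) (λ x → ⟦ ¬? (V.least? x) ⟧) (λ x → ⟦ ¬? (V.least? (f x)) ⟧) ⟩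
        u + ∑F (λ x → ⟦ ¬? (V.least? (f x)) ⟧)
          ≤⟨ +-monoʳ-≤ u (≤-trans (∑-retract (finE n) (finE n) f g (λ x → ⟦ ¬? (V.least? (f x)) ⟧) (λ x → ⟦ ¬? (V.least? x) ⟧) (λ x _ → gf x , ≤-refl)) (≤-reflexive (sym (+-identityʳ u)))) ⟩
        2 * u ∎
        where
        open ≤-Reasoning
        point : ∀ x → f x ≢ x → (a : Dec (Root x)) (b : Dec (Root (f x))) → 1 ≤ ⟦ ¬? a ⟧ + ⟦ ¬? b ⟧
        point x ne (yes r) (yes r′) = contradiction (V.least-unique 1 r r′) ne
        point x ne (yes _) (no _) = ≤-refl
        point x ne (no _) b = s≤s z≤n

    -- A non-root costs one stored pair but removes at least three units of degree, that is 3/2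
    -- edges, up to the correction for light vertices. This saves half a pair for each non-root, and
    -- at least half of the moved vertices are matched by non-roots.
    code-size : 4 * (∣ bits backs? ∣ + ∣ bits chosen? ∣) + ∣ moved f ∣ ≤ 2 * ∑F d + (4 * n₁ + 2 * n₂)
    code-size = begin
      4 * (∣ bits backs? ∣ + ∣ bits chosen? ∣) + ∣ moved f ∣
        ≤⟨ +-mono-≤ (*-monoʳ-≤ 4 (+-mono-≤ (≤-trans (bits-size backs?) B≤u) (bits-size chosen?))) moved≤ ⟩
      4 * (u + A) + 2 * u
        ≡⟨ lem₁ u A ⟩
      2 * (A + A) + 2 * (3 * u)
        ≤⟨ +-mono-≤ (*-monoʳ-≤ 2 root-degrees) (*-monoʳ-≤ 2 nonroot-degrees) ⟩
      2 * R + 2 * (N + (2 * n₁ + n₂))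
        ≡⟨ lem₂ R N n₁ n₂ ⟩
      2 * (R + N) + (4 * n₁ + 2 * n₂)
        ≡⟨ cong (λ k → 2 * k + (4 * n₁ + 2 * n₂)) (trans (sym (∑-+ (allFin n) (λ x → ⟦ V.least? x ⟧ * d x) (λ x → ⟦ ¬? (V.least? x) ⟧ * d x)))
             (∑-cong (allFin n) (λ x → trans (sym (*-distribʳ-+ (d x) ⟦ V.least? x ⟧ ⟦ ¬? (V.least? x) ⟧)) (trans (cong (_* d x) (⟦⟧-¬ (V.least? x))) (*-identityˡ (d x)))))) ⟩
      2 * ∑F d + (4 * n₁ + 2 * n₂) ∎
      where
      open ≤-Reasoning
      R N : ℕ
      R = ∑F (λ x → ⟦ V.least? x ⟧ * d x)
      N = ∑F (λ x → ⟦ ¬? (V.least? x) ⟧ * d x)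
      lem₁ : ∀ u A → 4 * (u + A) + 2 * u ≡ 2 * (A + A) + 2 * (3 * u)
      lem₁ = solve-∀
      lem₂ : ∀ R N a b → 2 * R + 2 * (N + (2 * a + b)) ≡ 2 * (R + N) + (4 * a + 2 * b)
      lem₂ = solve-∀

  Code : Set
  Code = (Vec Bool (n * n) × Vec Bool (n * n)) × Vec Bool n

  codeE : Enumeration Code
  codeE = productE (productE (vecE (n * n)) (vecE (n * n))) (vecE n)

  -- Stands for n^(-|v|), multiplied by n^(n²) to be integral.
  weightOf : Vec Bool (n * n) → ℕ
  weightOf v = weigh v (λ _ → 1) (λ _ → n)

  size-weight : ∀ v → n ^ ∣ v ∣ * weightOf v ≡ n ^ (n * n)
  size-weight v = begin
    n ^ ∣ v ∣ * weightOf v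
      ≡⟨ cong (_* weightOf v) (trans (cong (n ^_) (∑-cong (allFin (n * n)) (λ i → sym (*-identityʳ (𝕀 (lookup v i)))))) (^-size v n (λ _ → 1))) ⟩
    weigh v (λ _ → n ^ 1) (λ _ → 1) * weightOf v
      ≡⟨ weigh-* v (λ _ → n ^ 1) (λ _ → 1) (λ _ → 1) (λ _ → n) ⟩
    weigh v (λ _ → n ^ 1 * 1) (λ _ → 1 * n)
      ≡⟨ trans (∏-cong (λ i → same (lookup v i))) (∏-const (n * n) n) ⟩
    n ^ (n * n) ∎
    where
    open ≡-Reasoning
    same : ∀ b → (if b then n ^ 1 * 1 else 1 * n) ≡ n
    same true = trans (*-identityʳ (n ^ 1)) (*-identityʳ n)
    same false = *-identityˡ n

  -- The sum of n^(-|v|) over all sets of pairs is (1 + 1/n)^(n²), at most 4^n. So a code with q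
  -- pairs is charged n^q up to an exponential factor, with no count of permutations.
  ∑-weights : 1 ≤ n → ∑ (allVecs (n * n)) weightOf ≤ 4 ^ n * n ^ (n * n)
  ∑-weights 1≤n = begin
    ∑ (allVecs (n * n)) weightOf   ≡⟨ trans (∑-subsets {n * n} (λ _ → 1) (λ _ → n)) (trans (∏-const (n * n) (1 + n)) (cong (_^ (n * n)) (+-comm 1 n))) ⟩
    (n + 1) ^ (n * n)              ≤⟨ exp-bound n 1 (n * n) n 1≤n (≤-reflexive (*-identityʳ (n * n))) ⟩
    4 ^ n * n ^ (n * n)            ∎
    where open ≤-Reasoning

  module _ (M : ℕ) where

    Large : Vec Bool n → Set
    Large S = M ≤ ∣ S ∣

    large? : ∀ S → Dec (Large S)
    large? S = M ≤? ∣ S ∣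

    code : (G : Graph n) → Dec (HasAut Large G) → Code
    code G (yes (v , w , aut , _)) = (bits (AutCode.backs? G (lookup v) (lookup w) aut) , bits (AutCode.chosen? G (lookup v) (lookup w) aut)) , marks (AutCode.antipodal? G (lookup v) (lookup w) aut)
    -- A default value; injectivity is claimed only for graphs that have such an automorphism.
    code G (no _) = (Vec.replicate _ false , Vec.replicate _ false) , Vec.replicate _ false

    -- The two automorphisms are found by independent searches, so equality of the codes must first
    -- identify them. Decoding in both directions then gives equal adjacency.
    code-injective : ∀ G H (p : Dec (HasAut Large G)) (q : Dec (HasAut Large H)) → ⟦ p ⟧ ≢ 0 → ⟦ q ⟧ ≢ 0 → code G p ≡ code H q → G ≡ H
    code-injective G H (no _) _ ne _ _ = contradiction refl ne
    code-injective G H (yes _) (no _) _ ne _ = contradiction refl ne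
    code-injective G H (yes (v , w , a , _)) (yes (v′ , w′ , b , _)) _ _ e = graph-ext G H λ i j → T-ext
      (Decode.decode-edge a b (bits-transfer C₁.backs? C₂.backs? e₁) (bits-transfer C₂.backs? C₁.backs? (sym e₁)) (bits-transfer C₁.chosen? C₂.chosen? e₂) (marks-transfer C₁.antipodal? C₂.antipodal? e₃) i j)
      (Decode.decode-edge b a (bits-transfer C₂.backs? C₁.backs? (sym e₁)) (bits-transfer C₁.backs? C₂.backs? e₁) (bits-transfer C₂.chosen? C₁.chosen? (sym e₂)) (marks-transfer C₂.antipodal? C₁.antipodal? (sym e₃)) i j)
      where
      module C₁ = AutCode G (lookup v) (lookup w) a
      module C₂ = AutCode H (lookup v′) (lookup w′) b
      e₁ : bits C₁.backs? ≡ bits C₂.backs?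
      e₁ = cong (λ c → proj₁ (proj₁ c)) e
      e₂ : bits C₁.chosen? ≡ bits C₂.chosen?
      e₂ = cong (λ c → proj₂ (proj₁ c)) e
      e₃ : marks C₁.antipodal? ≡ marks C₂.antipodal?
      e₃ = cong proj₂ e

    -- A code with at most `Q` pairs has cost at least `c`, and the costs of all codes add up to at
    -- most c · n^Q · 32^n. Here 32 is 2 · 4 · 4: the marks and the two bit vectors.
    large-aut-count : ∀ Q → 1 ≤ n → (∀ q → 4 * q + M ≤ 2 * ∑F d + (4 * n₁ + 2 * n₂) → q ≤ Q) →
      ∑𝒢 d (λ G → ⟦ hasAut? large? G ⟧) ≤ n ^ Q * 32 ^ n
    large-aut-count Q 1≤n q≤Q = cancel-≤ c (*-mono-≤ {1} (^-pos (n * n) 1≤n) (^-pos (n * n) 1≤n)) (begin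
      c * ∑𝒢 d (λ G → ⟦ hasAut? large? G ⟧)
        ≡⟨ ∑𝒢-* d c (λ G → ⟦ hasAut? large? G ⟧) ⟨
      ∑𝒢 d (λ G → c * ⟦ hasAut? large? G ⟧)
        ≤⟨ ∑-inject (graphE n) codeE (λ G → code G (hasAut? large? G)) (λ G → ⟦ hasDegrees? d G ⟧ * (c * ⟦ hasAut? large? G ⟧)) cost inj le ⟩
      ∑ (elements codeE) cost
        ≡⟨ trans (∑-cartesianProduct (elements (productE (vecE (n * n)) (vecE (n * n)))) (allVecs n) cost)
             (∑-cartesianProduct (allVecs (n * n)) (allVecs (n * n)) (λ vw → ∑ (allVecs n) (λ b → cost (vw , b)))) ⟩
      ∑ (allVecs (n * n)) (λ v → ∑ (allVecs (n * n)) (λ w → ∑ (allVecs n) (λ b → n ^ Q * (weightOf v * weightOf w))))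
        ≡⟨ ∑-cong (allVecs (n * n)) (λ v → trans (∑-cong (allVecs (n * n)) (λ w → inner v w)) (∑-*ˡ (allVecs (n * n)) (2 ^ n * n ^ Q * weightOf v) weightOf)) ⟩
      ∑ (allVecs (n * n)) (λ v → 2 ^ n * n ^ Q * weightOf v * ∑ (allVecs (n * n)) weightOf)
        ≡⟨ trans (∑-*ʳ (allVecs (n * n)) (∑ (allVecs (n * n)) weightOf) (λ v → 2 ^ n * n ^ Q * weightOf v)) (cong (_* ∑ (allVecs (n * n)) weightOf) (∑-*ˡ (allVecs (n * n)) (2 ^ n * n ^ Q) weightOf)) ⟩
      2 ^ n * n ^ Q * ∑ (allVecs (n * n)) weightOf * ∑ (allVecs (n * n)) weightOf
        ≤⟨ *-mono-≤ (*-monoʳ-≤ (2 ^ n * n ^ Q) (∑-weights 1≤n)) (∑-weights 1≤n) ⟩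
      2 ^ n * n ^ Q * (4 ^ n * n ^ (n * n)) * (4 ^ n * n ^ (n * n))
        ≡⟨ lem (2 ^ n) (n ^ Q) (4 ^ n) (n ^ (n * n)) ⟩
      c * (n ^ Q * (2 ^ n * 4 ^ n * 4 ^ n))
        ≡⟨ cong (λ k → c * (n ^ Q * k)) (trans (cong (_* 4 ^ n) (sym (^-distribʳ-* 2 4 n))) (sym (^-distribʳ-* 8 4 n))) ⟩
      c * (n ^ Q * 32 ^ n) ∎)
      where
      open ≤-Reasoning
      c : ℕ
      c = n ^ (n * n) * n ^ (n * n)
      lem : ∀ a q b e → a * q * (b * e) * (b * e) ≡ e * e * (q * (a * b * b))
      lem = solve-∀
      cost : Code → ℕ
      cost ((v , w) , b) = n ^ Q * (weightOf v * weightOf w)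
      inner : ∀ v w → ∑ (allVecs n) (λ b → n ^ Q * (weightOf v * weightOf w)) ≡ 2 ^ n * n ^ Q * weightOf v * weightOf w
      inner v w = trans (trans (∑-cong (allVecs n) (λ b → sym (*-identityˡ (n ^ Q * (weightOf v * weightOf w))))) (∑-*ʳ (allVecs n) (n ^ Q * (weightOf v * weightOf w)) (λ _ → 1)))
        (trans (cong (_* (n ^ Q * (weightOf v * weightOf w))) two^n) (lem₂ (2 ^ n) (n ^ Q) (weightOf v) (weightOf w)))
        where
        lem₂ : ∀ a b c d → a * (b * (c * d)) ≡ a * b * c * d
        lem₂ = solve-∀
        two^n : ∑ (allVecs n) (λ _ → 1) ≡ 2 ^ n
        two^n = trans (∑-cong (allVecs n) (λ v → sym (trans (weigh-same v (λ _ → 1)) (trans (∏-const n 1) (^-zeroˡ n))))) (trans (∑-subsets {n} (λ _ → 1) (λ _ → 1)) (∏-const n 2))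
      has : ∀ G → ⟦ hasDegrees? d G ⟧ * (c * ⟦ hasAut? large? G ⟧) ≢ 0 → ⟦ hasAut? large? G ⟧ ≢ 0
      has G ne = *≢0ʳ c (*≢0ʳ ⟦ hasDegrees? d G ⟧ ne)
      inj : ∀ G H → ⟦ hasDegrees? d G ⟧ * (c * ⟦ hasAut? large? G ⟧) ≢ 0 → ⟦ hasDegrees? d H ⟧ * (c * ⟦ hasAut? large? H ⟧) ≢ 0 →
        code G (hasAut? large? G) ≡ code H (hasAut? large? H) → G ≡ H
      inj G H gne hne = code-injective G H (hasAut? large? G) (hasAut? large? H) (has G gne) (has H hne)
      le : ∀ G → ⟦ hasDegrees? d G ⟧ * (c * ⟦ hasAut? large? G ⟧) ≤ cost (code G (hasAut? large? G))
      le G = ⟦⟧*≤ (hasDegrees? d G) λ Dg → ≤-trans (≤-reflexive (*-comm c ⟦ hasAut? large? G ⟧)) (by Dg (hasAut? large? G))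
        where
        by : HasDegrees d G → (p : Dec (HasAut Large G)) → ⟦ p ⟧ * c ≤ cost (code G p)
        by Dg (no _) = z≤n
        by Dg (yes (v , w , a , big)) = begin
          1 * c
            ≡⟨ *-identityˡ c ⟩
          c
            ≡⟨ cong₂ _*_ (size-weight τ) (size-weight α) ⟨
          n ^ ∣ τ ∣ * weightOf τ * (n ^ ∣ α ∣ * weightOf α)
            ≡⟨ lem₃ (n ^ ∣ τ ∣) (weightOf τ) (n ^ ∣ α ∣) (weightOf α) ⟩
          n ^ ∣ τ ∣ * n ^ ∣ α ∣ * (weightOf τ * weightOf α)
            ≡⟨ cong (_* (weightOf τ * weightOf α)) (^-distribˡ-+-* n ∣ τ ∣ ∣ α ∣) ⟨
          n ^ (∣ τ ∣ + ∣ α ∣) * (weightOf τ * weightOf α)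
            ≤⟨ *-monoˡ-≤ (weightOf τ * weightOf α) (^-mono 1≤n (q≤Q (∣ τ ∣ + ∣ α ∣) (≤-trans (+-monoʳ-≤ (4 * (∣ τ ∣ + ∣ α ∣)) big) (code-size Dg a)))) ⟩
          n ^ Q * (weightOf τ * weightOf α) ∎
          where
          τ α : Vec Bool (n * n)
          τ = bits (AutCode.backs? G (lookup v) (lookup w) a)
          α = bits (AutCode.chosen? G (lookup v) (lookup w) a)
          lem₃ : ∀ a b c d → a * b * (c * d) ≡ a * c * (b * d)
          lem₃ = solve-∀

-- Lower bound for the number of graphs

containing : ∀ {n} → List (Fin n × Fin n) → Graph n → ℕ
containing [] G = 1
containing ((x , y) ∷ zs) G = 𝕀 (adj G x y) * containing zs G

Ordered : ∀ {n} → Fin n × Fin n → Set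
Ordered (i , j) = toℕ i < toℕ j

module GraphCount {n : ℕ} (d : Fin n → ℕ) (Δ : ℕ) (d≤Δ : ∀ i → d i ≤ Δ) where
  open BoundedDegree d Δ d≤Δ

  Avoids : List (Fin n × Fin n) → Fin n → Fin n → Set
  Avoids zs a b = All (λ (i , j) → ¬ SamePair a b i j) zs

  avoids? : ∀ zs a b → Dec (Avoids zs a b)
  avoids? zs a b = All.all? (λ (i , j) → ¬? (samePair? a b i j)) zs

  hits : List (Fin n × Fin n) → Fin n → Fin n → ℕ
  hits zs a b = ∑ zs (λ (i , j) → ⟦ i ≟ a ⟧ * ⟦ j ≟ b ⟧ + ⟦ j ≟ a ⟧ * ⟦ i ≟ b ⟧)

  hits-total : ∀ zs → ∑F (λ a → ∑F (hits zs a)) ≡ 2 * length zs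
  hits-total [] = ∑-zero (allFin n) (λ a → ∑-zero (allFin n) (λ b → refl))
  hits-total ((i , j) ∷ zs) = begin
    ∑F (λ a → ∑F (hits ((i , j) ∷ zs) a))
      ≡⟨ ∑∑-+ (λ a b → ⟦ i ≟ a ⟧ * ⟦ j ≟ b ⟧ + ⟦ j ≟ a ⟧ * ⟦ i ≟ b ⟧) (hits zs) ⟩
    ∑F (λ a → ∑F (λ b → ⟦ i ≟ a ⟧ * ⟦ j ≟ b ⟧ + ⟦ j ≟ a ⟧ * ⟦ i ≟ b ⟧)) + ∑F (λ a → ∑F (hits zs a))
      ≡⟨ cong₂ _+_ (trans (∑∑-+ (λ a b → ⟦ i ≟ a ⟧ * ⟦ j ≟ b ⟧) (λ a b → ⟦ j ≟ a ⟧ * ⟦ i ≟ b ⟧)) (cong₂ _+_ (pair-sum i j) (pair-sum j i))) (hits-total zs) ⟩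
    2 + 2 * length zs
      ≡⟨ *-suc 2 (length zs) ⟨
    2 * suc (length zs) ∎
    where open ≡-Reasoning

  ¬avoids⇒hits : ∀ zs a b → ¬ Avoids zs a b → 1 ≤ hits zs a b
  ¬avoids⇒hits [] a b h = contradiction [] h
  ¬avoids⇒hits ((i , j) ∷ zs) a b h with samePair? a b i j
  ... | yes s = ≤-trans (hit s) (m≤m+n _ (hits zs a b))
    where
    hit : SamePair a b i j → 1 ≤ ⟦ i ≟ a ⟧ * ⟦ j ≟ b ⟧ + ⟦ j ≟ a ⟧ * ⟦ i ≟ b ⟧
    hit (inj₁ (p , q)) = ≤-trans (≤-reflexive (sym (cong₂ _*_ (⟦⟧-yes (i ≟ a) (sym p)) (⟦⟧-yes (j ≟ b) (sym q))))) (m≤m+n (⟦ i ≟ a ⟧ * ⟦ j ≟ b ⟧) _)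
    hit (inj₂ (p , q)) = ≤-trans (≤-reflexive (sym (cong₂ _*_ (⟦⟧-yes (j ≟ a) (sym p)) (⟦⟧-yes (i ≟ b) (sym q))))) (m≤n+m (⟦ j ≟ a ⟧ * ⟦ i ≟ b ⟧) (⟦ i ≟ a ⟧ * ⟦ j ≟ b ⟧))
  ... | no ¬s = ≤-trans (¬avoids⇒hits zs a b (λ av → h (¬s ∷ av))) (m≤n+m (hits zs a b) _)

  -- Each listed pair blocks only its two orientations.
  many-free : ∀ {G} → HasDegrees d G → ∀ zs → ∑F d ≤ ∑F (λ a → ∑F (λ b → ⟦ avoids? zs a b ⟧ * 𝕀 (adj G a b))) + 2 * length zs
  many-free {G} Dg zs = begin
    ∑F d
      ≡⟨ ∑-cong (allFin n) (λ i → sym (Dg i)) ⟩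
    ∑F (λ a → ∑F (λ b → 𝕀 (adj G a b)))
      ≤⟨ double-∑F-mono (λ a b → point a b (avoids? zs a b)) ⟩
    ∑F (λ a → ∑F (λ b → ⟦ avoids? zs a b ⟧ * 𝕀 (adj G a b) + hits zs a b))
      ≡⟨ trans (∑∑-+ (λ a b → ⟦ avoids? zs a b ⟧ * 𝕀 (adj G a b)) (hits zs)) (cong (∑F (λ a → ∑F (λ b → ⟦ avoids? zs a b ⟧ * 𝕀 (adj G a b))) +_) (hits-total zs)) ⟩
    ∑F (λ a → ∑F (λ b → ⟦ avoids? zs a b ⟧ * 𝕀 (adj G a b))) + 2 * length zs ∎
    where
    open ≤-Reasoning
    point : ∀ a b (v : Dec (Avoids zs a b)) → 𝕀 (adj G a b) ≤ ⟦ v ⟧ * 𝕀 (adj G a b) + hits zs a b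
    point a b (yes _) = ≤-trans (≤-reflexive (sym (*-identityˡ (𝕀 (adj G a b))))) (m≤m+n (1 * 𝕀 (adj G a b)) (hits zs a b))
    point a b (no ¬v) = ≤-trans (⟦⟧≤1 (adj? G a b)) (¬avoids⇒hits zs a b ¬v)

  -- The pairs are revealed one at a time, each at a cost of Δ²/β. Only edges different from the
  -- remaining pairs are used for switching, so these stay present.
  containing-bound : ∀ β zs → β + slack + 2 * length zs ≤ ∑F d → Unique zs → All Ordered zs →
    β ^ length zs * ∑𝒢 d (containing zs) ≤ (Δ * Δ) ^ length zs * ∑𝒢 d (λ _ → 1)
  containing-bound β [] _ _ _ = ≤-refl
  containing-bound β ((x , y) ∷ zs) β≤ (z∉ ∷ uniq) (x<y ∷ ord) = begin
    β * β ^ l * V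
      ≡⟨ lem β (β ^ l) V ⟩
    β ^ l * (β * V)
      ≤⟨ *-monoʳ-≤ (β ^ l) (switching-bound x y (λ a b → ⟦ avoids? zs a b ⟧) (containing zs) β (λ a b → ⟦⟧≤1 (avoids? zs a b)) mono many) ⟩
    β ^ l * (Δ * Δ * ∑𝒢 d (containing zs))
      ≡⟨ lem₂ (β ^ l) (Δ * Δ) (∑𝒢 d (containing zs)) ⟩
    Δ * Δ * (β ^ l * ∑𝒢 d (containing zs))
      ≤⟨ *-monoʳ-≤ (Δ * Δ) (containing-bound β zs β≤′ uniq ord) ⟩
    Δ * Δ * ((Δ * Δ) ^ l * ∑𝒢 d (λ _ → 1))
      ≡⟨ *-assoc (Δ * Δ) ((Δ * Δ) ^ l) (∑𝒢 d (λ _ → 1)) ⟨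
    (Δ * Δ) ^ suc l * ∑𝒢 d (λ _ → 1) ∎
    where
    open ≤-Reasoning
    l V : ℕ
    l = length zs
    V = ∑𝒢 d (λ G → 𝕀 (adj G x y) * containing zs G)
    lem : ∀ b p v → b * p * v ≡ p * (b * v)
    lem = solve-∀
    lem₂ : ∀ p D w → p * (D * w) ≡ D * (p * w)
    lem₂ = solve-∀
    β≤′ : β + slack + 2 * l ≤ ∑F d
    β≤′ = ≤-trans (+-monoʳ-≤ (β + slack) (*-monoʳ-≤ 2 (n≤1+n l))) β≤
    many : ∀ G → HasDegrees d G → β + slack ≤ ∑F (λ a → ∑F (λ b → ⟦ avoids? zs a b ⟧ * 𝕀 (adj G a b)))
    many G Dg = +-cancelʳ-≤ (2 * l) (β + slack) (∑F (λ a → ∑F (λ b → ⟦ avoids? zs a b ⟧ * 𝕀 (adj G a b)))) (≤-trans β≤′ (many-free Dg zs))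
    mono : ∀ G a b → ⟦ avoids? zs a b ⟧ ≢ 0 → Switchable G x y a b → containing zs G ≤ containing zs (switch x y a b G)
    mono G a b av sw = go zs z∉ ord (⟦⟧-pos (avoids? zs a b) av)
      where
      go : ∀ zs → All ((x , y) ≢_) zs → All Ordered zs → Avoids zs a b → containing zs G ≤ containing zs (switch x y a b G)
      go [] _ _ _ = ≤-refl
      go ((i , j) ∷ zs) (ne ∷ nes) (i<j ∷ ord) (¬s ∷ av) = *-mono-≤
        (⟦⟧≤ (adj? G i j) (λ ij → 𝕀-T (switch-keeps sw i j ij ¬xy ¬s))) (go zs nes ord av)
        where
        ¬xy : ¬ SamePair x y i j
        ¬xy (inj₁ (refl , refl)) = ne refl
        ¬xy (inj₂ (refl , refl)) = <-asym x<y i<j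

  edges : Graph n → List (Fin n × Fin n)
  edges G = filter (λ (i , j) → i <ᶠ? j ×-dec adj? G i j) (List.cartesianProduct (allFin n) (allFin n))

  edge-count : ∀ {G} → HasDegrees d G → 2 * length (edges G) ≡ ∑F d
  edge-count {G} Dg = begin
    2 * length (edges G)
      ≡⟨ cong (2 *_) (trans (length-filter≡∑ (λ (i , j) → i <ᶠ? j ×-dec adj? G i j) (List.cartesianProduct (allFin n) (allFin n)))
           (trans (∑-cartesianProduct (allFin n) (allFin n) (λ z → ⟦ proj₁ z <ᶠ? proj₂ z ×-dec adj? G (proj₁ z) (proj₂ z) ⟧))
             (∑-cong (allFin n) (λ i → ∑-cong (allFin n) (λ j → ⟦⟧-× (i <ᶠ? j) (adj? G i j)))))) ⟩
    2 * ∑F (λ i → ∑F (λ j → ⟦ i <ᶠ? j ⟧ * 𝕀 (adj G i j)))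
      ≡⟨ handshake (λ i j → 𝕀 (adj G i j)) (λ i j → cong 𝕀 (adj-sym G i j)) (λ i → cong 𝕀 (adj-irrefl G i)) ⟨
    ∑F (deg G)
      ≡⟨ ∑-cong (allFin n) Dg ⟩
    ∑F d ∎
    where open ≡-Reasoning

  -- Take `J` edges of one graph `G`. The graph `G` itself contains them, yet at most a fraction
  -- (Δ²/β)^J of all graphs does, so there are at least (β/Δ²)^J graphs.
  graph-count : ∀ {G} → HasDegrees d G → ∀ J β → J ≤ length (edges G) → β + slack + 2 * J ≤ ∑F d → β ^ J ≤ (Δ * Δ) ^ J * ∑𝒢 d (λ _ → 1)
  graph-count {G} Dg J β J≤ β≤ = begin
    β ^ J
      ≡⟨ trans (sym (*-identityʳ (β ^ J))) (cong (β ^ J *_) (sym (contained zs zs⊆G))) ⟩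
    β ^ J * containing zs G
      ≤⟨ *-monoʳ-≤ (β ^ J) (∑𝒢-term d (containing zs) G Dg) ⟩
    β ^ J * ∑𝒢 d (containing zs)
      ≡⟨ cong (λ k → β ^ k * ∑𝒢 d (containing zs)) (sym len) ⟩
    β ^ length zs * ∑𝒢 d (containing zs)
      ≤⟨ containing-bound β zs (subst (λ k → β + slack + 2 * k ≤ ∑F d) (sym len) β≤)
           (Unique.take⁺ J (Unique.filter⁺ (λ (i , j) → i <ᶠ? j ×-dec adj? G i j) (Unique.cartesianProduct⁺ (Unique.allFin⁺ n) (Unique.allFin⁺ n))))
           (All.map proj₁ zs-all) ⟩
    (Δ * Δ) ^ length zs * ∑𝒢 d (λ _ → 1)
      ≡⟨ cong (λ k → (Δ * Δ) ^ k * ∑𝒢 d (λ _ → 1)) len ⟩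
    (Δ * Δ) ^ J * ∑𝒢 d (λ _ → 1) ∎
    where
    open ≤-Reasoning
    zs : List (Fin n × Fin n)
    zs = take J (edges G)
    len : length zs ≡ J
    len = trans (List.length-take J (edges G)) (m≤n⇒m⊓n≡m J≤)
    zs-all : All (λ (i , j) → toℕ i < toℕ j × Adj G i j) zs
    zs-all = All.take⁺ J (All.all-filter (λ (i , j) → i <ᶠ? j ×-dec adj? G i j) (List.cartesianProduct (allFin n) (allFin n)))
    zs⊆G : All (λ (i , j) → Adj G i j) zs
    zs⊆G = All.map proj₂ zs-all
    contained : ∀ zs → All (λ (i , j) → Adj G i j) zs → containing zs G ≡ 1
    contained [] _ = refl
    contained (_ ∷ zs) (e ∷ es) = trans (cong₂ _*_ (cong 𝕀 (T⇒≡ e)) (contained zs es)) refl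

-- Asymmetry almost surely: both ranges of support combined

≤-/ : ∀ a b m .{{_ : NonZero b}} → a * b ≤ m → a ≤ m / b
≤-/ a b m h = ≤-trans (≤-reflexive (sym (m*n/n≡m a b))) (/-monoˡ-≤ b h)

/-upper : ∀ m b .{{_ : NonZero b}} → m ≤ b * suc (m / b)
/-upper m b = begin
  m                    ≡⟨ m≡m%n+[m/n]*n m b ⟩
  m % b + m / b * b    ≤⟨ +-monoˡ-≤ (m / b * b) (<⇒≤ (m%n<n m b)) ⟩
  b + m / b * b        ≡⟨ lem b (m / b) ⟩
  b * suc (m / b)      ∎
  where
  open ≤-Reasoning
  lem : ∀ b q → b + q * b ≡ b * suc q
  lem = solve-∀

module AsymmetricParameters (Δ E : ℕ) where
  open SmallParameters Δ E public

  abstract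
    -- With r about n/(32 cutoff), n ≤ ratio · r after allowing a factor 2 for rounding. `base`
    -- collects the exponential losses of both counts per vertex. The summands of `minSize` ensure,
    -- in order, that r exceeds `slack`, that E · base^ratio ≤ n, that 4 · slack ≤ n and that n is
    -- positive.
    ratio base minSize : ℕ
    ratio = 64 * cutoff
    base = 32 * (ratio * (Δ * Δ)) ^ Δ
    minSize = 32 * cutoff * suc (slackOf Δ) + E * base ^ ratio + 4 * slackOf Δ + 1

    ratio≡ : ratio ≡ 64 * cutoff
    ratio≡ = refl

    base≡ : base ≡ 32 * (ratio * (Δ * Δ)) ^ Δ
    base≡ = refl

    minSize≡ : minSize ≡ 32 * cutoff * suc (slackOf Δ) + E * base ^ ratio + 4 * slackOf Δ + 1
    minSize≡ = refl

module AsymmetricAlmostSurely {n : ℕ} (d : Fin n → ℕ) (Δ : ℕ) (1≤Δ : 1 ≤ Δ) (d≥1 : ∀ i → 1 ≤ d i) (d≤Δ : ∀ i → d i ≤ Δ)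
    (E : ℕ) (1≤E : 1 ≤ E) (graphical : Graphical d) where
  open AsymmetricParameters Δ E
  open BoundedDegree d Δ d≤Δ
  open LightVertices d Δ d≤Δ

  private
    t : ℕ
    t = ∑𝒢 d (λ _ → 1)
    G₀ : Graph n
    G₀ = proj₁ graphical
    1≤cutoff : 1 ≤ cutoff
    1≤cutoff = subst (1 ≤_) (sym cutoff≡) (≤-trans (s≤s z≤n) (≤-trans (*-monoʳ-≤ 4 {1} {1 + Δ} (s≤s z≤n)) (m≤n+m (4 * (1 + Δ)) (3 * (12 * scale * (12 * scale))))))

  instance
    cutoff≢0 : NonZero cutoff
    cutoff≢0 = >-nonZero 1≤cutoff

  module _ (large : minSize ≤ n)
           (n₁-few : ∀ k → k ≤ 4 * scale + 2 * ratio → k * n₁ * (k * n₁) ≤ n)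
           (n₂-few : ∀ k → k ≤ 12 * scale + ratio → k * n₂ ≤ n) where

    private
      N≤n : 32 * cutoff * suc slack + E * base ^ ratio + 4 * slack + 1 ≤ n
      N≤n = subst (_≤ n) minSize≡ large
      -- `M` separates the two ranges and `μ` is the number of edges. Codes save M/4 ≥ 8r pairs and
      -- lose at most r to light vertices, whence `Q`; the lower bound for the number of graphs
      -- gives up r edges, whence `J`. The margin is n^(6r).
      M r μ J Q : ℕ
      M = n / cutoff
      r = M / 32
      μ = length (GraphCount.edges d Δ d≤Δ G₀)
      J = μ ∸ r
      Q = μ ∸ 7 * r
      big small : Graph n → ℕ
      big G = ⟦ hasAut? (LargeSupport.large? d Δ d≥1 d≤Δ M) G ⟧
      open SmallSupportRare d Δ d≥1 d≤Δ E 1≤E using (small?; small-tangled-rare)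
      small-part₁ : 4 * scale * n₁ * (4 * scale * n₁) ≤ n
      small-part₁ = n₁-few (4 * scale) (m≤m+n (4 * scale) (2 * ratio))
      small-part₂ : 12 * scale * n₂ ≤ n
      small-part₂ = n₂-few (12 * scale) (m≤m+n (12 * scale) ratio)
      size₁ : 32 * cutoff * suc slack ≤ n
      size₁ = m+n≤o⇒m≤o (32 * cutoff * suc slack) (m+n≤o⇒m≤o (32 * cutoff * suc slack + E * base ^ ratio)
        (m+n≤o⇒m≤o (32 * cutoff * suc slack + E * base ^ ratio + 4 * slack) N≤n))
      size₂ : E * base ^ ratio ≤ n
      size₂ = m+n≤o⇒n≤o (32 * cutoff * suc slack) (m+n≤o⇒m≤o (32 * cutoff * suc slack + E * base ^ ratio)
        (m+n≤o⇒m≤o (32 * cutoff * suc slack + E * base ^ ratio + 4 * slack) N≤n))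
      size₃ : 4 * slack ≤ n
      size₃ = m+n≤o⇒n≤o (32 * cutoff * suc slack + E * base ^ ratio)
        (m+n≤o⇒m≤o (32 * cutoff * suc slack + E * base ^ ratio + 4 * slack) N≤n)
      1≤n : 1 ≤ n
      1≤n = m+n≤o⇒n≤o (32 * cutoff * suc slack + E * base ^ ratio + 4 * slack) N≤n
      small G = ∑ (allVecs n) (λ S → ⟦ small? small-part₁ small-part₂ size₃ S ⟧ * ⟦ tangled? S G ⟧)

      slack<r : suc slack ≤ r
      slack<r = ≤-/ (suc slack) 32 M (≤-/ (suc slack * 32) cutoff n (≤-trans (≤-reflexive (lem (suc slack) cutoff)) size₁))
        where
        lem : ∀ s c → s * 32 * c ≡ 32 * c * s
        lem = solve-∀
      1≤r : 1 ≤ r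
      1≤r = ≤-trans (s≤s z≤n) slack<r
      32r≤M : 32 * r ≤ M
      32r≤M = ≤-trans (≤-reflexive (*-comm 32 r)) (m/n*n≤m M 32)
      Mz≤n : M * cutoff ≤ n
      Mz≤n = m/n*n≤m n cutoff
      n≤ratio : n ≤ ratio * r
      n≤ratio = begin
        n                                    ≤⟨ /-upper n cutoff ⟩
        cutoff * suc M                       ≤⟨ *-monoʳ-≤ cutoff sM≤ ⟩
        cutoff * (32 * (r + r))              ≡⟨ trans (lem cutoff r) (cong (_* r) (sym ratio≡)) ⟩
        ratio * r                            ∎
        where
        open ≤-Reasoning
        lem : ∀ c r → c * (32 * (r + r)) ≡ 64 * c * r
        lem = solve-∀
        M<32 : suc M ≤ 32 * suc r
        M<32 = begin
          suc M                  ≡⟨ cong suc (m≡m%n+[m/n]*n M 32) ⟩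
          suc (M % 32) + r * 32  ≤⟨ +-monoˡ-≤ (r * 32) (m%n<n M 32) ⟩
          32 + r * 32            ≡⟨ lem₂ r ⟩
          32 * suc r             ∎
          where
          lem₂ : ∀ r → 32 + r * 32 ≡ 32 * suc r
          lem₂ = solve-∀
        sM≤ : suc M ≤ 32 * (r + r)
        sM≤ = ≤-trans M<32 (*-monoʳ-≤ 32 (+-monoˡ-≤ r 1≤r))
      1≤ratio : 1 ≤ ratio
      1≤ratio = subst (1 ≤_) (sym ratio≡) (*-mono-≤ {1} {64} (s≤s z≤n) 1≤cutoff)
      n₂≤r : n₂ ≤ r
      n₂≤r = cancel-≤ ratio 1≤ratio (≤-trans (n₂-few ratio (m≤n+m ratio (12 * scale))) n≤ratio)
      2n₁≤r : 2 * n₁ ≤ r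
      2n₁≤r = cancel-≤ ratio 1≤ratio (begin
        ratio * (2 * n₁)                     ≡⟨ lem ratio n₁ ⟩
        2 * ratio * n₁                       ≤⟨ x≤x² (2 * ratio * n₁) ⟩
        2 * ratio * n₁ * (2 * ratio * n₁)    ≤⟨ n₁-few (2 * ratio) (m≤n+m (2 * ratio) (4 * scale)) ⟩
        n                                    ≤⟨ n≤ratio ⟩
        ratio * r                            ∎)
        where
        open ≤-Reasoning
        lem : ∀ c n → c * (2 * n) ≡ 2 * c * n
        lem = solve-∀
        x≤x² : ∀ x → x ≤ x * x
        x≤x² zero = z≤n
        x≤x² (suc x) = m≤m+n (suc x) _
      2μ≡D : 2 * μ ≡ ∑F d
      2μ≡D = GraphCount.edge-count d Δ d≤Δ (proj₂ graphical)
      n≤D : n ≤ ∑F d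
      n≤D = ≤-trans (≤-reflexive (sym (trans (∑F-const {n} 1) (*-identityʳ n)))) (∑-mono (allFin n) d≥1)
      7r≤μ : 7 * r ≤ μ
      7r≤μ = cancel-≤ 2 (s≤s z≤n) (begin
        2 * (7 * r)          ≡⟨ *-assoc 2 7 r ⟨
        14 * r               ≤⟨ *-monoˡ-≤ r {14} {32} (m≤m+n 14 18) ⟩
        32 * r               ≤⟨ 32r≤M ⟩
        M                    ≡⟨ *-identityʳ M ⟨
        M * 1                ≤⟨ *-monoʳ-≤ M 1≤cutoff ⟩
        M * cutoff           ≤⟨ Mz≤n ⟩
        n                    ≤⟨ n≤D ⟩
        ∑F d                 ≡⟨ 2μ≡D ⟨
        2 * μ                ∎)
        where open ≤-Reasoning
      r≤μ : r ≤ μ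
      r≤μ = ≤-trans (m≤m+n r (6 * r)) 7r≤μ
      J≡ : J ≡ Q + 6 * r
      J≡ = +-cancelʳ-≡ r J (Q + 6 * r) (trans (m∸n+n≡m r≤μ) (trans (sym (m∸n+n≡m 7r≤μ)) (lem Q r)))
        where
        lem : ∀ q r → q + 7 * r ≡ q + 6 * r + r
        lem = solve-∀
      codes : ∀ q → 4 * q + M ≤ 2 * ∑F d + (4 * n₁ + 2 * n₂) → q ≤ Q
      codes q h = m+n≤o⇒m≤o∸n q (cancel-≤ 4 (s≤s z≤n) (+-cancelʳ-≤ (4 * r) (4 * (q + 7 * r)) (4 * μ) (begin
        4 * (q + 7 * r) + 4 * r
          ≡⟨ lem₁ q r ⟩
        4 * q + 32 * r
          ≤⟨ +-monoʳ-≤ (4 * q) 32r≤M ⟩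
        4 * q + M
          ≤⟨ h ⟩
        2 * ∑F d + (4 * n₁ + 2 * n₂)
          ≤⟨ +-mono-≤ (≤-reflexive (trans (cong (2 *_) (sym 2μ≡D)) (sym (*-assoc 2 2 μ)))) (≤-trans (≤-reflexive (lem₂ n₁ n₂)) (*-monoʳ-≤ 2 (+-mono-≤ 2n₁≤r n₂≤r))) ⟩
        4 * μ + 2 * (r + r)
          ≡⟨ cong (4 * μ +_) (lem₃ r) ⟩
        4 * μ + 4 * r ∎)))
        where
        open ≤-Reasoning
        lem₁ : ∀ q r → 4 * (q + 7 * r) + 4 * r ≡ 4 * q + 32 * r
        lem₁ = solve-∀
        lem₂ : ∀ a b → 4 * a + 2 * b ≡ 2 * (2 * a + b)
        lem₂ = solve-∀
        lem₃ : ∀ r → 2 * (r + r) ≡ 4 * r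
        lem₃ = solve-∀
      -- Giving up r edges leaves 2r half-edges free for switching: r of them serve as β and the
      -- other r cover `slack`.
      enough-edges : r + slack + 2 * J ≤ ∑F d
      enough-edges = begin
        r + slack + 2 * J    ≤⟨ +-monoˡ-≤ (2 * J) (+-monoʳ-≤ r (≤-trans (n≤1+n slack) slack<r)) ⟩
        r + r + 2 * J        ≡⟨ lem r J ⟩
        2 * (J + r)          ≡⟨ cong (2 *_) (m∸n+n≡m r≤μ) ⟩
        2 * μ                ≡⟨ 2μ≡D ⟩
        ∑F d                 ∎
        where
        open ≤-Reasoning
        lem : ∀ r J → r + r + 2 * J ≡ 2 * (J + r)
        lem = solve-∀
      many-graphs : n ^ J ≤ ((ratio * (Δ * Δ)) ^ Δ) ^ n * t
      many-graphs = begin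
        n ^ J                                   ≤⟨ ^-monoˡ-≤ J n≤ratio ⟩
        (ratio * r) ^ J                         ≡⟨ ^-distribʳ-* ratio r J ⟩
        ratio ^ J * r ^ J                       ≤⟨ *-monoʳ-≤ (ratio ^ J) (GraphCount.graph-count d Δ d≤Δ (proj₂ graphical) J r (m∸n≤m μ r) enough-edges) ⟩
        ratio ^ J * ((Δ * Δ) ^ J * t)           ≡⟨ *-assoc (ratio ^ J) ((Δ * Δ) ^ J) t ⟨
        ratio ^ J * (Δ * Δ) ^ J * t             ≡⟨ cong (_* t) (^-distribʳ-* ratio (Δ * Δ) J) ⟨
        (ratio * (Δ * Δ)) ^ J * t               ≤⟨ *-monoˡ-≤ t (^-mono (*-mono-≤ {1} 1≤ratio (*-mono-≤ {1} 1≤Δ 1≤Δ)) J≤Δn) ⟩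
        (ratio * (Δ * Δ)) ^ (Δ * n) * t         ≡⟨ cong (_* t) (^-*-assoc (ratio * (Δ * Δ)) Δ n) ⟨
        ((ratio * (Δ * Δ)) ^ Δ) ^ n * t         ∎
        where
        open ≤-Reasoning
        J≤Δn : J ≤ Δ * n
        J≤Δn = begin
          J             ≤⟨ m∸n≤m μ r ⟩
          μ             ≤⟨ m≤m+n μ _ ⟩
          2 * μ         ≡⟨ 2μ≡D ⟩
          ∑F d          ≤⟨ ∑-mono (allFin n) d≤Δ ⟩
          ∑F {n} (λ _ → Δ) ≡⟨ trans (∑F-const {n} Δ) (*-comm n Δ) ⟩
          Δ * n         ∎

      big-rare : E * ∑𝒢 d big ≤ t
      big-rare = cancel-≤ (n ^ (6 * r)) (^-pos (6 * r) 1≤n) (begin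
        n ^ (6 * r) * (E * ∑𝒢 d big)
          ≤⟨ *-monoʳ-≤ (n ^ (6 * r)) (*-monoʳ-≤ E (LargeSupport.large-aut-count d Δ d≥1 d≤Δ M Q 1≤n codes)) ⟩
        n ^ (6 * r) * (E * (n ^ Q * 32 ^ n))
          ≡⟨ lem₁ (n ^ (6 * r)) E (n ^ Q) (32 ^ n) ⟩
        E * 32 ^ n * (n ^ Q * n ^ (6 * r))
          ≡⟨ cong (E * 32 ^ n *_) (trans (sym (^-distribˡ-+-* n Q (6 * r))) (cong (n ^_) (sym J≡))) ⟩
        E * 32 ^ n * n ^ J
          ≤⟨ *-monoʳ-≤ (E * 32 ^ n) many-graphs ⟩
        E * 32 ^ n * (((ratio * (Δ * Δ)) ^ Δ) ^ n * t)
          ≡⟨ trans (lem₂ E (32 ^ n) (((ratio * (Δ * Δ)) ^ Δ) ^ n) t) (cong (λ k → E * k * t) (trans (sym (^-distribʳ-* 32 ((ratio * (Δ * Δ)) ^ Δ) n)) (cong (_^ n) (sym base≡)))) ⟩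
        E * base ^ n * t
          ≤⟨ *-monoˡ-≤ t absorb ⟩
        n ^ (6 * r) * t ∎)
        where
        open ≤-Reasoning
        lem₁ : ∀ a E q b → a * (E * (q * b)) ≡ E * b * (q * a)
        lem₁ = solve-∀
        lem₂ : ∀ E a b t → E * a * (b * t) ≡ E * (a * b) * t
        lem₂ = solve-∀
        1≤base : 1 ≤ base
        1≤base = subst (1 ≤_) (sym base≡) (*-mono-≤ {1} {32} (s≤s z≤n) (^-pos Δ (*-mono-≤ {1} 1≤ratio (*-mono-≤ {1} 1≤Δ 1≤Δ))))
        -- As n ≤ ratio · r, the exponential loss is at most (E · base^ratio)^r, hence at most n^r.
        absorb : E * base ^ n ≤ n ^ (6 * r)
        absorb = begin
          E * base ^ n                   ≤⟨ *-mono-≤ (≤-trans (≤-reflexive (sym (*-identityʳ E))) (^-mono {k = 1} 1≤E 1≤r)) (^-mono 1≤base n≤ratio) ⟩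
          E ^ r * base ^ (ratio * r)     ≡⟨ cong (E ^ r *_) (^-*-assoc base ratio r) ⟨
          E ^ r * (base ^ ratio) ^ r     ≡⟨ ^-distribʳ-* E (base ^ ratio) r ⟨
          (E * base ^ ratio) ^ r         ≤⟨ ^-monoˡ-≤ r size₂ ⟩
          n ^ r                          ≤⟨ ^-mono 1≤n (m≤m+n r (5 * r)) ⟩
          n ^ (6 * r)                    ∎

      symmetric⇒ : ∀ G → Symmetric G → 1 ≤ small G + big G
      symmetric⇒ G sym-G = split (symmetric⇒hasAut G sym-G)
        where
        split : HasAut Nonempty G → 1 ≤ small G + big G
        split (v , w , aut , x , x∈) = by (∣ S ∣ * cutoff ≤? n)
          where
          S : Vec Bool n
          S = moved (lookup v)
          1≤S : 1 ≤ ∣ S ∣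
          1≤S = ≤-trans (𝕀-T x∈) (term≤∑ (finE n) (λ i → 𝕀 (lookup S i)) x)
          by : Dec (∣ S ∣ * cutoff ≤ n) → 1 ≤ small G + big G
          by (yes fit) = ≤-trans (≤-trans
            (*-mono-≤ {1} (⟦⟧-≥1 (small? small-part₁ small-part₂ size₃ S) (1≤S , fit)) (⟦⟧-≥1 (tangled? S G) (moved-tangled aut)))
            (term≤∑ (vecE n) (λ S → ⟦ small? small-part₁ small-part₂ size₃ S ⟧ * ⟦ tangled? S G ⟧) S)) (m≤m+n (small G) (big G))
          -- A set with fewer than `M` elements would fit, because `M * cutoff ≤ n`.
          by (no ¬fit) = ≤-trans (⟦⟧-≥1 (hasAut? (LargeSupport.large? d Δ d≥1 d≤Δ M) G)
            (v , w , aut , ≮⇒≥ λ lt → ¬fit (≤-trans (*-monoˡ-≤ cutoff (<⇒≤ lt)) Mz≤n))) (m≤n+m (big G) (small G))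

    symmetric-rare : E * ∑𝒢 d (λ G → ⟦ ¬? (asymmetric? G) ⟧) ≤ 2 * t
    symmetric-rare = begin
      E * ∑𝒢 d (λ G → ⟦ ¬? (asymmetric? G) ⟧)
        ≤⟨ *-monoʳ-≤ E (∑𝒢-mono d (λ G _ → ⟦⟧≤ (¬? (asymmetric? G)) (symmetric⇒ G))) ⟩
      E * ∑𝒢 d (λ G → small G + big G)
        ≡⟨ trans (cong (E *_) (∑𝒢-+ d small big)) (*-distribˡ-+ E (∑𝒢 d small) (∑𝒢 d big)) ⟩
      E * ∑𝒢 d small + E * ∑𝒢 d big
        ≤⟨ +-mono-≤ (small-tangled-rare small-part₁ small-part₂ size₃) big-rare ⟩
      t + t
        ≡⟨ cong (t +_) (+-identityʳ t) ⟨
      2 * t ∎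
      where open ≤-Reasoning

theorem-a : (Δ : ℕ) → 1 ≤ Δ → (d : DegSeqs) → (∀ n i → 1 ≤ d n i × d n i ≤ Δ) →
  Eventually (λ n → Graphical (d n)) →
  (∀ (e : ℕ) → Eventually λ n → suc e * suc e * (nj (d n) 1 * nj (d n) 1) < n) →
  (∀ (e : ℕ) → Eventually λ n → suc e * nj (d n) 2 < n) →
  AAS d Asymmetric
theorem-a Δ 1≤Δ d range (N₀ , graphical) few₁ few₂ e = N₀ + (N₁ + (N₂ + minSize)) , λ n N≤n →
  let d≤Δ = λ i → proj₂ (range n i)
      d≥1 = λ i → proj₁ (range n i)
      N₀≤n = ≤-trans (m≤m+n N₀ _) N≤n
      rest = ≤-trans (m≤n+m _ N₀) N≤n
      N₁≤n = ≤-trans (m≤m+n N₁ _) rest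
      rest′ = ≤-trans (m≤n+m _ N₁) rest
      N₂≤n = ≤-trans (m≤m+n N₂ _) rest′
      size = ≤-trans (m≤n+m minSize N₂) rest′
      h₁ = subst (λ k → suc K₁ * suc K₁ * (k * k) ≤ n) (nj-1 (d n) Δ d≤Δ) (<⇒≤ (proj₂ (few₁ K₁) n N₁≤n))
      h₂ = subst (λ k → suc K₂ * k ≤ n) (nj-2 (d n) Δ d≤Δ) (<⇒≤ (proj₂ (few₂ K₂) n N₂≤n))
      rare = AsymmetricAlmostSurely.symmetric-rare (d n) Δ 1≤Δ d≥1 d≤Δ E (s≤s z≤n) (graphical n N₀≤n) size
               (λ k k≤ → ≤-trans (scaled k _ K₁ k≤) h₁) (λ k k≤ → ≤-trans (*-monoˡ-≤ _ (≤-trans k≤ (n≤1+n K₂))) h₂)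
  in ∑𝒢 (d n) (λ G → ⟦ asymmetric? G ⟧) , ∑𝒢 (d n) (λ _ → 1) , probCounts (d n) asymmetric? ,
     finish _ _ _ (∑𝒢-split (d n) asymmetric?) rare
  where
  E : ℕ
  -- Small and large supports each have probability at most 1/E, together 1/(e + 1).
  E = 2 * suc e
  open AsymmetricParameters Δ E
  K₁ K₂ N₁ N₂ : ℕ
  K₁ = 4 * scale + 2 * ratio
  K₂ = 12 * scale + ratio
  N₁ = proj₁ (few₁ K₁)
  N₂ = proj₁ (few₂ K₂)
  scaled : ∀ k m K → k ≤ K → k * m * (k * m) ≤ suc K * suc K * (m * m)
  scaled k m K k≤ = ≤-trans (≤-reflexive (lem k m)) (*-monoˡ-≤ (m * m) (*-mono-≤ (≤-trans k≤ (n≤1+n K)) (≤-trans k≤ (n≤1+n K))))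
    where
    lem : ∀ k m → k * m * (k * m) ≡ k * k * (m * m)
    lem = solve-∀
  finish : ∀ t b s → t ≡ b + s → E * b ≤ 2 * t → e * t ≤ suc e * s
  finish t b s refl h = ≤-trans (≤-reflexive (*-distribˡ-+ e b s)) (+-monoˡ-≤ (e * s) (+-cancelˡ-≤ b (e * b) s
    (cancel-≤ 2 (s≤s z≤n) (≤-trans (≤-reflexive (sym (*-assoc 2 (suc e) b))) h))))

theorem1p2 : (Δ : ℕ) → 1 ≤ Δ →
    ((d : DegSeqs) →
    (∀ n i → 1 ≤ d n i × d n i ≤ Δ) →
    Eventually (λ n → Graphical (d n)) →
    (∀ (e : ℕ) → Eventually λ n → suc e * suc e * (nj (d n) 1 * nj (d n) 1) < n) →
    (∀ (e : ℕ) → Eventually λ n → suc e * nj (d n) 2 < n) →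
    AAS d Asymmetric)
    ×
    ((d : DegSeqs) →
    (∀ n i → 1 ≤ d n i × d n i ≤ Δ) →
    Eventually (λ n → Graphical (d n)) →
    (∀ (M : ℕ) → Eventually λ n → M * M * n < nj (d n) 1 * nj (d n) 1) →
    AAS d Symmetric)
    ×
    ((p q : ℕ) → ∃ λ (e : ℕ) → (d : DegSeqs) →
    (∀ n i → 1 ≤ d n i × d n i ≤ Δ) →
    Eventually (λ n → Graphical (d n)) →
    Eventually (λ n →
    (suc p * suc p * n < suc q * suc q * (nj (d n) 1 * nj (d n) 1))
    ⊎ (suc p * n < suc q * nj (d n) 2)) →
    Eventually λ n → ∃ λ s → ∃ λ t →
    ProbCounts (d n) Symmetric s t × t < suc e * s)
theorem1p2 Δ 1≤Δ = theorem-a Δ 1≤Δ , theorem-b Δ 1≤Δ , theorem-c Δ
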